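{- Let $t > \ell \ge 3$ be fixed integers. Then for all sufficiently large $n$, \[ \mathrm{ar}(n,H_{F}^{3}) = \begin{cases} t_{3}(n,\ell) + \ell+1, & \text{if } F \in \{K_{\ell}^{\alpha}[t],\ K_{\ell}^{\beta}[t]\},\\ t_{3}(n,\ell) + 2, & \text{if } F = K_{\ell}^{\gamma}[t].\end{cases} \]
   Context: A 3-graph is a collection of 3-subsets of a finite vertex set. $K_n^3$ is the complete 3-graph on $[n]$. Given $\chi\colon K_n^3\to\mathbb{N}$, a subgraph is rainbow if no two of its edges receive the same color. $\mathrm{ar}(n,F)$ is the minimum $m$ such that every surjective map $\chi\colon K_n^3\to[m]$ contains a rainbow copy of the 3-graph $F$. For a graph $F$, the expansion $H_F^3$ is the 3-graph obtained from $F$ by adding to each edge one new vertex, different edges receiving different new vertices. $K_\ell[t]$ is the $t$-blowup of $K_\ell$, i.e. the complete $\ell$-partite graph with all parts of size $t$. $K_\ell^\alpha[t]$ is obtained from $K_\ell[t]$ by adding a path with two edges inside one part; $K_\ell^\beta[t]$ by adding two disjoint edges inside one part; $K_\ell^\gamma[t]$ by adding two edges inside two different parts (one edge in each). For $n\ge r$, let $V_1\sqcup\cdots\sqcup V_\ell=[n]$ with $|V_\ell|+1\ge|V_1|\ge\cdots\ge|V_\ell|$; $T_r(n,\ell)$ is the $r$-graph of all $r$-subsets of $[n]$ containing at most one vertex from each $V_i$, and $t_r(n,\ell)$ is its number of edges. -}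

module Defs where

open import Data.Nat using (ℕ; zero; suc; _+_; _*_; _≤_; _<_; _≡ᵇ_; _<ᵇ_; _%_)
open import Data.Bool using (Bool; true; false; _∧_; _∨_; not)
open import Data.Fin using (Fin; toℕ; quotient; remainder; _↑ˡ_; _↑ʳ_)
open import Data.Fin.Subset using (Subset; ⁅_⁆; _∪_; ∣_∣)
open import Data.List using (List; []; _∷_; length; lookup; map; concatMap; filterᵇ; allFin)
open import Data.Product using (Σ; ∃; _×_; _,_)
open import Function.Definitions using (Injective)
open import Relation.Binary.PropositionalEquality using (_≡_; _≢_)
open import Relation.Nullary using (¬_)

record Graph : Set where
  field
    nv    : ℕ
    edges : List (Fin nv × Fin nv)

record Hyp3 : Set where
  field
    nv : ℕ
    ne : ℕ
    edge : Fin ne → Fin nv × Fin nv × Fin nv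

expansion : Graph → Hyp3
expansion F = record
  { nv = Graph.nv F + length (Graph.edges F)
  ; ne = length (Graph.edges F)
  ; edge = λ i → mk (lookup (Graph.edges F) i) i
  }
  where
  mk : Fin (Graph.nv F) × Fin (Graph.nv F) → Fin (length (Graph.edges F))
     → Fin (Graph.nv F + length (Graph.edges F)) × Fin (Graph.nv F + length (Graph.edges F))
       × Fin (Graph.nv F + length (Graph.edges F))
  mk (u , v) i = (u ↑ˡ length (Graph.edges F)) , (v ↑ˡ length (Graph.edges F)) , (Graph.nv F ↑ʳ i)

-- Blow-ups K_ℓ[t] and the three variants.
-- Vertex x of Fin (ℓ * t) lies in part  toℕ (quotient t x)  with index
-- toℕ (remainder t x) inside that part.

data Variant : Set where
  plain α β γ : Variant

-- extra edges inside parts (p,q parts, i,j indices within parts, x < y)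
extra : Variant → ℕ → ℕ → ℕ → ℕ → Bool
extra plain p q i j = false
extra α p q i j = (p ≡ᵇ 0) ∧ (q ≡ᵇ 0) ∧
  (((i ≡ᵇ 0) ∧ (j ≡ᵇ 1)) ∨ ((i ≡ᵇ 1) ∧ (j ≡ᵇ 2)))
extra β p q i j = (p ≡ᵇ 0) ∧ (q ≡ᵇ 0) ∧
  (((i ≡ᵇ 0) ∧ (j ≡ᵇ 1)) ∨ ((i ≡ᵇ 2) ∧ (j ≡ᵇ 3)))
extra γ p q i j = (p ≡ᵇ q) ∧ ((p ≡ᵇ 0) ∨ (p ≡ᵇ 1)) ∧ (i ≡ᵇ 0) ∧ (j ≡ᵇ 1)

blowAdj : (v : Variant) (ℓ t : ℕ) → Fin (ℓ * t) → Fin (ℓ * t) → Bool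
blowAdj v ℓ t x y =
  (toℕ x <ᵇ toℕ y) ∧
  (not (p ≡ᵇ q) ∨ extra v p q (toℕ (remainder {ℓ} t x)) (toℕ (remainder {ℓ} t y)))
  where
  p = toℕ (quotient {ℓ} t x)
  q = toℕ (quotient {ℓ} t y)

allPairs : ∀ N → List (Fin N × Fin N)
allPairs N = concatMap (λ x → map (λ y → x , y) (allFin N)) (allFin N)

blowup : Variant → ℕ → ℕ → Graph
blowup v ℓ t = record
  { nv = ℓ * t
  ; edges = filterᵇ (λ { (x , y) → blowAdj v ℓ t x y }) (allPairs (ℓ * t))
  }

triple : ∀ {n} → Fin n × Fin n × Fin n → Subset n
triple (a , b , c) = ⁅ a ⁆ ∪ ⁅ b ⁆ ∪ ⁅ c ⁆

-- A coloring of K_n^3 with colors [m] (= Fin m); only its values on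
-- 3-subsets are ever used.
Coloring : ℕ → ℕ → Set
Coloring n m = Subset n → Fin m

Surjective3 : ∀ {n m} → Coloring n m → Set
Surjective3 {n} {m} χ = ∀ (c : Fin m) → ∃ λ (s : Subset n) → ∣ s ∣ ≡ 3 × χ s ≡ c

RainbowCopy : ∀ {n m} → Coloring n m → Hyp3 → Set
RainbowCopy {n} χ H =
  Σ (Fin (Hyp3.nv H) → Fin n) λ φ →
    Injective _≡_ _≡_ φ ×
    (∀ i j → i ≢ j → χ (triple (img φ (Hyp3.edge H i))) ≢ χ (triple (img φ (Hyp3.edge H j))))
  where
  img : (Fin (Hyp3.nv H) → Fin n) → Fin (Hyp3.nv H) × Fin (Hyp3.nv H) × Fin (Hyp3.nv H)
      → Fin n × Fin n × Fin n
  img φ (a , b , c) = φ a , φ b , φ c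

ArProperty : ℕ → Hyp3 → ℕ → Set
ArProperty n H m = ∀ (χ : Coloring n m) → Surjective3 χ → RainbowCopy χ H

IsAr : ℕ → Hyp3 → ℕ → Set
IsAr n H v = 1 ≤ v × ArProperty n H v × (∀ m → 1 ≤ m → m < v → ¬ ArProperty n H m)

-- Turán number t_3(n,ℓ): parts V_i = { x : x mod ℓ = i }, sizes
-- |V_1| ≥ ... ≥ |V_ℓ| ≥ |V_1| - 1.

triples : ∀ n → List (Fin n × Fin n × Fin n)
triples n = concatMap (λ a → concatMap (λ b → map (λ c → a , b , c) (allFin n)) (allFin n)) (allFin n)

t3 : ℕ → (ℓ : ℕ) → ℕ
t3 n zero = 0
t3 n (suc k) = length (filterᵇ ok (triples n))
  where
  ℓ = suc k
  ok : Fin n × Fin n × Fin n → Bool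
  ok (a , b , c) = (toℕ a <ᵇ toℕ b) ∧ (toℕ b <ᵇ toℕ c) ∧
    not ((toℕ a % ℓ) ≡ᵇ (toℕ b % ℓ)) ∧ not ((toℕ a % ℓ) ≡ᵇ (toℕ c % ℓ)) ∧
    not ((toℕ b % ℓ) ≡ᵇ (toℕ c % ℓ))

{-# OPTIONS --safe #-}
module Submission where

-- Lower bound: give the transversal triples of the balanced partition distinct colours and colour any other
-- triple by the part containing two of its vertices (for γ, all of them alike).  In a copy of the expansion the
-- partition induces a map from K_ℓ[t] to ℓ classes in which no class has two inner edges; as t > ℓ, it has to be
-- constant on each part, so both extra edges are inner.
--
-- Upper bound: choose one triple per colour and delete vertices of small degree; this only increases the excess
-- over the Turán number, so some large vertex set S with minimum degree at least that of the Turán 3-graph remains.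
-- Call a pair heavy if its codegree is at least a constant K; edges of the core mapped to heavy pairs can be
-- expanded greedily with new colours.  Since one extra edge may be taken to be an arbitrary triple, the heavy
-- pairs contain no K_ℓ[t] plus an edge.  By Erdős–Stone in the links, almost all vertices have heavy degree about
-- (1 - 1/ℓ)|S|, and classifying vertices by their neighbours in a large K_ℓ[T] gives ℓ parts that are nearly
-- complete to each other.  Any two triples having two vertices in the same part (for γ: in any parts) must then
-- have the same colour, which in turn forces every remaining vertex into one of the parts.  Hence at most ℓ
-- (for γ: one) of the chosen triples are not transversal.

open import Defs
import Data.Bool
open import Data.Bool using (Bool; true; false; _∧_; _∨_; not; if_then_else_)
import Data.Bool.Properties as Boolₚ
open import Data.Bool.Properties using (∧-zeroʳ; ∧-identityʳ; ∧-comm; ∧-assoc)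
open import Data.Empty using (⊥; ⊥-elim)
import Data.Fin
open import Data.Fin using (Fin; zero; suc; toℕ; combine; remQuot; splitAt; _↑ˡ_; _↑ʳ_; fromℕ<)
import Data.Fin.Properties as Finₚ
open import Data.Fin.Patterns
open import Data.Fin.Subset using (Subset; ⁅_⁆; _∪_; ∣_∣) renaming (_∈_ to _∈ₛ_)
import Data.Fin.Subset.Properties as Subₚ
open import Data.List using (List; []; _∷_; length; lookup; map; concatMap; filterᵇ; allFin; cartesianProduct; tabulate; _++_)
open import Data.List.Membership.Propositional using (_∈_; _∉_)
open import Data.List.Membership.Propositional.Properties using (∈-lookup; ∈-filter⁻; ∈-tabulate⁺; ∈-filter⁺; ∈-cartesianProduct⁺; ∈-allFin)
import Data.List.Properties as Listₚ
open import Data.List.Properties using (length-tabulate)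
open import Data.List.Relation.Unary.All as All using ()
open import Data.List.Relation.Unary.AllPairs using ([]; _∷_)
open import Data.List.Relation.Unary.Any using (here; there; index)
open import Data.List.Relation.Unary.Any.Properties using (lookup-index)
open import Data.List.Relation.Unary.Unique.Propositional using (Unique)
import Data.List.Relation.Unary.Unique.Propositional.Properties as Uniqueₚ
open import Data.Nat using (ℕ; zero; suc; pred; _+_; _*_; _∸_; _^_; _≤_; _<_; _≤?_; _<?_; z≤n; s≤s; NonZero; >-nonZero; _≡ᵇ_; _%_; _<ᵇ_; _⊓_)
open import Data.Nat.DivMod using (_mod_; m<n⇒m%n≡m; [m+kn]%n≡m%n; m%n<n)
open import Data.Nat.Properties hiding (_≟_)
open import Data.Nat.Tactic.RingSolver using (solve-∀)
open import Data.Product using (Σ; ∃; _×_; _,_; proj₁; proj₂; uncurry)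
open import Data.Product.Properties using (≡-dec)
open import Data.Sum using (_⊎_; inj₁; inj₂; [_,_]′)
open import Data.Unit using (tt; ⊤)
import Data.Vec as Vec
open import Data.Vec using (_∷_; [])
import Data.Vec.Properties as Vecₚ
open import Function using (_∘_; id; case_of_)
open import Relation.Binary.Definitions using (tri<; tri≈; tri>)
open import Relation.Binary.PropositionalEquality using (_≡_; _≢_; refl; sym; trans; cong; cong₂; subst; subst₂)
open import Relation.Nullary using (¬_; Dec; yes; no; does)
open import Relation.Nullary.Decidable using (dec-true; dec-false; T?; ¬?; _×-dec_; _→-dec_; _⊎-dec_; decidable-stable)
import Algebra.Properties.Semiring.Sum +-*-semiring as S

-- Finite sums and counting

-- All counting is over ordered tuples: `e3` is six times a Turán number, a colour weighs six, and
-- no division occurs. The two extra edges of the core may be expanded by arbitrary fresh vertices,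
-- not only along chosen triples. Hence the absence of a rainbow copy becomes an equality of colours
-- (`EmbProp`) that also reaches triples outside the chosen family. The obstacle is the exceptional
-- vertices. Erdős-Stone in a link speaks only about heavy pairs, and a bounded number of vertices
-- may have links full of light ones; others fit no class of the anchor. They are treated last, with
-- the minimum degree in triples: once inner triples of typical vertices are known to share a
-- colour, a link has hardly any pairs inside a part, so only a vertex joined almost completely to
-- all parts but one can have a link of the required size. The constants are chosen in the order
-- `E₁` (precision of the final parts, from ℓ and t), `E'` = 11 ℓ `E₁` (precision of the degrees),
-- `T` (part size of the anchor), and finally a bound for `q`, which is about the size of a part.

⟦_⟧ : Bool → ℕ
⟦ true ⟧ = 1
⟦ false ⟧ = 0

slack : ∀ {m n} → m ≤ n → ∃ λ d → n ≡ m + d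
slack {m} {n} h = n ∸ m , sym (m+[n∸m]≡n h)

infix 6 _==_
_==_ : ∀ {n} → Fin n → Fin n → Bool
x == y = does (x Finₚ.≟ y)

==-refl : ∀ {n} (x : Fin n) → (x == x) ≡ true
==-refl x = dec-true (x Finₚ.≟ x) refl

==⇒≡ : ∀ {n} {x y : Fin n} → (x == y) ≡ true → x ≡ y
==⇒≡ {x = x} {y} e with x Finₚ.≟ y
... | yes p = p

≢⇒== : ∀ {n} {x y : Fin n} → x ≢ y → (x == y) ≡ false
≢⇒== {x = x} {y} ne = dec-false (x Finₚ.≟ y) ne

does-true : ∀ {A : Set} (d : Dec A) → does d ≡ true → A
does-true (yes a) _ = a

does-false : ∀ {A : Set} (d : Dec A) → does d ≡ false → ¬ A
does-false (no ¬a) _ = ¬a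

true≢false : ∀ {b} → b ≡ true → b ≡ false → ⊥
true≢false refl ()

∧-proj₁ : ∀ {a b} → a ∧ b ≡ true → a ≡ true
∧-proj₁ {true} _ = refl

∧-proj₂ : ∀ {a b} → a ∧ b ≡ true → b ≡ true
∧-proj₂ {true} e = e

∧-intro : ∀ {a b} → a ≡ true → b ≡ true → a ∧ b ≡ true
∧-intro refl refl = refl

not-intro : ∀ {a} → a ≡ false → not a ≡ true
not-intro refl = refl

not-elim : ∀ {a} → not a ≡ true → a ≡ false
not-elim {false} _ = refl

⟦⟧-≤ : ∀ {b k} → (b ≡ true → 1 ≤ k) → ⟦ b ⟧ ≤ k
⟦⟧-≤ {true} f = f refl
⟦⟧-≤ {false} f = z≤n

⟦⟧≤1 : ∀ b → ⟦ b ⟧ ≤ 1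
⟦⟧≤1 true = ≤-refl
⟦⟧≤1 false = z≤n

⟦⟧-true : ∀ {b} → b ≡ true → 1 ≤ ⟦ b ⟧
⟦⟧-true refl = ≤-refl

⟦⟧-pos : ∀ {b} → 1 ≤ ⟦ b ⟧ → b ≡ true
⟦⟧-pos {true} _ = refl

⟦⟧-∧ : ∀ a b → ⟦ a ∧ b ⟧ ≡ ⟦ a ⟧ * ⟦ b ⟧
⟦⟧-∧ true b = sym (+-identityʳ _)
⟦⟧-∧ false b = refl

opaque
  sum : ∀ {n} → (Fin n → ℕ) → ℕ
  sum = S.sum

  sum-cong : ∀ {n} {f g : Fin n → ℕ} → (∀ x → f x ≡ g x) → sum f ≡ sum g
  sum-cong = S.sum-cong-≗

  sum-+ : ∀ {n} (f g : Fin n → ℕ) → sum (λ x → f x + g x) ≡ sum f + sum g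
  sum-+ = S.∑-distrib-+

  sum-swap : ∀ {m n} (f : Fin m → Fin n → ℕ) → sum (λ x → sum (λ y → f x y)) ≡ sum (λ y → sum (λ x → f x y))
  sum-swap = S.∑-comm

  *-sum : ∀ {n} c (f : Fin n → ℕ) → c * sum f ≡ sum (λ x → c * f x)
  *-sum = S.*-distribˡ-sum

  sum-* : ∀ {n} (f : Fin n → ℕ) c → sum f * c ≡ sum (λ x → f x * c)
  sum-* f c = S.*-distribʳ-sum c f

  sum-suc : ∀ {n} (f : Fin (suc n) → ℕ) → sum f ≡ f zero + sum (f ∘ suc)
  sum-suc f = refl

  sum-empty : (f : Fin 0 → ℕ) → sum f ≡ 0
  sum-empty f = refl

  sum-mono : ∀ {n} {f g : Fin n → ℕ} → (∀ x → f x ≤ g x) → sum f ≤ sum g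
  sum-mono {zero} h = z≤n
  sum-mono {suc n} h = +-mono-≤ (h zero) (sum-mono (h ∘ suc))

  sum-const : ∀ n c → sum {n} (λ _ → c) ≡ n * c
  sum-const zero c = refl
  sum-const (suc n) c = cong (c +_) (sum-const n c)

  sum-zero : ∀ n → sum {n} (λ _ → 0) ≡ 0
  sum-zero n = trans (sum-const n 0) (*-zeroʳ n)

  sum-<⇒∃ : ∀ {n} {f g : Fin n → ℕ} → sum f < sum g → ∃ λ x → f x < g x
  sum-<⇒∃ {suc n} {f} {g} h with f zero <? g zero
  ... | yes p = zero , p
  ... | no ¬p = case sum-<⇒∃ (+-cancelˡ-< (f zero) _ _ (<-≤-trans h (+-monoˡ-≤ _ (≮⇒≥ ¬p)))) of λ { (x , q) → suc x , q }

  term≤sum : ∀ {n} (f : Fin n → ℕ) x → f x ≤ sum f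
  term≤sum f zero = m≤m+n _ _
  term≤sum f (suc x) = ≤-trans (term≤sum (f ∘ suc) x) (m≤n+m _ _)

  sum-δ : ∀ {n} (v : Fin n) (f : Fin n → ℕ) → sum (λ x → ⟦ x == v ⟧ * f x) ≡ f v
  sum-δ {suc n} zero f = trans (cong₂ _+_ (+-identityʳ (f zero)) (sum-zero n)) (+-identityʳ _)
  sum-δ {suc n} (suc v) f = trans (sum-cong lem) (sum-δ v (f ∘ suc))
    where
    lem : ∀ x → ⟦ suc x == suc v ⟧ * f (suc x) ≡ ⟦ x == v ⟧ * f (suc x)
    lem x with x Finₚ.≟ v
    ... | yes _ = refl
    ... | no _ = refl

count : ∀ {n} → (Fin n → Bool) → ℕ
count p = sum (λ x → ⟦ p x ⟧)

infix 4 _⊑_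
_⊑_ : ∀ {n} → (Fin n → Bool) → (Fin n → Bool) → Set
p ⊑ q = ∀ x → p x ≡ true → q x ≡ true

count-mono : ∀ {n} {p q : Fin n → Bool} → p ⊑ q → count p ≤ count q
count-mono h = sum-mono λ x → ⟦⟧-≤ λ e → ⟦⟧-true (h x e)

count≤n : ∀ {n} (p : Fin n → Bool) → count p ≤ n
count≤n {n} p = ≤-trans (sum-mono (λ x → ⟦⟧≤1 (p x))) (≤-reflexive (trans (sum-const n 1) (*-identityʳ n)))

count-all : ∀ n → count {n} (λ _ → true) ≡ n
count-all n = trans (sum-const n 1) (*-identityʳ n)

count-pos : ∀ {n} {p : Fin n → Bool} x → p x ≡ true → 1 ≤ count p
count-pos {p = p} x e = ≤-trans (⟦⟧-true e) (term≤sum (λ y → ⟦ p y ⟧) x)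

count-∃ : ∀ {n} {p : Fin n → Bool} → 1 ≤ count p → ∃ λ x → p x ≡ true
count-∃ {n} {p} h = case sum-<⇒∃ {f = λ _ → 0} (subst (_< count p) (sym (sum-zero n)) h) of λ { (x , q) → x , ⟦⟧-pos q }

_∖_ : ∀ {n} → (Fin n → Bool) → Fin n → Fin n → Bool
(p ∖ v) x = p x ∧ not (x == v)

count-split : ∀ {n} (p q : Fin n → Bool) → count p ≡ count (λ x → p x ∧ q x) + count (λ x → p x ∧ not (q x))
count-split p q = trans (sum-cong lem) (sum-+ _ _)
  where
  lem : ∀ x → ⟦ p x ⟧ ≡ ⟦ p x ∧ q x ⟧ + ⟦ p x ∧ not (q x) ⟧
  lem x with p x | q x
  ... | true | true = refl
  ... | true | false = refl
  ... | false | _ = refl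

count-== : ∀ {n} (v : Fin n) → count (_== v) ≡ 1
count-== v = trans (sum-cong (λ x → sym (*-identityʳ _))) (sum-δ v (λ _ → 1))

count-∖ : ∀ {n} (p : Fin n → Bool) v → count p ≤ suc (count (p ∖ v))
count-∖ p v = ≤-trans (≤-reflexive (count-split p (_== v)))
  (+-monoˡ-≤ _ (≤-trans (count-mono {q = _== v} (λ x → ∧-proj₂)) (≤-reflexive (count-== v))))

count-∖-≡ : ∀ {n} (p : Fin n → Bool) v → p v ≡ true → count p ≡ suc (count (p ∖ v))
count-∖-≡ p v e = trans (count-split p (_== v)) (cong (_+ count (p ∖ v)) (trans (sum-cong lem) (count-== v)))
  where
  lem : ∀ x → ⟦ p x ∧ (x == v) ⟧ ≡ ⟦ x == v ⟧
  lem x with x Finₚ.≟ v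
  ... | yes refl rewrite e = refl
  ... | no _ = cong ⟦_⟧ (∧-zeroʳ (p x))

count-avoid : ∀ {n} (p q : Fin n → Bool) → (∀ x y → p x ≡ true → q x ≡ true → p y ≡ true → q y ≡ true → x ≡ y) →
  count p ≤ suc (count (λ x → p x ∧ not (q x)))
count-avoid p q uniq with 1 ≤? count (λ x → p x ∧ q x)
... | no ¬h = ≤-trans (≤-reflexive (count-split p q)) (+-monoˡ-≤ _ (≤-trans (≤-pred (≰⇒> ¬h)) z≤n))
... | yes h with count-∃ h
... | v , e = ≤-trans (≤-reflexive (count-split p q)) (+-monoˡ-≤ _
  (≤-trans (count-mono {q = _== v} λ x ex → subst (λ y → (x == y) ≡ true) (uniq x v (∧-proj₁ ex) (∧-proj₂ {p x} ex) (∧-proj₁ e) (∧-proj₂ {p v} e)) (==-refl x))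
    (≤-reflexive (count-== v))))

count-or : ∀ {n} {p q r : Fin n → Bool} → (∀ x → p x ≡ true → q x ≡ true ⊎ r x ≡ true) → count p ≤ count q + count r
count-or {p = p} {q} {r} h = ≤-trans (sum-mono lem) (≤-reflexive (sum-+ _ _))
  where
  lem : ∀ x → ⟦ p x ⟧ ≤ ⟦ q x ⟧ + ⟦ r x ⟧
  lem x = ⟦⟧-≤ λ e → case h x e of λ { (inj₁ a) → ≤-trans (⟦⟧-true a) (m≤m+n _ _) ; (inj₂ b) → ≤-trans (⟦⟧-true b) (m≤n+m _ _) }

sum-on : ∀ {n} (p : Fin n → Bool) {f : Fin n → ℕ} c → (∀ x → p x ≡ true → f x ≤ c) → sum (λ x → ⟦ p x ⟧ * f x) ≤ count p * c
sum-on p {f} c h = ≤-trans (sum-mono lem) (≤-reflexive (sym (sum-* _ c)))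
  where
  lem : ∀ x → ⟦ p x ⟧ * f x ≤ ⟦ p x ⟧ * c
  lem x with p x in e
  ... | true = +-monoˡ-≤ 0 (h x e)
  ... | false = z≤n

sum-on-≥ : ∀ {n} (p : Fin n → Bool) {f : Fin n → ℕ} c → (∀ x → p x ≡ true → c ≤ f x) → count p * c ≤ sum (λ x → ⟦ p x ⟧ * f x)
sum-on-≥ p {f} c h = ≤-trans (≤-reflexive (sum-* _ c)) (sum-mono lem)
  where
  lem : ∀ x → ⟦ p x ⟧ * c ≤ ⟦ p x ⟧ * f x
  lem x with p x in e
  ... | true = +-monoˡ-≤ 0 (h x e)
  ... | false = z≤n

select : ∀ {n} t (p : Fin n → Bool) → t ≤ count p →
  Σ (Fin t → Fin n) λ κ → (∀ r r' → κ r ≡ κ r' → r ≡ r') × (∀ r → p (κ r) ≡ true)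
select zero p h = (λ ()) , (λ ()) , (λ ())
select {n} (suc t) p h with count-∃ (≤-trans (s≤s z≤n) h)
... | v , e with select t (p ∖ v) (≤-pred (≤-trans h (count-∖ p v)))
... | κ , inj , ok = κ' , inj' , ok'
  where
  κ' : Fin (suc t) → Fin n
  κ' zero = v
  κ' (suc r) = κ r
  ne : ∀ r → κ r ≢ v
  ne r eq = true≢false (∧-proj₂ {p (κ r)} (ok r)) (subst (λ y → not (κ r == y) ≡ false) eq (cong not (==-refl (κ r))))
  inj' : ∀ r r' → κ' r ≡ κ' r' → r ≡ r'
  inj' zero zero eq = refl
  inj' zero (suc r') eq = ⊥-elim (ne r' (sym eq))
  inj' (suc r) zero eq = ⊥-elim (ne r eq)
  inj' (suc r) (suc r') eq = cong suc (inj r r' eq)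
  ok' : ∀ r → p (κ' r) ≡ true
  ok' zero = e
  ok' (suc r) = ∧-proj₁ (ok r)

decide∃ : ∀ {n} (p : Fin n → Bool) → (∃ λ x → p x ≡ true) ⊎ (∀ x → p x ≡ false)
decide∃ {n} p with 1 ≤? count p
... | yes h = inj₁ (count-∃ h)
... | no ¬h = inj₂ λ x → lem x (p x) refl
  where
  lem : ∀ x b → p x ≡ b → b ≡ false
  lem x true e = ⊥-elim (¬h (count-pos x e))
  lem x false e = refl

-- Deleting a vertex of degree below Θ s - Θ (s - 1) raises the excess of μ over Θ; d records the total gain.
delete : ∀ {n} (μ : (Fin n → Bool) → ℕ) (deg : (Fin n → Bool) → Fin n → ℕ) (Θ : ℕ → ℕ) →
  (∀ P v → P v ≡ true → μ P ≤ μ (P ∖ v) + deg P v) →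
  ∀ s a P → count P ≡ s → Θ s + a ≤ μ P →
  Σ (Fin n → Bool) λ Q → Σ ℕ λ s' → Σ ℕ λ d →
    (Q ⊑ P) × count Q ≡ s' × s ≡ s' + d × Θ s' + (a + d) ≤ μ Q ×
    (∀ v → Q v ≡ true → Θ s' ≤ Θ (pred s') + deg Q v)
delete μ deg Θ step zero a P cP h =
  P , 0 , 0 , (λ _ e → e) , cP , refl , subst (λ k → Θ 0 + k ≤ μ P) (sym (+-identityʳ a)) h , λ v _ → m≤m+n _ _
delete μ deg Θ step (suc s) a P cP h with decide∃ (λ v → P v ∧ does (Θ s + deg P v <? Θ (suc s)))
... | inj₂ none = P , suc s , 0 , (λ _ e → e) , cP , sym (+-identityʳ _) , subst (λ k → Θ (suc s) + k ≤ μ P) (sym (+-identityʳ a)) h , ok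
  where
  ok : ∀ v → P v ≡ true → Θ (suc s) ≤ Θ s + deg P v
  ok v e = ≮⇒≥ (does-false (Θ s + deg P v <? Θ (suc s)) (subst (λ b → b ∧ does (Θ s + deg P v <? Θ (suc s)) ≡ false) e (none v)))
... | inj₁ (v , e) with delete μ deg Θ step s (suc a) (P ∖ v) (suc-injective (trans (sym (count-∖-≡ P v (∧-proj₁ e))) cP)) h'
  where
  lt : Θ s + deg P v < Θ (suc s)
  lt = does-true (Θ s + deg P v <? Θ (suc s)) (∧-proj₂ {P v} e)
  h' : Θ s + suc a ≤ μ (P ∖ v)
  h' = +-cancelʳ-≤ (deg P v) _ _ (≤-trans (≤-reflexive (lem (Θ s) a (deg P v)))
    (≤-trans (+-monoˡ-≤ a lt) (≤-trans h (step P v (∧-proj₁ e)))))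
    where
    lem : ∀ x a d → x + suc a + d ≡ suc (x + d) + a
    lem = solve-∀
... | Q , s' , d , sub , cQ , eq , big , ok =
  Q , s' , suc d , (λ x q → ∧-proj₁ (sub x q)) , cQ , trans (cong suc eq) (sym (+-suc s' d)) ,
  subst (λ k → Θ s' + k ≤ μ Q) (sym (+-suc a d)) big , ok

-- Erdős–Stone

-- Splitting by one predicate after the other and keeping the larger half costs a factor 2 each
-- time.
homogenize : ∀ {n} N (r : Fin N → Fin n → Bool) (X : Fin n → Bool) →
  Σ (Fin n → Bool) λ Y → (Y ⊑ X) × count X ≤ 2 ^ N * count Y × (∀ i x y → Y x ≡ true → Y y ≡ true → r i x ≡ r i y)
homogenize zero r X = X , (λ _ e → e) , ≤-reflexive (sym (+-identityʳ _)) , λ ()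
homogenize {n} (suc N) r X with homogenize N (r ∘ suc) X
... | Y , sub , big , hom = case ≤-total (count Y₀) (count Y₁) of λ
      { (inj₁ h) → Y₁ , (λ x e → sub x (∧-proj₁ e)) , bound h ≤-refl , same₁
      ; (inj₂ h) → Y₀ , (λ x e → sub x (∧-proj₁ e)) , bound ≤-refl h , same₀ }
  where
  Y₁ Y₀ : Fin n → Bool
  Y₁ x = Y x ∧ r zero x
  Y₀ x = Y x ∧ not (r zero x)
  bound : ∀ {k} → count Y₀ ≤ k → count Y₁ ≤ k → count X ≤ 2 ^ suc N * k
  bound {k} h₀ h₁ = ≤-trans big (≤-trans (*-monoʳ-≤ (2 ^ N) (≤-trans (≤-reflexive (count-split Y (r zero))) (+-mono-≤ h₁ h₀)))
    (≤-reflexive (lem (2 ^ N) k)))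
    where
    lem : ∀ a k → a * (k + k) ≡ (a + (a + 0)) * k
    lem = solve-∀
  same₁ : ∀ i x y → Y₁ x ≡ true → Y₁ y ≡ true → r i x ≡ r i y
  same₁ zero x y ex ey = trans (∧-proj₂ {Y x} ex) (sym (∧-proj₂ {Y y} ey))
  same₁ (suc i) x y ex ey = hom i x y (∧-proj₁ ex) (∧-proj₁ ey)
  same₀ : ∀ i x y → Y₀ x ≡ true → Y₀ y ≡ true → r i x ≡ r i y
  same₀ zero x y ex ey = trans (not-elim (∧-proj₂ {Y x} ex)) (sym (not-elim (∧-proj₂ {Y y} ey)))
  same₀ (suc i) x y ex ey = hom i x y (∧-proj₁ ex) (∧-proj₁ ey)

decide∀ : ∀ {n} (p : Fin n → Bool) → (∀ x → p x ≡ true) ⊎ (∃ λ x → p x ≡ false)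
decide∀ p = case decide∃ (λ x → not (p x)) of λ
  { (inj₁ (x , e)) → inj₂ (x , not-elim e)
  ; (inj₂ none) → inj₁ λ x → flip' (p x) (none x) }
  where
  flip' : ∀ b → not b ≡ false → b ≡ true
  flip' true _ = refl

all : ∀ {n} → (Fin n → Bool) → Bool
all p with decide∀ p
... | inj₁ _ = true
... | inj₂ _ = false

all-true : ∀ {n} (p : Fin n → Bool) → all p ≡ true → ∀ x → p x ≡ true
all-true p e with decide∀ p
... | inj₁ h = h

all-false : ∀ {n} (p : Fin n → Bool) → all p ≡ false → ∃ λ x → p x ≡ false
all-false p e with decide∀ p
... | inj₂ h = h

any : ∀ {n} → (Fin n → Bool) → Bool
any p = not (all (λ x → not (p x)))

any-true : ∀ {n} (p : Fin n → Bool) → any p ≡ true → ∃ λ x → p x ≡ true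
any-true p e = case all-false _ (not-elim e) of λ { (x , ne) → x , flip' (p x) ne }
  where
  flip' : ∀ b → not b ≡ false → b ≡ true
  flip' true _ = refl

any-intro : ∀ {n} (p : Fin n → Bool) x → p x ≡ true → any p ≡ true
any-intro p x e with all (λ y → not (p y)) in eq
... | false = refl
... | true = ⊥-elim (true≢false e (not-elim (all-true _ eq x)))

-- K_ℓ[T] inside P; vertices of different parts differ because adj is irreflexive.
record Blow {n} (adj : Fin n → Fin n → Bool) (P : Fin n → Bool) (ℓ T : ℕ) : Set where
  field
    κ     : Fin ℓ → Fin T → Fin n
    inP   : ∀ p r → P (κ p r) ≡ true
    inj   : ∀ p r r' → κ p r ≡ κ p r' → r ≡ r'
    cross : ∀ p p' r r' → p ≢ p' → adj (κ p r) (κ p' r') ≡ true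

-- Vertices that suffice for `buildBlow`: first `i` parts of size `4ET`, from which `T` vertices
-- each survive; then a new part, for which a fraction `1/(4E)` of all vertices is suitable and
-- `homogenize` over the `i * 4ET` old vertices costs the power of two.
n₀ : (E i T : ℕ) → ℕ
n₀ E zero T = 0
n₀ E (suc i) T = n₀ E i (4 * E * T) + 4 * E * (2 ^ (i * (4 * E * T)) * T)

module SimpleGraph {n : ℕ} (adj : Fin n → Fin n → Bool) (adj-sym : ∀ x y → adj x y ≡ adj y x) (adj-irr : ∀ x → adj x x ≡ false) where

  deg : (Fin n → Bool) → Fin n → ℕ
  deg P v = count (λ x → P x ∧ adj v x)

  codeg : (Fin n → Bool) → Fin n → ℕ
  codeg P v = count (λ x → P x ∧ not (adj v x))

  edges : (Fin n → Bool) → ℕ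
  edges P = sum λ v → ⟦ P v ⟧ * deg P v

  deg+codeg : ∀ P v → count P ≡ deg P v + codeg P v
  deg+codeg P v = count-split P (adj v)

  -- The hypothesis `sparse` bounds each codegree by `(1 - 1/(2E)) / (j + 1)` times `count P`, so a
  -- blow-up with at most `j + 1` parts can always be extended by one more.
  module _ (j E' : ℕ) (P : Fin n → Bool)
           (sparse : ∀ v → P v ≡ true → 2 * (suc j * suc E') * codeg P v + count P ≤ 2 * suc E' * count P) where

    private
      E = suc E'
      p = count P

    -- Double counting of the non-adjacent pairs between `P` and the core, whose parts have size
    -- `A = 4ET`. On average a vertex misses at most `(1 - 1/(2E)) A` core vertices, whereas one
    -- with fewer than `T` neighbours in some part misses at least `A - T = (1 - 1/(4E)) A` there.
    -- So a fraction `1/(4E)` of `P` has `T` neighbours in every part, and `homogenize` finds `T` of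
    -- them with the same neighbours.
    extend : ∀ i T → i ≤ suc j → 1 ≤ T → 4 * E * (2 ^ (i * (4 * E * T)) * T) ≤ p →
      Blow adj P i (4 * E * T) → Blow adj P (suc i) T
    extend i T i≤j 1≤T big K = result
      where
      open Blow K
      A D : ℕ
      A = 4 * E * T
      D = (4 * E' + 3) * T
      A≡ : A ≡ T + D
      A≡ = lem E' T
        where
        lem : ∀ e t → 4 * suc e * t ≡ t + (4 * e + 3) * t
        lem = solve-∀

      nbrs : Fin n → Fin i → ℕ
      nbrs x q = count (λ r → adj x (κ q r))
      good : Fin n → Fin i → Bool
      good x q = does (T ≤? nbrs x q)
      ext nonext : Fin n → Bool
      ext x = P x ∧ all (good x)
      nonext x = P x ∧ not (all (good x))

      miss : Fin n → ℕ
      miss x = sum λ q → sum λ r → ⟦ not (adj x (κ q r)) ⟧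

      miss-big : ∀ x → nonext x ≡ true → D ≤ miss x
      miss-big x e with all-false (good x) (not-elim (∧-proj₂ {P x} e))
      ... | q , eq = ≤-trans (+-cancelˡ-≤ T _ _ (≤-trans (≤-reflexive (sym A≡)) h)) (term≤sum (λ q → sum λ r → ⟦ not (adj x (κ q r)) ⟧) q)
        where
        h : A ≤ T + count (λ r → not (adj x (κ q r)))
        h = ≤-trans (≤-reflexive (trans (sym (count-all A)) (count-split (λ _ → true) (λ r → adj x (κ q r)))))
              (+-monoˡ-≤ _ (<⇒≤ (≰⇒> (does-false (T ≤? nbrs x q) eq))))

      total : sum (λ x → ⟦ P x ⟧ * miss x) ≡ sum (λ q → sum λ r → codeg P (κ q r))
      total = trans (sum-cong λ x → trans (*-sum ⟦ P x ⟧ _) (sum-cong λ q → *-sum ⟦ P x ⟧ _))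
        (trans (sum-swap _) (sum-cong λ q → trans (sum-swap _) (sum-cong λ r → sum-cong λ x → lem x q r)))
        where
        lem : ∀ x q r → ⟦ P x ⟧ * ⟦ not (adj x (κ q r)) ⟧ ≡ ⟦ P x ∧ not (adj (κ q r) x) ⟧
        lem x q r = trans (sym (⟦⟧-∧ (P x) _)) (cong (λ b → ⟦ P x ∧ not b ⟧) (adj-sym x _))

      total-≤ : 2 * (suc j * E) * sum (λ x → ⟦ P x ⟧ * miss x) + i * A * p ≤ i * A * (2 * E * p)
      total-≤ = begin
        2 * (suc j * E) * sum (λ x → ⟦ P x ⟧ * miss x) + i * A * p
          ≡⟨ cong₂ _+_ (trans (cong (2 * (suc j * E) *_) total) (trans (*-sum (2 * (suc j * E)) _) (sum-cong λ q → *-sum (2 * (suc j * E)) _))) (sym (const₂ p)) ⟩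
        sum (λ q → sum λ r → 2 * (suc j * E) * codeg P (κ q r)) + sum (λ q → sum λ r → p)
          ≡⟨ sym (trans (sum-cong λ q → sum-+ _ _) (sum-+ _ _)) ⟩
        sum (λ q → sum λ r → 2 * (suc j * E) * codeg P (κ q r) + p)
          ≤⟨ sum-mono (λ q → sum-mono λ r → sparse (κ q r) (inP q r)) ⟩
        sum (λ (q : Fin i) → sum λ (r : Fin A) → 2 * E * p)
          ≡⟨ const₂ (2 * E * p) ⟩
        i * A * (2 * E * p) ∎
        where
        open ≤-Reasoning
        const₂ : ∀ c → sum (λ (q : Fin i) → sum λ (r : Fin A) → c) ≡ i * A * c
        const₂ c = trans (sum-cong λ q → sum-const A c) (trans (sum-const i _) (sym (*-assoc i A c)))

      X Y : ℕ
      X = count nonext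
      Y = count ext

      X-≤ : X * D ≤ sum (λ x → ⟦ P x ⟧ * miss x)
      X-≤ = ≤-trans (sum-on-≥ nonext D miss-big) (sum-mono λ x → *-monoˡ-≤ (miss x) (⟦⟧-≤ {nonext x} {⟦ P x ⟧} λ e → ⟦⟧-true (∧-proj₁ {P x} e)))

      p-≤ : p ≤ 4 * E * Y
      p-≤ = +-cancelʳ-≤ ((4 * E' + 2) * p) p _ (begin
        p + (4 * E' + 2) * p ≡⟨ l₁ E' p ⟩
        (4 * E' + 3) * p ≡⟨ cong ((4 * E' + 3) *_) (count-split P (all ∘ good)) ⟩
        (4 * E' + 3) * (Y + X) ≡⟨ l₂ E' Y X ⟩
        (4 * E' + 3) * Y + X * (4 * E' + 3) ≤⟨ +-mono-≤ (*-monoˡ-≤ Y (l₃ E')) X≤ ⟩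
        4 * E * Y + (4 * E' + 2) * p ∎)
        where
        open ≤-Reasoning
        l₁ : ∀ e p → p + (4 * e + 2) * p ≡ (4 * e + 3) * p
        l₁ = solve-∀
        l₂ : ∀ e y x → (4 * e + 3) * (y + x) ≡ (4 * e + 3) * y + x * (4 * e + 3)
        l₂ = solve-∀
        l₃ : ∀ e → 4 * e + 3 ≤ 4 * suc e
        l₃ e = ≤-trans (m≤m+n _ 1) (≤-reflexive (lem e))
          where
          lem : ∀ e → 4 * e + 3 + 1 ≡ 4 * suc e
          lem = solve-∀
        h₁ : 2 * (suc j * E) * (X * D) ≤ suc j * A * ((2 * E' + 1) * p)
        h₁ = ≤-trans (+-cancelʳ-≤ (i * A * p) _ (i * A * ((2 * E' + 1) * p))
               (≤-trans (+-monoˡ-≤ _ (*-monoʳ-≤ (2 * (suc j * E)) X-≤)) (≤-trans total-≤ (≤-reflexive (lem i A E' p)))))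
               (*-monoˡ-≤ _ (*-monoˡ-≤ A i≤j))
          where
          lem : ∀ i a e p → i * a * (2 * suc e * p) ≡ i * a * ((2 * e + 1) * p) + i * a * p
          lem = solve-∀
        nz : NonZero (2 * suc j * E * T)
        nz = m*n≢0 (2 * suc j * E) T
          where instance
            t≠0 : NonZero T
            t≠0 = >-nonZero 1≤T
        X≤ : X * (4 * E' + 3) ≤ (4 * E' + 2) * p
        X≤ = *-cancelˡ-≤ (2 * suc j * E * T) ⦃ nz ⦄ (≤-trans (≤-reflexive (la j E X T E')) (≤-trans h₁ (≤-reflexive (lb j E' T p))))
          where
          la : ∀ j e x t e' → 2 * suc j * e * t * (x * (4 * e' + 3)) ≡ 2 * (suc j * e) * (x * ((4 * e' + 3) * t))
          la = solve-∀
          lb : ∀ j e t p → suc j * (4 * suc e * t) * ((2 * e + 1) * p) ≡ 2 * suc j * suc e * t * ((4 * e + 2) * p)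
          lb = solve-∀

      rel : Fin (i * A) → Fin n → Bool
      rel k x = adj x (uncurry κ (remQuot A k))

      result : Blow adj P (suc i) T
      result with homogenize (i * A) rel ext
      ... | Z , sub , bigZ , hom with T ≤? count Z
      ... | no T≰ = ⊥-elim (<⇒≱ (<-≤-trans (*-monoʳ-< (4 * E) (*-monoʳ-< (2 ^ (i * A)) ⦃ m^n≢0 2 (i * A) ⦄ (≰⇒> T≰))) big)
              (≤-trans p-≤ (*-monoʳ-≤ (4 * E) bigZ)))
      ... | yes T≤ with select T Z T≤
      ... | new , new-inj , new-Z = record { κ = κ' ; inP = inP' ; inj = inj' ; cross = cross' }
        where
        -- All members of `Z` have the same core neighbours, so those of the single vertex `x₀`
        -- decide which `T` vertices of each old part are kept.
        x₀ : Fin n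
        x₀ = proj₁ (count-∃ (≤-trans 1≤T T≤))
        Zx₀ : Z x₀ ≡ true
        Zx₀ = proj₂ (count-∃ (≤-trans 1≤T T≤))
        common : ∀ q → Σ (Fin T → Fin A) λ s → (∀ r r' → s r ≡ s r' → r ≡ r') × (∀ r → adj x₀ (κ q (s r)) ≡ true)
        common q = select T (λ r → adj x₀ (κ q r)) (does-true (T ≤? nbrs x₀ q) (all-true (good x₀) (∧-proj₂ {P x₀} (sub x₀ Zx₀)) q))
        κ' : Fin (suc i) → Fin T → Fin n
        κ' zero r = new r
        κ' (suc q) r = κ q (proj₁ (common q) r)
        inP' : ∀ q r → P (κ' q r) ≡ true
        inP' zero r = ∧-proj₁ (sub _ (new-Z r))
        inP' (suc q) r = inP q _
        inj' : ∀ q r r' → κ' q r ≡ κ' q r' → r ≡ r'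
        inj' zero r r' e = new-inj r r' e
        inj' (suc q) r r' e = proj₁ (proj₂ (common q)) r r' (inj q _ _ e)
        new-adj : ∀ r q r' → adj (new r) (κ' (suc q) r') ≡ true
        new-adj r q r' = trans (sym (un (new r))) (trans (hom (combine q s) (new r) x₀ (new-Z r) Zx₀) (trans (un x₀) (proj₂ (proj₂ (common q)) r')))
          where
          s = proj₁ (common q) r'
          un : ∀ x → rel (combine q s) x ≡ adj x (κ q s)
          un x = cong (λ k → adj x (uncurry κ k)) (Finₚ.remQuot-combine q s)
        cross' : ∀ q q' r r' → q ≢ q' → adj (κ' q r) (κ' q' r') ≡ true
        cross' zero zero r r' ne = ⊥-elim (ne refl)
        cross' zero (suc q') r r' ne = new-adj r q' r'
        cross' (suc q) zero r r' ne = trans (adj-sym _ _) (new-adj r' q r)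
        cross' (suc q) (suc q') r r' ne = cross q q' _ _ (ne ∘ cong suc)

    buildBlow : ∀ i T → i ≤ suc (suc j) → 1 ≤ T → n₀ E i T ≤ p → Blow adj P i T
    buildBlow zero T _ _ _ = record { κ = λ () ; inP = λ () ; inj = λ () ; cross = λ () }
    buildBlow (suc i) T i≤ 1≤T big = extend i T (≤-pred i≤) 1≤T (≤-trans (m≤n+m _ (n₀ E i (4 * E * T))) big)
      (buildBlow i (4 * E * T) (≤-trans (n≤1+n i) i≤) (≤-trans 1≤T (m≤n*m T (4 * E))) (≤-trans (m≤m+n _ _) big))

  edges-∖ : ∀ P v → P v ≡ true → edges P ≤ edges (P ∖ v) + 2 * deg P v
  edges-∖ P v _ = begin
    edges P ≡⟨ flat P ⟩
    sum (λ x → sum λ y → ⟦ P x ∧ (P y ∧ adj x y) ⟧) ≤⟨ sum-mono (λ x → sum-mono (pt x)) ⟩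
    sum (λ x → sum λ y → ⟦ (P ∖ v) x ∧ ((P ∖ v) y ∧ adj x y) ⟧ + (⟦ x == v ⟧ * ⟦ P y ∧ adj v y ⟧ + ⟦ y == v ⟧ * ⟦ P x ∧ adj v x ⟧))
      ≡⟨ trans (sum-cong λ x → trans (sum-+ _ _) (cong (sum (λ y → ⟦ (P ∖ v) x ∧ ((P ∖ v) y ∧ adj x y) ⟧) +_) (sum-+ _ _))) (trans (sum-+ _ _) (cong (sum (λ x → sum λ y → ⟦ (P ∖ v) x ∧ ((P ∖ v) y ∧ adj x y) ⟧) +_) (sum-+ _ _))) ⟩
    sum (λ x → sum λ y → ⟦ (P ∖ v) x ∧ ((P ∖ v) y ∧ adj x y) ⟧) +
      (sum (λ x → sum λ y → ⟦ x == v ⟧ * ⟦ P y ∧ adj v y ⟧) + sum (λ x → sum λ y → ⟦ y == v ⟧ * ⟦ P x ∧ adj v x ⟧))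
      ≡⟨ cong₂ _+_ (sym (flat (P ∖ v))) (trans (cong₂ _+_ (trans (sum-cong λ x → sym (*-sum ⟦ x == v ⟧ (λ y → ⟦ P y ∧ adj v y ⟧))) (sum-δ v (λ _ → deg P v)))
            (sum-cong λ x → sum-δ v (λ _ → ⟦ P x ∧ adj v x ⟧))) (cong (deg P v +_) (sym (+-identityʳ _)))) ⟩
    edges (P ∖ v) + 2 * deg P v ∎
    where
    open ≤-Reasoning
    flat : ∀ Q → edges Q ≡ sum (λ x → sum λ y → ⟦ Q x ∧ (Q y ∧ adj x y) ⟧)
    flat Q = sum-cong λ x → trans (*-sum ⟦ Q x ⟧ _) (sum-cong λ y → sym (⟦⟧-∧ (Q x) _))
    pt : ∀ x y → ⟦ P x ∧ (P y ∧ adj x y) ⟧ ≤ ⟦ (P ∖ v) x ∧ ((P ∖ v) y ∧ adj x y) ⟧ + (⟦ x == v ⟧ * ⟦ P y ∧ adj v y ⟧ + ⟦ y == v ⟧ * ⟦ P x ∧ adj v x ⟧)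
    pt x y with x Finₚ.≟ v | y Finₚ.≟ v
    ... | yes refl | _ = ⟦⟧-≤ λ e → ≤-trans (⟦⟧-true (∧-proj₂ {P x} e))
          (≤-trans (≤-reflexive (sym (+-identityʳ ⟦ P y ∧ adj x y ⟧))) (≤-trans (m≤m+n (⟦ P y ∧ adj x y ⟧ + 0) _) (m≤n+m (⟦ P y ∧ adj x y ⟧ + 0 + _) ⟦ (P x ∧ false) ∧ _ ⟧)))
    ... | no _ | yes refl = ⟦⟧-≤ λ e → ≤-trans (⟦⟧-true {P x ∧ adj y x} (∧-intro (∧-proj₁ {P x} e) (trans (adj-sym y x) (∧-proj₂ {P y} (∧-proj₂ {P x} e)))))
          (≤-trans (≤-reflexive (sym (+-identityʳ ⟦ P x ∧ adj y x ⟧))) (m≤n+m (⟦ P x ∧ adj y x ⟧ + 0) ⟦ (P x ∧ true) ∧ ((P y ∧ false) ∧ adj x y) ⟧))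
    ... | no _ | no _ = ⟦⟧-≤ λ e → ≤-trans (⟦⟧-true {(P x ∧ true) ∧ ((P y ∧ true) ∧ adj x y)}
           (∧-intro (∧-intro (∧-proj₁ {P x} e) refl) (∧-intro (∧-intro (∧-proj₁ {P y} (∧-proj₂ {P x} e)) refl) (∧-proj₂ {P y} (∧-proj₂ {P x} e))))) (m≤m+n _ 0)

  edges-≤ : ∀ P → edges P ≤ count P * count P
  edges-≤ P = sum-on P (count P) λ x _ → count-mono λ y → ∧-proj₁

blow-⊑ : ∀ {n} {adj : Fin n → Fin n → Bool} {P Q ℓ T} → P ⊑ Q → Blow adj P ℓ T → Blow adj Q ℓ T
blow-⊑ sub K = record { κ = κ ; inP = λ q r → sub _ (inP q r) ; inj = inj ; cross = cross }
  where open Blow K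

-- The sum `b + a` of the proof below: `b` pays for the linear term of `Θ`, and `a` is an excess too
-- large for fewer than `N` vertices.
n₁ : (j E T : ℕ) → ℕ
n₁ j E T = (2 * (j * E) + 1) + (2 * (suc j * E) * (N * N) + 1)
  where N = n₀ E (suc (suc j)) T

module _ {n : ℕ} (adj : Fin n → Fin n → Bool) (adj-sym : ∀ x y → adj x y ≡ adj y x) (adj-irr : ∀ x → adj x x ≡ false) where
  open SimpleGraph adj adj-sym adj-irr

  -- The hypothesis says that P has density at least 1 - 1/(j+1) + 1/((j+1)E), where E = E' + 1.
  erdős-stone : ∀ j E' T P → 1 ≤ T → n₁ j (suc E') T ≤ count P →
    (j * suc E' + 1) * (count P * count P) ≤ suc j * suc E' * edges P → Blow adj P (suc (suc j)) T
  erdős-stone j E' T P 1≤T big dense with delete (λ Q → 2 * W * edges Q) (λ Q v → 2 * W * (2 * deg Q v)) Θ step p a P refl start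
    where
    E = suc E'
    W = suc j * E
    p = count P
    N = n₀ E (suc (suc j)) T
    b = 2 * (j * E) + 1
    a = 2 * W * (N * N) + 1
    -- The density `b / (2W)` lies halfway between `1 - 1/(j+1)` and the given one; the other half
    -- of the surplus becomes the initial excess `a`. As `s * suc s` has increments `2s`, surviving
    -- vertices have degree at least `b / (2W)` times the size.
    Θ : ℕ → ℕ
    Θ s = b * (s * suc s)
    step : ∀ Q v → Q v ≡ true → 2 * W * edges Q ≤ 2 * W * edges (Q ∖ v) + 2 * W * (2 * deg Q v)
    step Q v e = ≤-trans (*-monoʳ-≤ (2 * W) (edges-∖ Q v e)) (≤-reflexive (*-distribˡ-+ (2 * W) (edges (Q ∖ v)) (2 * deg Q v)))
    start : Θ p + a ≤ 2 * W * edges P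
    start = begin
      b * (p * suc p) + a ≡⟨ l₁ b p a ⟩
      b * (p * p) + (b * p + a * 1) ≤⟨ +-monoʳ-≤ (b * (p * p)) (+-monoʳ-≤ (b * p) (*-monoʳ-≤ a (≤-trans (m≤m+n 1 (b + (2 * W * (N * N)))) (≤-trans (≤-reflexive (l₀ b (2 * W * (N * N)))) big)))) ⟩
      b * (p * p) + (b * p + a * p) ≡⟨ cong (b * (p * p) +_) (sym (*-distribʳ-+ p b a)) ⟩
      b * (p * p) + (b + a) * p ≤⟨ +-monoʳ-≤ (b * (p * p)) (*-monoˡ-≤ p big) ⟩
      b * (p * p) + p * p ≡⟨ l₂ (j * E) (p * p) ⟩
      2 * ((j * E + 1) * (p * p)) ≤⟨ *-monoʳ-≤ 2 dense ⟩
      2 * (W * edges P) ≡⟨ sym (*-assoc 2 W _) ⟩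
      2 * W * edges P ∎
      where
      open ≤-Reasoning
      l₀ : ∀ b x → 1 + (b + x) ≡ b + (x + 1)
      l₀ = solve-∀
      l₁ : ∀ b p a → b * (p * suc p) + a ≡ b * (p * p) + (b * p + a * 1)
      l₁ = solve-∀
      l₂ : ∀ c x → (2 * c + 1) * x + x ≡ 2 * ((c + 1) * x)
      l₂ = solve-∀
  ... | Q , s , d , sub , cQ , eq , bigQ , min = blow-⊑ sub
        (buildBlow j E' Q sparse (suc (suc j)) T ≤-refl 1≤T large)
    where
    E = suc E'
    W = suc j * E
    N = n₀ E (suc (suc j)) T
    b = 2 * (j * E) + 1
    a = 2 * W * (N * N) + 1
    -- Fewer than `N` vertices span at most `N * N` ordered edges, which is less than the excess `a`
    -- requires.
    large : N ≤ count Q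
    large with N ≤? count Q
    ... | yes h = h
    ... | no ¬h = ⊥-elim (<⇒≱ (≤-refl {suc (2 * W * (N * N))}) (begin
      suc (2 * W * (N * N)) ≡⟨ +-comm 1 _ ⟩
      a ≤⟨ ≤-trans (m≤m+n a d) (m≤n+m _ (b * (s * suc s))) ⟩
      b * (s * suc s) + (a + d) ≤⟨ bigQ ⟩
      2 * W * edges Q ≤⟨ *-monoʳ-≤ (2 * W) (≤-trans (edges-≤ Q) (*-mono-≤ (<⇒≤ (≰⇒> ¬h)) (<⇒≤ (≰⇒> ¬h)))) ⟩
      2 * W * (N * N) ∎))
      where open ≤-Reasoning
    sparse : ∀ v → Q v ≡ true → 2 * W * codeg Q v + count Q ≤ 2 * E * count Q
    sparse v e = +-cancelʳ-≤ (2 * (j * E) * count Q) _ _ (begin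
      2 * W * codeg Q v + count Q + 2 * (j * E) * count Q ≡⟨ l₁ (2 * W * codeg Q v) (count Q) (j * E) ⟩
      2 * W * codeg Q v + b * count Q ≤⟨ +-monoʳ-≤ (2 * W * codeg Q v) mindeg ⟩
      2 * W * codeg Q v + 2 * W * deg Q v ≡⟨ l₂ W (codeg Q v) (deg Q v) ⟩
      2 * W * (deg Q v + codeg Q v) ≡⟨ cong (2 * W *_) (sym (deg+codeg Q v)) ⟩
      2 * W * count Q ≡⟨ l₃ j E (count Q) ⟩
      2 * E * count Q + 2 * (j * E) * count Q ∎)
      where
      open ≤-Reasoning
      l₁ : ∀ x c y → x + c + 2 * y * c ≡ x + (2 * y + 1) * c
      l₁ = solve-∀
      l₂ : ∀ w c y → 2 * w * c + 2 * w * y ≡ 2 * w * (y + c)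
      l₂ = solve-∀
      l₃ : ∀ j e c → 2 * (suc j * e) * c ≡ 2 * e * c + 2 * (j * e) * c
      l₃ = solve-∀
      mindeg : b * count Q ≤ 2 * W * deg Q v
      mindeg = subst (λ k → b * k ≤ 2 * W * deg Q v) (sym cQ) (go s refl)
        where
        go : ∀ r → r ≡ s → b * r ≤ 2 * W * deg Q v
        go zero _ = ≤-trans (≤-reflexive (*-zeroʳ b)) z≤n
        go (suc r) refl = *-cancelˡ-≤ 2 (+-cancelˡ-≤ (b * (r * suc r)) _ _ (≤-trans (≤-reflexive (la b r)) (≤-trans (min v e) (≤-reflexive (lb (b * (r * suc r)) W (deg Q v))))))
          where
          la : ∀ b r → b * (r * suc r) + 2 * (b * suc r) ≡ b * (suc r * suc (suc r))
          la = solve-∀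
          lb : ∀ x w y → x + 2 * w * (2 * y) ≡ x + 2 * (2 * w * y)
          lb = solve-∀

-- Triples of vertices

tri : ∀ {n} → Fin n → Fin n → Fin n → Subset n
tri x y z = triple (x , y , z)

tri-sym₁ : ∀ {n} (x y z : Fin n) → tri x y z ≡ tri y x z
tri-sym₁ x y z = trans (sym (Subₚ.∪-assoc ⁅ x ⁆ ⁅ y ⁆ ⁅ z ⁆)) (trans (cong (_∪ ⁅ z ⁆) (Subₚ.∪-comm ⁅ x ⁆ ⁅ y ⁆)) (Subₚ.∪-assoc ⁅ y ⁆ ⁅ x ⁆ ⁅ z ⁆))

tri-sym₂ : ∀ {n} (x y z : Fin n) → tri x y z ≡ tri x z y
tri-sym₂ x y z = cong (⁅ x ⁆ ∪_) (Subₚ.∪-comm ⁅ y ⁆ ⁅ z ⁆)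

∈-tri⁻ : ∀ {n} {x y z u : Fin n} → u ∈ₛ tri x y z → u ≡ x ⊎ u ≡ y ⊎ u ≡ z
∈-tri⁻ {x = x} {y} {z} h with Subₚ.x∈p∪q⁻ ⁅ x ⁆ (⁅ y ⁆ ∪ ⁅ z ⁆) h
... | inj₁ a = inj₁ (Subₚ.x∈⁅y⁆⇒x≡y x a)
... | inj₂ b with Subₚ.x∈p∪q⁻ ⁅ y ⁆ ⁅ z ⁆ b
... | inj₁ c = inj₂ (inj₁ (Subₚ.x∈⁅y⁆⇒x≡y y c))
... | inj₂ c = inj₂ (inj₂ (Subₚ.x∈⁅y⁆⇒x≡y z c))

∈-tri₁ : ∀ {n} (x y z : Fin n) → x ∈ₛ tri x y z
∈-tri₁ x y z = Subₚ.x∈p∪q⁺ {p = ⁅ x ⁆} (inj₁ (Subₚ.x∈⁅x⁆ x))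

∈-tri₂ : ∀ {n} (x y z : Fin n) → y ∈ₛ tri x y z
∈-tri₂ x y z = subst (y ∈ₛ_) (tri-sym₁ y x z) (∈-tri₁ y x z)

∈-tri₃ : ∀ {n} (x y z : Fin n) → z ∈ₛ tri x y z
∈-tri₃ x y z = subst (z ∈ₛ_) (tri-sym₂ x z y) (∈-tri₂ x z y)

-- A rainbow set of triples inside S, given by the ordered triples.
record Family {n m : ℕ} (χ : Coloring n m) : Set where
  field
    S      : Fin n → Bool
    g      : Fin n → Fin n → Fin n → Bool
    g-sym₁ : ∀ x y z → g x y z ≡ g y x z
    g-sym₂ : ∀ x y z → g x y z ≡ g x z y
    g-≢    : ∀ {x y z} → g x y z ≡ true → x ≢ y
    g-S    : ∀ {x y z} → g x y z ≡ true → S x ≡ true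
    g-inj  : ∀ {x y z x' y' z'} → g x y z ≡ true → g x' y' z' ≡ true → χ (tri x y z) ≡ χ (tri x' y' z') → tri x y z ≡ tri x' y' z'

  g-≢₁₃ : ∀ {x y z} → g x y z ≡ true → x ≢ z
  g-≢₁₃ {x} {y} {z} e = g-≢ (trans (sym (g-sym₂ x y z)) e)

  g-≢₂₃ : ∀ {x y z} → g x y z ≡ true → y ≢ z
  g-≢₂₃ {x} {y} {z} e = g-≢₁₃ (trans (sym (g-sym₁ x y z)) e)

  -- Along a fixed pair the family has no repeated colours, so a forbidden colour excludes at most
  -- one extension of the pair.
  g-inj₃ : ∀ {x y z z'} → g x y z ≡ true → g x y z' ≡ true → χ (tri x y z) ≡ χ (tri x y z') → z ≡ z'
  g-inj₃ {x} {y} {z} {z'} e e' c with ∈-tri⁻ (subst (z ∈ₛ_) (g-inj e e' c) (∈-tri₃ x y z))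
  ... | inj₁ a = ⊥-elim (g-≢₁₃ e (sym a))
  ... | inj₂ (inj₁ a) = ⊥-elim (g-≢₂₃ e (sym a))
  ... | inj₂ (inj₂ a) = a

-- Greedy choice of expansion vertices

-- By injectivity of `f` on `p` each entry of `Y` costs one element at most. It is applied to
-- vertices (`f = id`) and to colours.
avoid : ∀ {n} {B : Set} (_≟B_ : (x y : B) → Dec (x ≡ y)) (f : Fin n → B) (Y : List B) (p : Fin n → Bool) c →
  (∀ x y → p x ≡ true → p y ≡ true → f x ≡ f y → x ≡ y) → length Y + c ≤ count p →
  Σ (Fin n → Bool) λ q → (q ⊑ p) × c ≤ count q × (∀ x → q x ≡ true → f x ∉ Y)
avoid _≟B_ f [] p c inj h = p , (λ _ e → e) , h , λ _ _ ()
avoid {n} _≟B_ f (y ∷ Y) p c inj h with avoid _≟B_ f Y p' c (λ a b pa pb → inj a b (∧-proj₁ pa) (∧-proj₁ pb)) h'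
  where
  p' : Fin n → Bool
  p' x = p x ∧ not (does (f x ≟B y))
  h' : length Y + c ≤ count p'
  h' = ≤-pred (≤-trans h (count-avoid p (λ x → does (f x ≟B y)) λ a b pa qa pb qb →
    inj a b pa pb (trans (does-true (f a ≟B y) qa) (sym (does-true (f b ≟B y) qb)))))
... | q , sub , big , out = q , (λ x e → ∧-proj₁ (sub x e)) , big , out'
  where
  out' : ∀ x → q x ≡ true → f x ∉ y ∷ Y
  out' x e (here eq) = does-false (f x ≟B y) (not-elim (∧-proj₂ {p x} (sub x e))) eq
  out' x e (there m) = out x e m

-- The `special` indices take the prescribed vertices `pre`, and distinctness is recorded for the
-- other indices only; `X` and `Y` therefore have to contain the prescribed vertices and their
-- colours from the start.
record Greedy {n m k : ℕ} (cand : Fin k → Fin n → Bool) (col : Fin k → Fin n → Fin m) (special : Fin k → Bool)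
              (pre : Fin k → Fin n) (X : List (Fin n)) (Y : List (Fin m)) : Set where
  field
    w     : Fin k → Fin n
    isPre : ∀ i → special i ≡ true → w i ≡ pre i
    isCand : ∀ i → special i ≡ false → cand i (w i) ≡ true
    w∉X   : ∀ i → special i ≡ false → w i ∉ X
    c∉Y   : ∀ i → special i ≡ false → col i (w i) ∉ Y
    w≢    : ∀ i j → i ≢ j → special i ≡ false → special j ≡ false → w i ≢ w j
    c≢    : ∀ i j → i ≢ j → special i ≡ false → special j ≡ false → col i (w i) ≢ col j (w j)

module _ {n m k : ℕ} {cand : Fin (suc k) → Fin n → Bool} {col : Fin (suc k) → Fin n → Fin m} {special : Fin (suc k) → Bool}
         {pre : Fin (suc k) → Fin n} {X : List (Fin n)} {Y : List (Fin m)} where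

  greedy-skip : special zero ≡ true → Greedy (cand ∘ suc) (col ∘ suc) (special ∘ suc) (pre ∘ suc) X Y → Greedy cand col special pre X Y
  greedy-skip eq G = record
    { w = λ { zero → pre zero ; (suc i) → G.w i }
    ; isPre = λ { zero _ → refl ; (suc i) → G.isPre i }
    ; isCand = λ { zero e → ⊥-elim (true≢false eq e) ; (suc i) → G.isCand i }
    ; w∉X = λ { zero e → ⊥-elim (true≢false eq e) ; (suc i) → G.w∉X i }
    ; c∉Y = λ { zero e → ⊥-elim (true≢false eq e) ; (suc i) → G.c∉Y i }
    ; w≢ = λ { zero _ _ e _ → ⊥-elim (true≢false eq e) ; (suc i) zero _ _ e → ⊥-elim (true≢false eq e)
             ; (suc i) (suc j) ne → G.w≢ i j (ne ∘ cong suc) }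
    ; c≢ = λ { zero _ _ e _ → ⊥-elim (true≢false eq e) ; (suc i) zero _ _ e → ⊥-elim (true≢false eq e)
             ; (suc i) (suc j) ne → G.c≢ i j (ne ∘ cong suc) }
    }
    where module G = Greedy G

  greedy-cons : special zero ≡ false → ∀ v → cand zero v ≡ true → v ∉ X → col zero v ∉ Y →
    Greedy (cand ∘ suc) (col ∘ suc) (special ∘ suc) (pre ∘ suc) (v ∷ X) (col zero v ∷ Y) → Greedy cand col special pre X Y
  greedy-cons eq v cv v∉X c∉Y G = record
    { w = λ { zero → v ; (suc i) → G.w i }
    ; isPre = λ { zero e → ⊥-elim (true≢false e eq) ; (suc i) → G.isPre i }
    ; isCand = λ { zero e → cv ; (suc i) → G.isCand i }
    ; w∉X = λ { zero e → v∉X ; (suc i) e → G.w∉X i e ∘ there }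
    ; c∉Y = λ { zero e → c∉Y ; (suc i) e → G.c∉Y i e ∘ there }
    ; w≢ = λ { zero zero ne _ _ _ → ne refl ; zero (suc j) _ _ e q → G.w∉X j e (here (sym q)) ; (suc i) zero _ e _ q → G.w∉X i e (here q)
             ; (suc i) (suc j) ne → G.w≢ i j (ne ∘ cong suc) }
    ; c≢ = λ { zero zero ne _ _ _ → ne refl ; zero (suc j) _ _ e q → G.c∉Y j e (here (sym q)) ; (suc i) zero _ e _ q → G.c∉Y i e (here q)
             ; (suc i) (suc j) ne → G.c≢ i j (ne ∘ cong suc) }
    }
    where module G = Greedy G

greedy-pick : ∀ {n m} (cand : Fin n → Bool) (col : Fin n → Fin m) (X : List (Fin n)) (Y : List (Fin m)) →
  (∀ x y → cand x ≡ true → cand y ≡ true → col x ≡ col y → x ≡ y) → length X + (length Y + 1) ≤ count cand →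
  ∃ λ v → cand v ≡ true × v ∉ X × col v ∉ Y
greedy-pick cand col X Y inj big with avoid Finₚ._≟_ id X cand (length Y + 1) (λ _ _ _ _ e → e) big
... | q , sub , bigq , out with avoid Finₚ._≟_ col Y q 1 (λ x y a b → inj x y (sub x a) (sub y b)) bigq
... | q' , sub' , bigq' , out' with count-∃ bigq'
... | v , e = v , sub v (sub' v e) , out v (sub' v e) , out' v e

-- The bound `K` stays the same during the recursion: a choice adds one vertex to `X` and one colour
-- to `Y` and takes 2 off `2 * k`.
greedy : ∀ {n m} k (cand : Fin k → Fin n → Bool) (col : Fin k → Fin n → Fin m) (special : Fin k → Bool) (pre : Fin k → Fin n)
  (X : List (Fin n)) (Y : List (Fin m)) K → length X + length Y + 2 * k ≤ K →
  (∀ i → special i ≡ false → K ≤ count (cand i)) →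
  (∀ i → special i ≡ false → ∀ x y → cand i x ≡ true → cand i y ≡ true → col i x ≡ col i y → x ≡ y) →
  Greedy cand col special pre X Y
greedy zero cand col special pre X Y K h big inj =
  record { w = λ () ; isPre = λ () ; isCand = λ () ; w∉X = λ () ; c∉Y = λ () ; w≢ = λ () ; c≢ = λ () }
greedy (suc k) cand col special pre X Y K h big inj with special zero in eq
... | true = greedy-skip eq (greedy k (cand ∘ suc) (col ∘ suc) (special ∘ suc) (pre ∘ suc) X Y K
      (≤-trans (+-monoʳ-≤ (length X + length Y) (*-monoʳ-≤ 2 (n≤1+n k))) h) (big ∘ suc) (inj ∘ suc))
... | false = case greedy-pick (cand zero) (col zero) X Y (inj zero eq) (≤-trans (≤-trans (m≤m+n _ (1 + 2 * k)) (≤-trans (≤-reflexive (l₁ (length X) (length Y) k)) h)) (big zero eq)) of λ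
  { (v , cv , v∉X , c∉Y) → greedy-cons eq v cv v∉X c∉Y (greedy k (cand ∘ suc) (col ∘ suc) (special ∘ suc) (pre ∘ suc) (v ∷ X) (col zero v ∷ Y) K
      (≤-trans (≤-reflexive (l₂ (length X) (length Y) k)) h) (big ∘ suc) (inj ∘ suc)) }
  where
  l₁ : ∀ a b k → a + (b + 1) + (1 + 2 * k) ≡ a + b + 2 * suc k
  l₁ = solve-∀
  l₂ : ∀ a b k → suc a + suc b + 2 * k ≡ a + b + 2 * suc k
  l₂ = solve-∀

-- The edges of the blow-ups

eqᵇ : ∀ {m n} → (m ≡ᵇ n) ≡ true → m ≡ n
eqᵇ {m} {n} e = ≡ᵇ⇒≡ m n (subst Data.Bool.T (sym e) tt)

∨-elim : ∀ {a b} → a ∨ b ≡ true → a ≡ true ⊎ b ≡ true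
∨-elim {true} _ = inj₁ refl
∨-elim {false} e = inj₂ e

Pos : ℕ → ℕ → Set
Pos ℓ t = Fin ℓ × Fin t

module _ {l t' : ℕ} where
  private
    ℓ t : ℕ
    ℓ = (2 + l)
    t = (4 + t')

  -- The two edges added inside parts (e₂ plain is a dummy value).
  e₁ : Pos ℓ t × Pos ℓ t
  e₁ = (zero , zero) , (zero , 1F)

  e₂ : Variant → Pos ℓ t × Pos ℓ t
  e₂ plain = (zero , 1F) , (zero , 2F)
  e₂ α = (zero , 1F) , (zero , 2F)
  e₂ β = (zero , 2F) , (zero , 3F)
  e₂ γ = (1F , zero) , (1F , 1F)

  pos : Fin (ℓ * t) → Pos ℓ t
  pos = remQuot {ℓ} t

  private
    pos≡ : ∀ {p : Pos ℓ t} {a i} → toℕ (proj₁ p) ≡ toℕ a → toℕ (proj₂ p) ≡ toℕ i → p ≡ (a , i)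
    pos≡ e f = cong₂ _,_ (Finₚ.toℕ-injective e) (Finₚ.toℕ-injective f)

  extra⇒ : ∀ v (p q : Pos ℓ t) → extra v (toℕ (proj₁ p)) (toℕ (proj₁ q)) (toℕ (proj₂ p)) (toℕ (proj₂ q)) ≡ true →
    (p , q) ≡ e₁ ⊎ (p , q) ≡ e₂ v
  extra⇒ α p@(a , i) q@(b , j) e = case ∨-elim (∧-proj₂ {toℕ b ≡ᵇ 0} r) of λ
      { (inj₁ h) → inj₁ (cong₂ _,_ (pos≡ {p} a0 (eqᵇ (∧-proj₁ {toℕ i ≡ᵇ 0} h))) (pos≡ {q} b0 (eqᵇ (∧-proj₂ {toℕ i ≡ᵇ 0} h))))
      ; (inj₂ h) → inj₂ (cong₂ _,_ (pos≡ {p} a0 (eqᵇ (∧-proj₁ {toℕ i ≡ᵇ 1} h))) (pos≡ {q} b0 (eqᵇ (∧-proj₂ {toℕ i ≡ᵇ 1} h)))) }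
    where
    r = ∧-proj₂ {toℕ a ≡ᵇ 0} e
    a0 : toℕ a ≡ 0
    a0 = eqᵇ (∧-proj₁ {toℕ a ≡ᵇ 0} e)
    b0 : toℕ b ≡ 0
    b0 = eqᵇ (∧-proj₁ {toℕ b ≡ᵇ 0} r)
  extra⇒ β p@(a , i) q@(b , j) e = case ∨-elim (∧-proj₂ {toℕ b ≡ᵇ 0} r) of λ
      { (inj₁ h) → inj₁ (cong₂ _,_ (pos≡ {p} a0 (eqᵇ (∧-proj₁ {toℕ i ≡ᵇ 0} h))) (pos≡ {q} b0 (eqᵇ (∧-proj₂ {toℕ i ≡ᵇ 0} h))))
      ; (inj₂ h) → inj₂ (cong₂ _,_ (pos≡ {p} a0 (eqᵇ (∧-proj₁ {toℕ i ≡ᵇ 2} h))) (pos≡ {q} b0 (eqᵇ (∧-proj₂ {toℕ i ≡ᵇ 2} h)))) }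
    where
    r = ∧-proj₂ {toℕ a ≡ᵇ 0} e
    a0 : toℕ a ≡ 0
    a0 = eqᵇ (∧-proj₁ {toℕ a ≡ᵇ 0} e)
    b0 : toℕ b ≡ 0
    b0 = eqᵇ (∧-proj₁ {toℕ b ≡ᵇ 0} r)
  extra⇒ γ p@(a , i) q@(b , j) e = case ∨-elim (∧-proj₁ {(toℕ a ≡ᵇ 0) ∨ (toℕ a ≡ᵇ 1)} r) of λ
      { (inj₁ h) → inj₁ (cong₂ _,_ (pos≡ {p} (eqᵇ h) i0) (pos≡ {q} (trans (sym ab) (eqᵇ h)) j1))
      ; (inj₂ h) → inj₂ (cong₂ _,_ (pos≡ {p} (eqᵇ h) i0) (pos≡ {q} (trans (sym ab) (eqᵇ h)) j1)) }
    where
    ab : toℕ a ≡ toℕ b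
    ab = eqᵇ (∧-proj₁ {toℕ a ≡ᵇ toℕ b} e)
    r = ∧-proj₂ {toℕ a ≡ᵇ toℕ b} e
    s = ∧-proj₂ {(toℕ a ≡ᵇ 0) ∨ (toℕ a ≡ᵇ 1)} r
    i0 : toℕ i ≡ 0
    i0 = eqᵇ (∧-proj₁ {toℕ i ≡ᵇ 0} s)
    j1 : toℕ j ≡ 1
    j1 = eqᵇ (∧-proj₂ {toℕ i ≡ᵇ 0} s)

  blowAdj⇒ : ∀ v x y → blowAdj v ℓ t x y ≡ true →
    proj₁ (pos x) ≢ proj₁ (pos y) ⊎ (pos x , pos y) ≡ e₁ ⊎ (pos x , pos y) ≡ e₂ v
  blowAdj⇒ v x y e = case ∨-elim (∧-proj₂ {toℕ x Data.Nat.<ᵇ toℕ y} e) of λ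
    { (inj₁ h) → inj₁ λ eq → true≢false (subst (λ z → (toℕ (proj₁ (pos x)) ≡ᵇ toℕ z) ≡ true) eq (≡ᵇ-refl (toℕ (proj₁ (pos x))))) (not-elim h)
    ; (inj₂ h) → inj₂ (extra⇒ v (pos x) (pos y) h) }
    where
    ≡ᵇ-refl : ∀ k → (k ≡ᵇ k) ≡ true
    ≡ᵇ-refl zero = refl
    ≡ᵇ-refl (suc k) = ≡ᵇ-refl k

  pos-injective : ∀ {x y} → pos x ≡ pos y → x ≡ y
  pos-injective {x} {y} e = trans (sym (Finₚ.combine-remQuot {ℓ} t x)) (trans (cong (uncurry combine) e) (Finₚ.combine-remQuot {ℓ} t y))

allPairs≡ : ∀ N → allPairs N ≡ cartesianProduct (allFin N) (allFin N)
allPairs≡ N = go (allFin N)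
  where
  go : ∀ xs → concatMap (λ x → map (λ y → x , y) (allFin N)) xs ≡ cartesianProduct xs (allFin N)
  go [] = refl
  go (x ∷ xs) = cong (map (x ,_) (allFin N) Data.List.++_) (go xs)

unique-lookup : ∀ {A : Set} {xs : List A} → Unique xs → ∀ {i j} → lookup xs i ≡ lookup xs j → i ≡ j
unique-lookup (p ∷ u) {zero} {zero} e = refl
unique-lookup (p ∷ u) {zero} {suc j} e = ⊥-elim (All.lookup p (∈-lookup j) e)
unique-lookup (p ∷ u) {suc i} {zero} e = ⊥-elim (All.lookup p (∈-lookup i) (sym e))
unique-lookup (p ∷ u) {suc i} {suc j} e = cong suc (unique-lookup u e)

edgesOf : Variant → (ℓ t : ℕ) → List (Fin (ℓ * t) × Fin (ℓ * t))
edgesOf v ℓ t = Graph.edges (blowup v ℓ t)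

edgesOf-unique : ∀ v ℓ t → Unique (edgesOf v ℓ t)
edgesOf-unique v ℓ t = Uniqueₚ.filter⁺ _ (subst Unique (sym (allPairs≡ (ℓ * t))) (Uniqueₚ.cartesianProduct⁺ (Uniqueₚ.allFin⁺ _) (Uniqueₚ.allFin⁺ _)))

edgesOf-adj : ∀ v ℓ t i → blowAdj v ℓ t (proj₁ (lookup (edgesOf v ℓ t) i)) (proj₂ (lookup (edgesOf v ℓ t) i)) ≡ true
edgesOf-adj v ℓ t i = T⇒≡ (proj₂ (∈-filter⁻ (λ xy → T? (blowAdj v ℓ t (proj₁ xy) (proj₂ xy))) {xs = allPairs (ℓ * t)} (∈-lookup i)))
  where
  T⇒≡ : ∀ {b} → Data.Bool.T b → b ≡ true
  T⇒≡ {true} _ = refl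

-- Each greedy expansion has to avoid all vertices and all colours used before.
Kh : Graph → ℕ
Kh Γ = Graph.nv Γ + 4 + 2 * length (Graph.edges Γ)

OnlyEdges : (Γ : Graph) {ℓ t : ℕ} → (Fin (Graph.nv Γ) → Pos ℓ t) → Pos ℓ t × Pos ℓ t → Pos ℓ t × Pos ℓ t → Set
OnlyEdges Γ pos e₁ e₂ = ∀ i → let (x , y) = lookup (Graph.edges Γ) i in
  proj₁ (pos x) ≢ proj₁ (pos y) ⊎ (pos x , pos y) ≡ e₁ ⊎ (pos x , pos y) ≡ e₂

module Embed {n m : ℕ} {χ : Coloring n m} (F : Family χ) (Γ : Graph) (unique : Unique (Graph.edges Γ))
    {ℓ t : ℕ} (pos : Fin (Graph.nv Γ) → Pos ℓ t) (pos-injective : ∀ {x y} → pos x ≡ pos y → x ≡ y) (e₁ e₂ : Pos ℓ t × Pos ℓ t)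
    (edge⇒ : OnlyEdges Γ pos e₁ e₂) where
  open Family F

  private
    nv : ℕ
    nv = Graph.nv Γ

  -- The cross pairs have to be heavy. The triples on the two extra edges are asked to have
  -- different colours and expansion vertices off the core; they may lie outside the family.
  module _ (ψ : Pos ℓ t → Fin n) (ψ-inj : ∀ {p q} → ψ p ≡ ψ q → p ≡ q)
    (heavy : ∀ p q → proj₁ p ≢ proj₁ q → Kh Γ ≤ count (g (ψ p) (ψ q)))
    (w₁ w₂ : Fin n) (w₁≢w₂ : w₁ ≢ w₂) (ψ≢w₁ : ∀ p → ψ p ≢ w₁) (ψ≢w₂ : ∀ p → ψ p ≢ w₂)
    (c≢c : χ (tri (ψ (proj₁ e₁)) (ψ (proj₂ e₁)) w₁) ≢ χ (tri (ψ (proj₁ e₂)) (ψ (proj₂ e₂)) w₂)) where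

    private
      L : List (Fin nv × Fin nv)
      L = Graph.edges Γ
      ne : ℕ
      ne = length L
      core : Fin nv → Fin n
      core x = ψ (pos x)
      a b : Fin ne → Fin nv
      a i = proj₁ (lookup L i)
      b i = proj₂ (lookup L i)
      key : Fin ne → Pos ℓ t × Pos ℓ t
      key i = pos (a i) , pos (b i)
      _≟K_ : (x y : Pos ℓ t × Pos ℓ t) → Dec (x ≡ y)
      _≟K_ = ≡-dec (≡-dec Finₚ._≟_ Finₚ._≟_) (≡-dec Finₚ._≟_ Finₚ._≟_)
      is₁ is₂ special : Fin ne → Bool
      is₁ i = does (key i ≟K e₁)
      is₂ i = does (key i ≟K e₂)
      special i = is₁ i ∨ is₂ i
      pre : Fin ne → Fin n
      pre i = if is₁ i then w₁ else w₂
      cand : Fin ne → Fin n → Bool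
      cand i = g (core (a i)) (core (b i))
      col : Fin ne → Fin n → Fin m
      col i w = χ (tri (core (a i)) (core (b i)) w)
      c₁ c₂ : Fin m
      c₁ = χ (tri (ψ (proj₁ e₁)) (ψ (proj₂ e₁)) w₁)
      c₂ = χ (tri (ψ (proj₁ (e₂))) (ψ (proj₂ (e₂))) w₂)
      X : List (Fin n)
      X = w₁ ∷ w₂ ∷ tabulate core
      Y : List (Fin m)
      Y = c₁ ∷ c₂ ∷ []

      key-injective : ∀ {i j} → key i ≡ key j → i ≡ j
      key-injective e = unique-lookup unique
        (cong₂ _,_ (pos-injective (cong proj₁ e)) (pos-injective (cong proj₂ e)))

      big : ∀ i → special i ≡ false → Kh Γ ≤ count (cand i)
      big i sp with edge⇒ i
      ... | inj₁ p≢ = heavy (pos (a i)) (pos (b i)) p≢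
      ... | inj₂ (inj₁ e) = ⊥-elim (true≢false (cong (_∨ is₂ i) (dec-true (key i ≟K e₁) e)) sp)
      ... | inj₂ (inj₂ e) = ⊥-elim (true≢false (trans (cong (is₁ i ∨_) (dec-true (key i ≟K e₂) e)) (∨-zeroʳ (is₁ i))) sp)
        where
        ∨-zeroʳ : ∀ b → b ∨ true ≡ true
        ∨-zeroʳ true = refl
        ∨-zeroʳ false = refl

      G : Greedy cand col special pre X Y
      G = greedy ne cand col special pre X Y (Kh Γ) (≤-reflexive size) big (λ i _ x y e e' → g-inj₃ e e')
        where
        lem : ∀ x k → suc (suc x) + 2 + 2 * k ≡ x + 4 + 2 * k
        lem = solve-∀
        size : length X + length Y + 2 * ne ≡ Kh Γ
        size = trans (cong (λ k → suc (suc k) + 2 + 2 * ne) (length-tabulate core)) (lem nv ne)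
      module Expand (G : Greedy cand col special pre X Y) where
        open Greedy G

        core-inj : ∀ {x y} → core x ≡ core y → x ≡ y
        core-inj e = pos-injective (ψ-inj e)

        data Kind (i : Fin ne) : Set where
          isE₁ : key i ≡ e₁ → w i ≡ w₁ → col i (w i) ≡ c₁ → Kind i
          isE₂ : key i ≡ e₂ → w i ≡ w₂ → col i (w i) ≡ c₂ → Kind i
          free : special i ≡ false → Kind i

        kind : ∀ i → Kind i
        kind i = go (is₁ i) (is₂ i) refl refl
          where
          go : ∀ x y → is₁ i ≡ x → is₂ i ≡ y → Kind i
          go true y s₁ _ = isE₁ k wi (cong₂ (λ k w → χ (tri (ψ (proj₁ k)) (ψ (proj₂ k)) w)) k wi)
            where
            k = does-true (key i ≟K e₁) s₁
            wi : w i ≡ w₁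
            wi = trans (isPre i (cong (_∨ is₂ i) s₁)) (cong (λ b → if b then w₁ else w₂) s₁)
          go false true s₁ s₂ = isE₂ k wi (cong₂ (λ k w → χ (tri (ψ (proj₁ k)) (ψ (proj₂ k)) w)) k wi)
            where
            k = does-true (key i ≟K e₂) s₂
            wi : w i ≡ w₂
            wi = trans (isPre i (cong₂ _∨_ s₁ s₂)) (cong (λ b → if b then w₁ else w₂) s₁)
          go false false s₁ s₂ = free (cong₂ _∨_ s₁ s₂)

        core∉ : ∀ x i → core x ≢ w i
        core∉ x i e with kind i
        ... | isE₁ _ q _ = ψ≢w₁ (pos x) (trans e q)
        ... | isE₂ _ q _ = ψ≢w₂ (pos x) (trans e q)
        ... | free s = w∉X i s (there (there (subst (_∈ tabulate core) e (∈-tabulate⁺ {f = core} x))))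

        w-inj : ∀ i j → i ≢ j → w i ≢ w j
        w-inj i j i≢j e with kind i | kind j
        ... | isE₁ k _ _ | isE₁ k' _ _ = i≢j (key-injective (trans k (sym k')))
        ... | isE₁ _ q _ | isE₂ _ q' _ = w₁≢w₂ (trans (sym q) (trans e q'))
        ... | isE₁ _ q _ | free s = w∉X j s (here (trans (sym e) q))
        ... | isE₂ _ q _ | isE₁ _ q' _ = w₁≢w₂ (trans (sym q') (trans (sym e) q))
        ... | isE₂ k _ _ | isE₂ k' _ _ = i≢j (key-injective (trans k (sym k')))
        ... | isE₂ _ q _ | free s = w∉X j s (there (here (trans (sym e) q)))
        ... | free s | isE₁ _ q _ = w∉X i s (here (trans e q))
        ... | free s | isE₂ _ q _ = w∉X i s (there (here (trans e q)))
        ... | free s | free s' = w≢ i j i≢j s s' e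

        col-inj : ∀ i j → i ≢ j → col i (w i) ≢ col j (w j)
        col-inj i j i≢j e with kind i | kind j
        ... | isE₁ k _ _ | isE₁ k' _ _ = i≢j (key-injective (trans k (sym k')))
        ... | isE₁ _ _ q | isE₂ _ _ q' = c≢c (trans (sym q) (trans e q'))
        ... | isE₁ _ _ q | free s = c∉Y j s (here (trans (sym e) q))
        ... | isE₂ _ _ q | isE₁ _ _ q' = c≢c (trans (sym q') (trans (sym e) q))
        ... | isE₂ k _ _ | isE₂ k' _ _ = i≢j (key-injective (trans k (sym k')))
        ... | isE₂ _ _ q | free s = c∉Y j s (there (here (trans (sym e) q)))
        ... | free s | isE₁ _ _ q = c∉Y i s (here (trans e q))
        ... | free s | isE₂ _ _ q = c∉Y i s (there (here (trans e q)))
        ... | free s | free s' = c≢ i j i≢j s s' e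

        φ : Fin (nv + ne) → Fin n
        φ x = [ core , w ]′ (splitAt nv x)

        φ-inj : ∀ {x y} → φ x ≡ φ y → x ≡ y
        φ-inj {x} {y} e with splitAt nv x in ex | splitAt nv y in ey
        ... | inj₁ p | inj₁ q = trans (sym (Finₚ.splitAt⁻¹-↑ˡ ex)) (trans (cong (_↑ˡ ne) (core-inj e)) (Finₚ.splitAt⁻¹-↑ˡ ey))
        ... | inj₁ p | inj₂ j = ⊥-elim (core∉ p j e)
        ... | inj₂ i | inj₁ q = ⊥-elim (core∉ q i (sym e))
        ... | inj₂ i | inj₂ j with i Finₚ.≟ j
        ... | yes refl = trans (sym (Finₚ.splitAt⁻¹-↑ʳ ex)) (Finₚ.splitAt⁻¹-↑ʳ ey)
        ... | no i≢j = ⊥-elim (w-inj i j i≢j e)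

        φ-edge : ∀ i → triple (φ (a i ↑ˡ ne) , φ (b i ↑ˡ ne) , φ (nv ↑ʳ i)) ≡ tri (core (a i)) (core (b i)) (w i)
        φ-edge i = cong triple (cong₂ _,_ (cong [ core , w ]′ (Finₚ.splitAt-↑ˡ nv (a i) ne))
          (cong₂ _,_ (cong [ core , w ]′ (Finₚ.splitAt-↑ˡ nv (b i) ne)) (cong [ core , w ]′ (Finₚ.splitAt-↑ʳ nv ne i))))

        embed' : RainbowCopy χ (expansion Γ)
        embed' = φ , φ-inj , λ i j i≢j e → col-inj i j i≢j (trans (cong χ (sym (φ-edge i))) (trans e (cong χ (φ-edge j))))

    embed : RainbowCopy χ (expansion Γ)
    embed = Expand.embed' G

-- The upper bound is an argument by contradiction. A search through the finitely many vertex maps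
-- turns its conclusion into an actual copy.
rainbow? : ∀ {n m} (χ : Coloring n m) (H : Hyp3) → Dec (RainbowCopy χ H)
rainbow? {n} χ H with Finₚ.any? {n = n ^ Hyp3.nv H} (λ k → Good? (Data.Fin.finToFun k))
  where
  Good : (Fin (Hyp3.nv H) → Fin n) → Set
  Good φ = (∀ x y → φ x ≡ φ y → x ≡ y) × (∀ i j → i ≡ j ⊎ χ (triple (img φ (Hyp3.edge H i))) ≢ χ (triple (img φ (Hyp3.edge H j))))
    where
    img : (Fin (Hyp3.nv H) → Fin n) → Fin (Hyp3.nv H) × Fin (Hyp3.nv H) × Fin (Hyp3.nv H) → Fin n × Fin n × Fin n
    img φ (a , b , c) = φ a , φ b , φ c
  Good? : ∀ φ → Dec (Good φ)
  Good? φ = Finₚ.all? (λ x → Finₚ.all? λ y → (φ x Finₚ.≟ φ y) →-dec (x Finₚ.≟ y)) ×-dec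
            Finₚ.all? (λ i → Finₚ.all? λ j → (i Finₚ.≟ j) ⊎-dec ¬? (_ Finₚ.≟ _))
... | yes (k , inj , ok) = yes (Data.Fin.finToFun k , (λ {x} {y} → inj x y) , λ i j i≢j e → case ok i j of λ { (inj₁ q) → i≢j q ; (inj₂ ne) → ne e })
... | no none = no λ { (φ , inj , ok) → none (Data.Fin.funToFin φ ,
    (λ x y e → inj (trans (sym (Finₚ.finToFun-funToFin φ x)) (trans e (Finₚ.finToFun-funToFin φ y)))) ,
    λ i j → case i Finₚ.≟ j of λ { (yes q) → inj₁ q ; (no ne) → inj₂ λ e → ok i j ne (trans (same φ i) (trans e (sym (same φ j)))) }) }
  where
  same : ∀ φ i → let (a , b , c) = Hyp3.edge H i ; φ' = Data.Fin.finToFun (Data.Fin.funToFin φ) in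
    χ (triple (φ a , φ b , φ c)) ≡ χ (triple (φ' a , φ' b , φ' c))
  same φ i = cong (χ ∘ triple) (cong₂ _,_ (sym (Finₚ.finToFun-funToFin φ _)) (cong₂ _,_ (sym (Finₚ.finToFun-funToFin φ _)) (sym (Finₚ.finToFun-funToFin φ _))))

-- The Turán number as an elementary symmetric function of the part sizes (over ordered tuples)

dist : ∀ {n} → Fin n → Fin n → Fin n → Bool
dist p q r = not (p == q) ∧ (not (p == r) ∧ not (q == r))

-- Twice the second elementary symmetric polynomial of the entries off `p`: the ordered pairs in the
-- link of a vertex of part `p`. Likewise `e3` is six times the third one.
e2 : ∀ {ℓ} → (Fin ℓ → ℕ) → Fin ℓ → ℕ
e2 a p = sum λ q → sum λ r → ⟦ dist p q r ⟧ * (a q * a r)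

e3 : ∀ {ℓ} → (Fin ℓ → ℕ) → ℕ
e3 a = sum λ p → a p * e2 a p

==-comm : ∀ {n} (x y : Fin n) → (x == y) ≡ (y == x)
==-comm x y with x Finₚ.≟ y
... | yes refl = sym (==-refl x)
... | no ne = sym (≢⇒== (ne ∘ sym))

dist-sym₁ : ∀ {n} (p q r : Fin n) → dist p q r ≡ dist q p r
dist-sym₁ p q r rewrite ==-comm p q = cong (not (q == p) ∧_) (∧-comm (not (p == r)) (not (q == r)))

dist-sym₂ : ∀ {n} (p q r : Fin n) → dist p q r ≡ dist p r q
dist-sym₂ p q r rewrite ==-comm q r = trans (sym (∧-assoc (not (p == q)) _ _)) (trans (cong (_∧ not (r == q)) (∧-comm (not (p == q)) (not (p == r)))) (∧-assoc (not (p == r)) _ _))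

_⊕_ : ∀ {ℓ} → (Fin ℓ → ℕ) → Fin ℓ → Fin ℓ → ℕ
(a ⊕ v) p = a p + ⟦ p == v ⟧

e3-flat : ∀ {ℓ} (a : Fin ℓ → ℕ) → e3 a ≡ sum (λ p → sum λ q → sum λ r → ⟦ dist p q r ⟧ * (a p * (a q * a r)))
e3-flat a = sum-cong λ p → trans (*-sum (a p) _) (sum-cong λ q → trans (*-sum (a p) _) (sum-cong λ r → lem (a p) ⟦ dist p q r ⟧ (a q * a r)))
  where
  lem : ∀ x d y → x * (d * y) ≡ d * (x * y)
  lem = solve-∀

-- Two increments at `v` would need two equal indices in a tuple of distinct ones, so only the
-- linear terms remain, one for each of the three positions of the new vertex.
e3-⊕ : ∀ {ℓ} (a : Fin ℓ → ℕ) v → e3 (a ⊕ v) ≡ e3 a + 3 * e2 a v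
e3-⊕ {ℓ} a v = begin
  e3 (a ⊕ v) ≡⟨ e3-flat (a ⊕ v) ⟩
  sum (λ p → sum λ q → sum λ r → ⟦ dist p q r ⟧ * ((a ⊕ v) p * ((a ⊕ v) q * (a ⊕ v) r)))
    ≡⟨ sum-cong (λ p → sum-cong λ q → sum-cong (pt p q)) ⟩
  sum (λ p → sum λ q → sum λ r → A p q r + (⟦ p == v ⟧ * B q r + (⟦ q == v ⟧ * B p r + ⟦ r == v ⟧ * B p q)))
    ≡⟨ split ⟩
  sum (λ p → sum λ q → sum λ r → A p q r) + (E₁ + (E₂ + E₃))
    ≡⟨ cong₂ _+_ (sym (e3-flat a)) (trans (cong₂ _+_ s₁ (cong₂ _+_ s₂ s₃)) (lem (e2 a v))) ⟩
  e3 a + 3 * e2 a v ∎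
  where
  open Relation.Binary.PropositionalEquality.≡-Reasoning
  A : Fin ℓ → Fin ℓ → Fin ℓ → ℕ
  A p q r = ⟦ dist p q r ⟧ * (a p * (a q * a r))
  B : Fin ℓ → Fin ℓ → ℕ
  B q r = ⟦ dist v q r ⟧ * (a q * a r)
  E₁ = sum λ p → sum λ q → sum λ r → ⟦ p == v ⟧ * B q r
  E₂ = sum λ p → sum λ q → sum λ r → ⟦ q == v ⟧ * B p r
  E₃ = sum λ p → sum λ q → sum λ (r : Fin ℓ) → ⟦ r == v ⟧ * B p q
  lem : ∀ x → x + (x + x) ≡ 3 * x
  lem = solve-∀
  s₃ : E₃ ≡ e2 a v
  s₃ = sum-cong λ p → sum-cong λ q → sum-δ v (λ _ → B p q)
  s₂ : E₂ ≡ e2 a v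
  s₂ = sum-cong λ p → trans (sum-swap _) (sum-cong λ r → sum-δ v (λ _ → B p r))
  s₁ : E₁ ≡ e2 a v
  s₁ = trans (sum-swap _) (sum-cong λ q → trans (sum-swap _) (sum-cong λ r → sum-δ v (λ _ → B q r)))
  split : sum (λ p → sum λ q → sum λ r → A p q r + (⟦ p == v ⟧ * B q r + (⟦ q == v ⟧ * B p r + ⟦ r == v ⟧ * B p q)))
    ≡ sum (λ p → sum λ q → sum λ r → A p q r) + (E₁ + (E₂ + E₃))
  split = trans (sum₃-+ A _) (cong (sum (λ p → sum λ q → sum λ r → A p q r) +_) (trans (sum₃-+ (λ p q r → ⟦ p == v ⟧ * B q r) _) (cong (E₁ +_) (sum₃-+ (λ p q r → ⟦ q == v ⟧ * B p r) _))))
    where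
    sum₃-+ : ∀ (f h : Fin ℓ → Fin ℓ → Fin ℓ → ℕ) → sum (λ p → sum λ q → sum λ r → f p q r + h p q r) ≡ sum (λ p → sum λ q → sum λ r → f p q r) + sum (λ p → sum λ q → sum λ r → h p q r)
    sum₃-+ f h = trans (sum-cong λ p → trans (sum-cong λ q → sum-+ _ _) (sum-+ _ _)) (sum-+ _ _)
  pt : ∀ p q r → ⟦ dist p q r ⟧ * ((a ⊕ v) p * ((a ⊕ v) q * (a ⊕ v) r)) ≡ A p q r + (⟦ p == v ⟧ * B q r + (⟦ q == v ⟧ * B p r + ⟦ r == v ⟧ * B p q))
  pt p q r = trans (expand ⟦ dist p q r ⟧ (a p) (a q) (a r) ⟦ p == v ⟧ ⟦ q == v ⟧ ⟦ r == v ⟧)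
    (trans (cong (main +_) zeros) (trans (+-identityʳ main) (cong (A p q r +_) (cong₂ _+_ (at p (λ x → dist x q r) (λ x → dist v q r) refl)
      (cong₂ _+_ (at q (λ x → dist p x r) (λ x → dist v p r) (dist-sym₁ p v r)) (at r (λ x → dist p q x) (λ x → dist v p q) (trans (dist-sym₂ p q v) (dist-sym₁ p v q))))))))
    where
    main = A p q r + (⟦ p == v ⟧ * (⟦ dist p q r ⟧ * (a q * a r)) + (⟦ q == v ⟧ * (⟦ dist p q r ⟧ * (a p * a r)) + ⟦ r == v ⟧ * (⟦ dist p q r ⟧ * (a p * a q))))
    expand : ∀ d x y z u v w → d * ((x + u) * ((y + v) * (z + w))) ≡
      d * (x * (y * z)) + (u * (d * (y * z)) + (v * (d * (x * z)) + w * (d * (x * y)))) + ((d * (u * v)) * (z + w) + ((d * (u * w)) * y + (d * (v * w)) * x))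
    expand = solve-∀
    at : ∀ p (f h : Fin ℓ → Bool) {k} → f v ≡ h v → ⟦ p == v ⟧ * (⟦ f p ⟧ * k) ≡ ⟦ p == v ⟧ * (⟦ h v ⟧ * k)
    at p f h {k} e with p Finₚ.≟ v
    ... | yes refl = cong (λ b → 1 * (⟦ b ⟧ * k)) e
    ... | no _ = refl
    none : ∀ {b x y} → (b ≡ true → x ≡ true → y ≡ true → ⊥) → ⟦ b ⟧ * (⟦ x ⟧ * ⟦ y ⟧) ≡ 0
    none {false} h = refl
    none {true} {false} h = refl
    none {true} {true} {false} h = refl
    none {true} {true} {true} h = ⊥-elim (h refl refl refl)
    both : ∀ {x y : Fin ℓ} → not (x == y) ≡ true → (x == v) ≡ true → (y == v) ≡ true → ⊥
    both {x} {y} ne ex ey = true≢false (subst (λ z → (x == z) ≡ true) (trans (==⇒≡ {x = x} {v} ex) (sym (==⇒≡ {x = y} {v} ey))) (==-refl x)) (not-elim ne)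
    z₁ : ⟦ dist p q r ⟧ * (⟦ p == v ⟧ * ⟦ q == v ⟧) ≡ 0
    z₁ = none {dist p q r} λ d → both {p} {q} (∧-proj₁ {not (p == q)} d)
    z₂ : ⟦ dist p q r ⟧ * (⟦ p == v ⟧ * ⟦ r == v ⟧) ≡ 0
    z₂ = none {dist p q r} λ d → both {p} {r} (∧-proj₁ {not (p == r)} (∧-proj₂ {not (p == q)} d))
    z₃ : ⟦ dist p q r ⟧ * (⟦ q == v ⟧ * ⟦ r == v ⟧) ≡ 0
    z₃ = none {dist p q r} λ d → both {q} {r} (∧-proj₂ {not (p == r)} (∧-proj₂ {not (p == q)} d))
    zeros : (⟦ dist p q r ⟧ * (⟦ p == v ⟧ * ⟦ q == v ⟧)) * (a r + ⟦ r == v ⟧) + ((⟦ dist p q r ⟧ * (⟦ p == v ⟧ * ⟦ r == v ⟧)) * a q + (⟦ dist p q r ⟧ * (⟦ q == v ⟧ * ⟦ r == v ⟧)) * a p) ≡ 0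
    zeros rewrite z₁ | z₂ | z₃ = refl

module _ {ℓ} (a : Fin ℓ → ℕ) (v : Fin ℓ) where
  others : Fin ℓ → ℕ
  others q = ⟦ not (v == q) ⟧ * a q

  -- For a given total of the entries off `v`, maximising `e2` thus means minimising a sum of
  -- squares.
  e2-squares : e2 a v + sum (λ q → others q * others q) ≡ sum others * sum others
  e2-squares = sym (begin
    sum others * sum others ≡⟨ sum-* others _ ⟩
    sum (λ q → others q * sum others) ≡⟨ sum-cong (λ q → *-sum (others q) others) ⟩
    sum (λ q → sum λ r → others q * others r) ≡⟨ sum-cong (λ q → sum-cong (pt q)) ⟩
    sum (λ q → sum λ r → ⟦ dist v q r ⟧ * (a q * a r) + ⟦ r == q ⟧ * (others r * others r)) ≡⟨ trans (sum-cong λ q → sum-+ _ _) (sum-+ _ _) ⟩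
    e2 a v + sum (λ q → sum λ r → ⟦ r == q ⟧ * (others r * others r)) ≡⟨ cong (e2 a v +_) (sum-cong λ q → sum-δ q (λ r → others r * others r)) ⟩
    e2 a v + sum (λ q → others q * others q) ∎)
    where
    open Relation.Binary.PropositionalEquality.≡-Reasoning
    bools : ∀ x y k l → (⟦ x ⟧ * k) * (⟦ y ⟧ * l) ≡ ⟦ x ∧ (y ∧ true) ⟧ * (k * l) + 0
    bools true true k l = lem k l
      where
      lem : ∀ k l → (1 * k) * (1 * l) ≡ 1 * (k * l) + 0
      lem = solve-∀
    bools true false k l = *-zeroʳ (1 * k)
    bools false y k l = refl
    pt : ∀ q r → others q * others r ≡ ⟦ dist v q r ⟧ * (a q * a r) + ⟦ r == q ⟧ * (others r * others r)
    pt q r with r Finₚ.≟ q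
    ... | yes refl rewrite ==-refl r | ∧-zeroʳ (not (v == r)) | ∧-zeroʳ (not (v == r)) = sym (+-identityʳ _)
    ... | no ne rewrite ≢⇒== {x = q} {r} (ne ∘ sym) = bools (not (v == q)) (not (v == r)) (a q) (a r)

  others-sum : sum others + a v ≡ sum a
  others-sum = trans (cong (sum others +_) (sym (sum-δ v a))) (trans (sym (sum-+ _ _)) (sum-cong pt))
    where
    pt : ∀ q → others q + ⟦ q == v ⟧ * a q ≡ a q
    pt q rewrite ==-comm q v with v == q
    ... | true = +-identityʳ (a q)
    ... | false = trans (+-identityʳ _) (+-identityʳ (a q))

sum-last : ∀ {n} (f : Fin (suc n) → ℕ) → sum f ≡ sum (f ∘ Data.Fin.inject₁) + f (Data.Fin.fromℕ n)
sum-last {zero} f = trans (sum-suc f) (trans (cong (f zero +_) (sum-empty _)) (trans (+-identityʳ _) (cong (_+ f zero) (sym (sum-empty _)))))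
sum-last {suc n} f = trans (sum-suc f) (trans (cong (f zero +_) (sum-last (f ∘ suc))) (trans (sym (+-assoc (f zero) _ _)) (cong (_+ f (Data.Fin.fromℕ (suc n))) (sym (sum-suc _)))))

-- For a transversal triple, `j` and `j'` are the numbers of parts left for its second and its third
-- vertex.
module Turán (j' : ℕ) where
  ℓ j : ℕ
  j = suc j'
  ℓ = suc j

  cls : ∀ {n} → Fin n → Fin ℓ
  cls x = toℕ x mod ℓ

  bal : ℕ → Fin ℓ → ℕ
  bal n p = sum {n} λ x → ⟦ p == cls x ⟧

  bal-suc : ∀ n p → bal (suc n) p ≡ (bal n ⊕ (n mod ℓ)) p
  bal-suc n p = trans (sum-last _) (cong₂ _+_ (sum-cong {n} λ x → cong (λ k → ⟦ p == (k mod ℓ) ⟧) (Finₚ.toℕ-inject₁ x)) (cong (λ k → ⟦ p == (k mod ℓ) ⟧) (Finₚ.toℕ-fromℕ n)))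

  bal-sum : ∀ n → sum (bal n) ≡ n
  bal-sum n = trans (sum-swap _) (trans (sum-cong λ x → count-== (cls x)) (trans (sum-const n 1) (*-identityʳ n)))

  record Shape (n : ℕ) : Set where
    field
      q r : ℕ
      r<ℓ : r < ℓ
      n≡  : n ≡ r + q * ℓ
      sizes : ∀ p → bal n p ≡ q + ⟦ toℕ p <ᵇ r ⟧

    toℕ-mod : toℕ (n mod ℓ) ≡ r
    toℕ-mod = trans (Finₚ.toℕ-fromℕ< (m%n<n n ℓ)) (trans (cong (_% ℓ) n≡) (trans ([m+kn]%n≡m%n r q ℓ) (m<n⇒m%n≡m r<ℓ)))

    -- Parts with index below `r` have already received their extra vertex, and the next one goes to
    -- part `r`, which is still of the smallest size.
    last-size : bal n (n mod ℓ) ≡ q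
    last-size = trans (sizes _) (trans (cong (λ b → q + ⟦ b ⟧) (trans (cong (_<ᵇ r) toℕ-mod) (<ᵇ-irr r))) (+-identityʳ q))
      where
      <ᵇ-irr : ∀ r → (r <ᵇ r) ≡ false
      <ᵇ-irr zero = refl
      <ᵇ-irr (suc r) = <ᵇ-irr r

    suc-sizes : ∀ p → bal (suc n) p ≡ q + ⟦ toℕ p <ᵇ suc r ⟧
    suc-sizes p = trans (bal-suc n p) (trans (cong (_+ ⟦ p == (n mod ℓ) ⟧) (sizes p)) (trans (+-assoc q _ _) (cong (q +_) ind)))
      where
      ind : ⟦ toℕ p <ᵇ r ⟧ + ⟦ p == (n mod ℓ) ⟧ ≡ ⟦ toℕ p <ᵇ suc r ⟧
      ind with p Finₚ.≟ (n mod ℓ)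
      ... | yes e = trans (cong (λ k → ⟦ k <ᵇ r ⟧ + 1) (trans (cong toℕ e) toℕ-mod)) (trans (lem r) (cong (λ k → ⟦ k <ᵇ suc r ⟧) (sym (trans (cong toℕ e) toℕ-mod))))
        where
        lem : ∀ r → ⟦ r <ᵇ r ⟧ + 1 ≡ ⟦ r <ᵇ suc r ⟧
        lem zero = refl
        lem (suc r) = lem r
      ... | no ne = trans (+-identityʳ _) (lem (toℕ p) r λ e → ne (Finₚ.toℕ-injective (trans e (sym toℕ-mod))))
        where
        lem : ∀ x r → x ≢ r → ⟦ x <ᵇ r ⟧ ≡ ⟦ x <ᵇ suc r ⟧
        lem zero zero ne = ⊥-elim (ne refl)
        lem zero (suc r) ne = refl
        lem (suc x) zero ne = refl
        lem (suc x) (suc r) ne = lem x r (ne ∘ cong suc)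

  shape : ∀ n → Shape n
  shape zero = record { q = 0 ; r = 0 ; r<ℓ = s≤s z≤n ; n≡ = refl ; sizes = λ p → sum-empty _ }
  shape (suc n) with suc (Shape.r (shape n)) <? ℓ
  ... | yes lt = record { q = q ; r = suc r ; r<ℓ = lt ; n≡ = cong suc n≡ ; sizes = suc-sizes }
    where open Shape (shape n)
  ... | no ¬lt = record { q = suc q ; r = 0 ; r<ℓ = s≤s z≤n ; n≡ = trans (cong suc n≡) (cong (_+ q * ℓ) full)
      ; sizes = λ p → trans (suc-sizes p) (trans (cong (λ b → q + ⟦ b ⟧) (≤⇒<ᵇ (toℕ p) (suc r) (<-≤-trans (Finₚ.toℕ<n p) (≤-reflexive (sym full))))) (trans (+-comm q 1) (sym (+-identityʳ (suc q))))) }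
    where
    open Shape (shape n)
    full : suc r ≡ ℓ
    full = ≤-antisym r<ℓ (≮⇒≥ ¬lt)
    ≤⇒<ᵇ : ∀ x y → x < y → (x <ᵇ y) ≡ true
    ≤⇒<ᵇ zero (suc y) _ = refl
    ≤⇒<ᵇ (suc x) (suc y) (s≤s h) = ≤⇒<ᵇ x y h

  nonlast : ∀ v → sum (λ q → ⟦ not (v == q) ⟧) ≡ j
  nonlast v = +-cancelʳ-≡ 1 _ j (trans (trans (cong (_+ 1) (sum-cong λ q → sym (*-identityʳ ⟦ not (v == q) ⟧))) (others-sum (λ _ → 1) v))
    (trans (sum-const ℓ 1) (trans (*-identityʳ ℓ) (+-comm 1 j))))

  dist-count : ∀ v → sum (λ q → sum λ r → ⟦ dist v q r ⟧) ≡ j * j'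
  dist-count v = +-cancelʳ-≡ j _ (j * j') (begin
    sum (λ q → sum λ r → ⟦ dist v q r ⟧) + j
      ≡⟨ cong₂ _+_ (sum-cong λ q → sum-cong λ r → sym (*-identityʳ ⟦ dist v q r ⟧)) (trans (sym (nonlast v)) (sum-cong λ q → sq (not (v == q)))) ⟩
    e2 (λ _ → 1) v + sum (λ q → others (λ _ → 1) v q * others (λ _ → 1) v q) ≡⟨ e2-squares (λ _ → 1) v ⟩
    sum (others (λ _ → 1) v) * sum (others (λ _ → 1) v) ≡⟨ cong₂ _*_ one one ⟩
    j * j ≡⟨ lem j' ⟩
    j * j' + j ∎)
    where
    open Relation.Binary.PropositionalEquality.≡-Reasoning
    sq : ∀ b → ⟦ b ⟧ ≡ ⟦ b ⟧ * 1 * (⟦ b ⟧ * 1)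
    sq true = refl
    sq false = refl
    one : sum (others (λ _ → 1) v) ≡ j
    one = trans (sum-cong λ q → *-identityʳ ⟦ not (v == q) ⟧) (nonlast v)
    lem : ∀ j → suc j * suc j ≡ suc j * j + suc j
    lem = solve-∀

  -- By `e3-bal-suc` this `e2` is a third of the increment of `e3`, so it is the link size that
  -- vertices have after the deletion of those of small degree.
  e2-bal-≥ : ∀ n → let q = Shape.q (shape n) in j * j' * (q * q) ≤ e2 (bal n) (n mod ℓ)
  e2-bal-≥ n = ≤-trans (≤-reflexive (trans (cong (_* (q * q)) (sym (dist-count v))) (trans (sum-* _ (q * q)) (sum-cong λ x → sum-* _ (q * q)))))
      (sum-mono λ x → sum-mono λ y → *-monoʳ-≤ ⟦ dist v x y ⟧ (*-mono-≤ (≥q x) (≥q y)))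
    where
    open Shape (shape n)
    v = n mod ℓ
    ≥q : ∀ p → q ≤ bal n p
    ≥q p = ≤-trans (m≤m+n q _) (≤-reflexive (sym (sizes p)))

  -- (x - k)(x - k - 1) ≥ 0
  tangent : ∀ k x → (2 * k + 1) * x ≤ x * x + k * suc k
  tangent k x with ≤-total x k
  ... | inj₁ x≤k with slack x≤k
  ...   | d , refl = ≤-trans (m≤m+n _ (d * suc d)) (≤-reflexive (lem x d))
    where
    lem : ∀ x d → (2 * (x + d) + 1) * x + d * suc d ≡ x * x + (x + d) * suc (x + d)
    lem = solve-∀
  tangent k x | inj₂ k≤x with slack k≤x
  ... | zero , refl = ≤-reflexive (lem k)
    where
    lem : ∀ k → (2 * k + 1) * (k + 0) ≡ (k + 0) * (k + 0) + k * suc k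
    lem = solve-∀
  ... | suc d , refl = ≤-trans (m≤m+n _ (d * suc d)) (≤-reflexive (lem k d))
    where
    lem : ∀ k d → (2 * k + 1) * (k + suc d) + d * suc d ≡ (k + suc d) * (k + suc d) + k * suc k
    lem = solve-∀

  -- Summing `tangent` over the parts off `v` gives `e2 a v ≤ σ² - (2q+1)σ + j q(q+1)`, with
  -- equality for the balanced sizes, which are all `q` or `q + 1`. The bound at `σ` is at most the
  -- bound at `σ*`, because `σ ≤ σ*` and `σ + σ* ≥ 2q + 1`; the latter uses `σ* ≥ 2q`, as there are
  -- three parts or more, and `σ ≥ 1`, whence the separate case `σ = 0`.
  e2-max : 1 ≤ j' → ∀ n (a : Fin ℓ → ℕ) v → sum a ≡ n → Shape.q (shape n) ≤ a v → e2 a v ≤ e2 (bal n) (n mod ℓ)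
  e2-max 1≤j' n a v Σa q≤a with sum (others a v) in σ≡
  ... | zero = ≤-trans (m≤m+n _ _) (≤-trans (≤-reflexive (trans (e2-squares a v) (cong₂ _*_ σ≡ σ≡))) z≤n)
  ... | suc _ = +-cancelʳ-≤ ((2 * q + 1) * σ + (2 * q + 1) * σ*) _ _ (begin
    e2 a v + ((2 * q + 1) * σ + (2 * q + 1) * σ*) ≡⟨ sym (+-assoc (e2 a v) _ _) ⟩
    e2 a v + (2 * q + 1) * σ + (2 * q + 1) * σ* ≤⟨ +-monoˡ-≤ _ (+-monoʳ-≤ (e2 a v) tan) ⟩
    e2 a v + (sum (λ p → u p * u p) + j * (q * suc q)) + (2 * q + 1) * σ* ≡⟨ cong (_+ (2 * q + 1) * σ*) (trans (sym (+-assoc (e2 a v) _ _)) (cong (_+ j * (q * suc q)) (e2-squares a v))) ⟩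
    σ * σ + j * (q * suc q) + (2 * q + 1) * σ* ≡⟨ l₁ (σ * σ) (j * (q * suc q)) ((2 * q + 1) * σ*) ⟩
    j * (q * suc q) + (σ * σ + (2 * q + 1) * σ*) ≤⟨ +-monoʳ-≤ (j * (q * suc q)) (convex σ≤) ⟩
    j * (q * suc q) + (σ* * σ* + (2 * q + 1) * σ) ≡⟨ cong (λ x → j * (q * suc q) + (x + (2 * q + 1) * σ)) (sym (e2-squares (bal n) v*)) ⟩
    j * (q * suc q) + (e2 (bal n) v* + sum (λ p → u* p * u* p) + (2 * q + 1) * σ) ≡⟨ l₂ (j * (q * suc q)) (e2 (bal n) v*) (sum (λ p → u* p * u* p)) ((2 * q + 1) * σ) ⟩
    e2 (bal n) v* + ((2 * q + 1) * σ + (sum (λ p → u* p * u* p) + j * (q * suc q))) ≡⟨ cong (λ x → e2 (bal n) v* + ((2 * q + 1) * σ + x)) (sym tan*) ⟩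
    e2 (bal n) v* + ((2 * q + 1) * σ + (2 * q + 1) * σ*) ∎)
    where
    open ≤-Reasoning
    open Shape (shape n)
    v* = n mod ℓ
    u u* : Fin ℓ → ℕ
    u = others a v
    u* = others (bal n) v*
    σ σ* : ℕ
    σ = sum u
    σ* = sum u*
    l₁ : ∀ a b c → a + b + c ≡ b + (a + c)
    l₁ = solve-∀
    l₂ : ∀ a b c d → a + (b + c + d) ≡ b + (d + (c + a))
    l₂ = solve-∀
    const-sum : ∀ v c → sum (λ p → ⟦ not (v == p) ⟧ * c) ≡ j * c
    const-sum v c = trans (sym (sum-* _ c)) (cong (_* c) (nonlast v))
    tan : (2 * q + 1) * σ ≤ sum (λ p → u p * u p) + j * (q * suc q)
    tan = ≤-trans (≤-reflexive (*-sum (2 * q + 1) u)) (≤-trans (sum-mono pt) (≤-reflexive (trans (sum-+ _ _) (cong (sum (λ p → u p * u p) +_) (const-sum v (q * suc q))))))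
      where
      pt : ∀ p → (2 * q + 1) * u p ≤ u p * u p + ⟦ not (v == p) ⟧ * (q * suc q)
      pt p with not (v == p)
      ... | true = ≤-trans (tangent q (1 * a p)) (+-monoʳ-≤ (1 * a p * (1 * a p)) (≤-reflexive (sym (+-identityʳ (q * suc q)))))
      ... | false = ≤-trans (≤-reflexive (*-zeroʳ (2 * q + 1))) z≤n
    tan* : (2 * q + 1) * σ* ≡ sum (λ p → u* p * u* p) + j * (q * suc q)
    tan* = trans (*-sum (2 * q + 1) u*) (trans (sum-cong pt) (trans (sum-+ _ _) (cong (sum (λ p → u* p * u* p) +_) (const-sum v* (q * suc q)))))
      where
      pt : ∀ p → (2 * q + 1) * u* p ≡ u* p * u* p + ⟦ not (v* == p) ⟧ * (q * suc q)
      pt p rewrite sizes p with not (v* == p) | toℕ p <ᵇ r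
      ... | true | true = lem q
        where
        lem : ∀ q → (2 * q + 1) * (1 * (q + 1)) ≡ 1 * (q + 1) * (1 * (q + 1)) + 1 * (q * suc q)
        lem = solve-∀
      ... | true | false = lem q
        where
        lem : ∀ q → (2 * q + 1) * (1 * (q + 0)) ≡ 1 * (q + 0) * (1 * (q + 0)) + 1 * (q * suc q)
        lem = solve-∀
      ... | false | _ = *-zeroʳ (2 * q + 1)
    σ*+q : σ* + q ≡ n
    σ*+q = trans (cong (σ* +_) (sym last-size)) (trans (others-sum (bal n) v*) (bal-sum n))
    σ≤ : σ ≤ σ*
    σ≤ = +-cancelʳ-≤ q σ σ* (≤-trans (+-monoʳ-≤ σ q≤a) (≤-reflexive (trans (others-sum a v) (trans Σa (sym σ*+q)))))
    big : 2 * q ≤ σ*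
    big = +-cancelʳ-≤ q (2 * q) σ* (≤-trans (≤-reflexive (lem q)) (≤-trans (*-monoʳ-≤ q (s≤s (s≤s 1≤j'))) (≤-trans (m≤n+m (q * ℓ) r) (≤-reflexive (trans (sym n≡) (sym σ*+q))))))
      where
      lem : ∀ q → 2 * q + q ≡ q * 3
      lem = solve-∀
    1≤σ : 1 ≤ σ
    1≤σ = ≤-trans (s≤s z≤n) (≤-reflexive (sym σ≡))
    convex : σ ≤ σ* → σ * σ + (2 * q + 1) * σ* ≤ σ* * σ* + (2 * q + 1) * σ
    convex h with slack h
    ... | d , eq = begin
      σ * σ + (2 * q + 1) * σ* ≡⟨ cong (λ x → σ * σ + (2 * q + 1) * x) eq ⟩
      σ * σ + (2 * q + 1) * (σ + d) ≡⟨ l₃ σ (2 * q + 1) d ⟩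
      σ * σ + (2 * q + 1) * σ + (2 * q + 1) * d ≤⟨ +-monoʳ-≤ _ (*-monoˡ-≤ d (≤-trans (+-mono-≤ big 1≤σ) (≤-reflexive (cong (_+ σ) eq)))) ⟩
      σ * σ + (2 * q + 1) * σ + (σ + d + σ) * d ≡⟨ l₄ σ ((2 * q + 1) * σ) d ⟩
      (σ + d) * (σ + d) + (2 * q + 1) * σ ≡⟨ cong (λ x → x * x + (2 * q + 1) * σ) (sym eq) ⟩
      σ* * σ* + (2 * q + 1) * σ ∎
      where
      l₃ : ∀ s c d → s * s + c * (s + d) ≡ s * s + c * s + c * d
      l₃ = solve-∀
      l₄ : ∀ s c d → s * s + c + (s + d + s) * d ≡ (s + d) * (s + d) + c
      l₄ = solve-∀

  e3-cong : ∀ {a b : Fin ℓ → ℕ} → (∀ p → a p ≡ b p) → e3 a ≡ e3 b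
  e3-cong h = sum-cong λ p → cong₂ _*_ (h p) (sum-cong λ q → sum-cong λ r → cong (⟦ dist p q r ⟧ *_) (cong₂ _*_ (h q) (h r)))

  e3-bal-suc : ∀ n → e3 (bal (suc n)) ≡ e3 (bal n) + 3 * e2 (bal n) (n mod ℓ)
  e3-bal-suc n = trans (e3-cong (bal-suc n)) (e3-⊕ (bal n) (n mod ℓ))

  -- Induction on the number of vertices. Some part has more than `q` of them; removing one vertex
  -- from it loses no more than the balanced partition gains in its last step, by `e2-max`.
  e3-max : 1 ≤ j' → ∀ n (a : Fin ℓ → ℕ) → sum a ≡ n → e3 a ≤ e3 (bal n)
  e3-max 1≤j' zero a Σa = ≤-trans (sum-mono λ p → ≤-reflexive (cong (_* e2 a p) (n≤0⇒n≡0 (≤-trans (term≤sum a p) (≤-reflexive Σa))))) (≤-trans (≤-reflexive (sum-zero ℓ)) z≤n)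
  e3-max 1≤j' (suc n) a Σa = ≤-trans (≤-reflexive (trans (e3-cong a≡) (e3-⊕ a' v)))
      (≤-trans (+-mono-≤ (e3-max 1≤j' n a' Σa') (*-monoʳ-≤ 3 (e2-max 1≤j' n a' v Σa' q≤a'))) (≤-reflexive (sym (e3-bal-suc n))))
    where
    open Shape (shape n)
    large : ∃ λ v → q < a v
    large = sum-<⇒∃ (≤-trans (s≤s (≤-trans (≤-reflexive (trans (sum-const ℓ q) (*-comm ℓ q))) (≤-trans (m≤n+m (q * ℓ) r) (≤-reflexive (sym n≡))))) (≤-reflexive (sym Σa)))
    v : Fin ℓ
    v = proj₁ large
    a' : Fin ℓ → ℕ
    a' p = a p ∸ ⟦ p == v ⟧
    a≡ : ∀ p → a p ≡ (a' ⊕ v) p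
    a≡ p with p Finₚ.≟ v
    ... | yes refl = sym (m∸n+n≡m (≤-trans (s≤s z≤n) (proj₂ large)))
    ... | no _ = sym (+-identityʳ (a p))
    q≤a' : q ≤ a' v
    q≤a' = +-cancelʳ-≤ 1 q (a' v) (≤-trans (≤-reflexive (+-comm q 1)) (≤-trans (proj₂ large) (≤-reflexive (trans (a≡ v) (cong (λ b → a' v + ⟦ b ⟧) (==-refl v))))))
    Σa' : sum a' ≡ n
    Σa' = +-cancelʳ-≡ 1 _ n (trans (cong (sum a' +_) (sym (count-== v))) (trans (sym (sum-+ a' _)) (trans (sum-cong λ p → sym (a≡ p)) (trans Σa (+-comm 1 n)))))

  module _ {n : ℕ} (S : Fin n → Bool) (f : Fin n → Fin ℓ) where
    size : Fin ℓ → ℕ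
    size p = sum λ x → ⟦ S x ⟧ * ⟦ p == f x ⟧

    group : ∀ h → sum (λ x → ⟦ S x ⟧ * h (f x)) ≡ sum (λ p → size p * h p)
    group h = trans (sum-cong λ x → trans (cong (⟦ S x ⟧ *_) (sym (sum-δ (f x) h))) (*-sum ⟦ S x ⟧ _))
      (trans (sum-swap _) (sum-cong λ p → trans (sum-cong λ x → sym (*-assoc ⟦ S x ⟧ ⟦ p == f x ⟧ (h p))) (sym (sum-* _ (h p)))))

    size-sum : sum size ≡ count S
    size-sum = trans (sum-cong λ p → sym (*-identityʳ (size p))) (trans (sym (group (λ _ → 1))) (sum-cong λ x → *-identityʳ ⟦ S x ⟧))

    transversal : sum (λ x → ⟦ S x ⟧ * sum λ y → ⟦ S y ⟧ * sum λ z → ⟦ S z ⟧ * ⟦ dist (f x) (f y) (f z) ⟧) ≡ e3 size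
    transversal = begin
      sum (λ x → ⟦ S x ⟧ * sum λ y → ⟦ S y ⟧ * sum λ z → ⟦ S z ⟧ * ⟦ dist (f x) (f y) (f z) ⟧)
        ≡⟨ sum-cong (λ x → cong (⟦ S x ⟧ *_) (trans (sum-cong λ y → cong (⟦ S y ⟧ *_) (group (λ r → ⟦ dist (f x) (f y) r ⟧))) (group (λ q → sum λ r → size r * ⟦ dist (f x) q r ⟧)))) ⟩
      sum (λ x → ⟦ S x ⟧ * sum λ q → size q * sum λ r → size r * ⟦ dist (f x) q r ⟧) ≡⟨ group (λ p → sum λ q → size q * sum λ r → size r * ⟦ dist p q r ⟧) ⟩
      sum (λ p → size p * sum λ q → size q * sum λ r → size r * ⟦ dist p q r ⟧)
        ≡⟨ sum-cong (λ p → cong (size p *_) (sum-cong λ q → trans (*-sum (size q) _) (sum-cong λ r → lem (size q) (size r) ⟦ dist p q r ⟧))) ⟩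
      e3 size ∎
      where
      open Relation.Binary.PropositionalEquality.≡-Reasoning
      lem : ∀ a b d → a * (b * d) ≡ d * (a * b)
      lem = solve-∀

    transversal≤ : 1 ≤ j' → sum (λ x → ⟦ S x ⟧ * sum λ y → ⟦ S y ⟧ * sum λ z → ⟦ S z ⟧ * ⟦ dist (f x) (f y) (f z) ⟧) ≤ e3 (bal (count S))
    transversal≤ 1≤j' = ≤-trans (≤-reflexive transversal) (e3-max 1≤j' (count S) size size-sum)

  private
    ok : ∀ {n} → Fin n → Fin n → Fin n → Bool
    ok a b c = (toℕ a <ᵇ toℕ b) ∧ ((toℕ b <ᵇ toℕ c) ∧ (not ((toℕ a % ℓ) ≡ᵇ (toℕ b % ℓ)) ∧ (not ((toℕ a % ℓ) ≡ᵇ (toℕ c % ℓ)) ∧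
      not ((toℕ b % ℓ) ≡ᵇ (toℕ c % ℓ)))))

  t3-sum : ∀ n → t3 n ℓ ≡ sum {n} (λ a → sum λ b → sum λ c → ⟦ ok a b c ⟧)
  t3-sum n = trans (length-concatMap _ _ id) (sum-cong λ a → trans (length-concatMap _ _ id) (sum-cong λ b → length-map _ _ id))
    where
    length-map : ∀ {A B : Set} (p : B → Bool) (h : A → B) {n} (g : Fin n → A) → length (filterᵇ p (map h (tabulate g))) ≡ sum (λ x → ⟦ p (h (g x)) ⟧)
    length-map p h {zero} g = sym (sum-empty _)
    length-map p h {suc n} g = trans (step (h (g zero)) (map h (tabulate (g ∘ suc)))) (trans (cong (⟦ p (h (g zero)) ⟧ +_) (length-map p h (g ∘ suc))) (sym (sum-suc _)))
      where
      step : ∀ x xs → length (filterᵇ p (x ∷ xs)) ≡ ⟦ p x ⟧ + length (filterᵇ p xs)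
      step x xs with p x
      ... | true = refl
      ... | false = refl
    length-concatMap : ∀ {A B : Set} (p : B → Bool) (h : A → List B) {n} (g : Fin n → A) →
      length (filterᵇ p (concatMap h (tabulate g))) ≡ sum (λ x → length (filterᵇ p (h (g x))))
    length-concatMap p h {zero} g = sym (sum-empty _)
    length-concatMap p h {suc n} g = trans (cong length (Listₚ.filter-++ (λ x → T? (p x)) (h (g zero)) _))
      (trans (Listₚ.length-++ (filterᵇ p (h (g zero)))) (trans (cong (length (filterᵇ p (h (g zero))) +_) (length-concatMap p h (g ∘ suc))) (sym (sum-suc _))))

  -- Each transversal triple has a sorted reordering.
  e3-bal≤ : ∀ n → e3 (bal n) ≤ 6 * t3 n ℓ
  e3-bal≤ n = begin
    e3 (bal n) ≡⟨ e3-cong (λ p → sum-cong λ x → sym (+-identityʳ ⟦ p == cls x ⟧)) ⟩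
    e3 (size (λ (_ : Fin n) → true) cls) ≡⟨ sym (transversal (λ (_ : Fin n) → true) cls) ⟩
    sum (λ (x : Fin n) → 1 * sum λ (y : Fin n) → 1 * sum λ (z : Fin n) → 1 * ⟦ dist (cls x) (cls y) (cls z) ⟧)
      ≡⟨ sum-cong (λ x → trans (+-identityʳ _) (sum-cong λ y → trans (+-identityʳ _) (sum-cong λ z → +-identityʳ _))) ⟩
    sum (λ (x : Fin n) → sum λ (y : Fin n) → sum λ (z : Fin n) → ⟦ dist (cls x) (cls y) (cls z) ⟧)
      ≤⟨ sum-mono (λ x → sum-mono λ y → sum-mono λ z → ⟦⟧-≤ (sorted x y z)) ⟩
    sum (λ (x : Fin n) → sum λ (y : Fin n) → sum λ (z : Fin n) → s x y z + (s x z y + (s y x z + (s y z x + (s z x y + s z y x)))))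
      ≡⟨ trans (sum₃-+ s _) (cong (Σs +_) (trans (sum₃-+ (λ x y z → s x z y) _) (cong₂ _+_ (sum-cong λ x → sum-swap _) (trans (sum₃-+ (λ x y z → s y x z) _) (cong₂ _+_ (sum-swap _) (trans (sum₃-+ (λ x y z → s y z x) _) (cong₂ _+_ p₄ (trans (sum₃-+ (λ x y z → s z x y) _) (cong₂ _+_ p₅ p₆))))))))) ⟩
    Σs + (Σs + (Σs + (Σs + (Σs + Σs)))) ≡⟨ lem Σs ⟩
    6 * Σs ≡⟨ cong (6 *_) (sym (t3-sum n)) ⟩
    6 * t3 n ℓ ∎
    where
    open ≤-Reasoning
    s : Fin n → Fin n → Fin n → ℕ
    s a b c = ⟦ ok a b c ⟧
    Σs : ℕ
    Σs = sum λ a → sum λ b → sum λ c → s a b c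
    sum₃-+ : ∀ (f h : Fin n → Fin n → Fin n → ℕ) → sum (λ p → sum λ q → sum λ r → f p q r + h p q r) ≡ sum (λ p → sum λ q → sum λ r → f p q r) + sum (λ p → sum λ q → sum λ r → h p q r)
    sum₃-+ f h = trans (sum-cong λ p → trans (sum-cong λ q → sum-+ _ _) (sum-+ _ _)) (sum-+ _ _)
    p₄ : sum (λ x → sum λ y → sum λ z → s y z x) ≡ Σs
    p₄ = trans (sum-swap _) (sum-cong λ y → sum-swap _)
    p₅ : sum (λ x → sum λ y → sum λ z → s z x y) ≡ Σs
    p₅ = trans (sum-cong λ x → sum-swap _) (sum-swap _)
    p₆ : sum (λ x → sum λ y → sum λ z → s z y x) ≡ Σs
    p₆ = trans (sum-cong λ x → sum-swap _) (trans (sum-swap _) (sum-cong λ z → sum-swap _))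
    lem : ∀ x → x + (x + (x + (x + (x + x)))) ≡ 6 * x
    lem = solve-∀
    ≢-% : ∀ {x y : Fin n} → not (cls x == cls y) ≡ true → not ((toℕ x % ℓ) ≡ᵇ (toℕ y % ℓ)) ≡ true
    ≢-% {x} {y} h with (toℕ x % ℓ) ≡ᵇ (toℕ y % ℓ) in e
    ... | false = refl
    ... | true = ⊥-elim (true≢false (trans (cong (_== cls y) (Finₚ.toℕ-injective (trans (Finₚ.toℕ-fromℕ< (m%n<n (toℕ x) ℓ)) (trans (eqᵇ e) (sym (Finₚ.toℕ-fromℕ< (m%n<n (toℕ y) ℓ))))))) (==-refl (cls y))) (not-elim h))
    <⇒ᵇ : ∀ {x y} → x < y → (x <ᵇ y) ≡ true
    <⇒ᵇ {zero} {suc y} _ = refl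
    <⇒ᵇ {suc x} {suc y} (s≤s h) = <⇒ᵇ {x} {y} h
    mk : ∀ {x y z : Fin n} → dist (cls x) (cls y) (cls z) ≡ true → toℕ x < toℕ y → toℕ y < toℕ z → 1 ≤ s x y z
    mk {x} {y} {z} d h h' = ⟦⟧-true {ok x y z} (∧-intro (<⇒ᵇ h) (∧-intro (<⇒ᵇ h') (∧-intro (≢-% {x} {y} (∧-proj₁ {not (cls x == cls y)} d))
      (∧-intro (≢-% {x} {z} (∧-proj₁ {not (cls x == cls z)} d')) (≢-% {y} {z} (∧-proj₂ {not (cls x == cls z)} d'))))))
      where d' = ∧-proj₂ {not (cls x == cls y)} d
    neq : ∀ {x y : Fin n} → not (cls x == cls y) ≡ true → toℕ x ≢ toℕ y
    neq {x} {y} h e = true≢false (trans (cong (_== cls y) (cong cls (Finₚ.toℕ-injective e))) (==-refl (cls y))) (not-elim h)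
    sorted : ∀ x y z → dist (cls x) (cls y) (cls z) ≡ true → 1 ≤ s x y z + (s x z y + (s y x z + (s y z x + (s z x y + s z y x))))
    sorted x y z d with <-cmp (toℕ x) (toℕ y) | <-cmp (toℕ y) (toℕ z) | <-cmp (toℕ x) (toℕ z)
    ... | tri≈ _ e _ | _ | _ = ⊥-elim (neq {x} {y} (∧-proj₁ {not (cls x == cls y)} d) e)
    ... | tri< _ _ _ | tri≈ _ e _ | _ = ⊥-elim (neq {y} {z} (∧-proj₂ {not (cls x == cls z)} (∧-proj₂ {not (cls x == cls y)} d)) e)
    ... | tri> _ _ _ | tri≈ _ e _ | _ = ⊥-elim (neq {y} {z} (∧-proj₂ {not (cls x == cls z)} (∧-proj₂ {not (cls x == cls y)} d)) e)
    ... | tri< _ _ _ | tri> _ _ _ | tri≈ _ e _ = ⊥-elim (neq {x} {z} (∧-proj₁ {not (cls x == cls z)} (∧-proj₂ {not (cls x == cls y)} d)) e)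
    ... | tri> _ _ _ | tri< _ _ _ | tri≈ _ e _ = ⊥-elim (neq {x} {z} (∧-proj₁ {not (cls x == cls z)} (∧-proj₂ {not (cls x == cls y)} d)) e)
    ... | tri< h _ _ | tri< h' _ _ | _ = ≤-trans (mk {x} {y} {z} d h h') (m≤m+n _ _)
    ... | tri< h _ _ | tri> _ _ h' | tri< h'' _ _ = ≤-trans (≤-trans (mk {x} {z} {y} (trans (dist-sym₂ (cls x) (cls z) (cls y)) d) h'' h') (m≤m+n _ _)) (m≤n+m _ (s x y z))
    ... | tri> _ _ h | tri< h' _ _ | tri< h'' _ _ = ≤-trans (≤-trans (≤-trans (mk {y} {x} {z} (trans (dist-sym₁ (cls y) (cls x) (cls z)) d) h h'') (m≤m+n _ _)) (m≤n+m _ (s x z y))) (m≤n+m _ (s x y z))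
    ... | tri> _ _ h | tri< h' _ _ | tri> _ _ h'' = ≤-trans (≤-trans (≤-trans (≤-trans (mk {y} {z} {x} (trans (dist-sym₂ (cls y) (cls z) (cls x)) (trans (dist-sym₁ (cls y) (cls x) (cls z)) d)) h' h'') (m≤m+n _ _)) (m≤n+m _ (s y x z))) (m≤n+m _ (s x z y))) (m≤n+m _ (s x y z))
    ... | tri< h _ _ | tri> _ _ h' | tri> _ _ h'' = ≤-trans (≤-trans (≤-trans (≤-trans (≤-trans (mk {z} {x} {y} (trans (dist-sym₁ (cls z) (cls x) (cls y)) (trans (dist-sym₂ (cls x) (cls z) (cls y)) d)) h'' h) (m≤m+n _ _)) (m≤n+m _ (s y z x))) (m≤n+m _ (s y x z))) (m≤n+m _ (s x z y))) (m≤n+m _ (s x y z))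
    ... | tri> _ _ h | tri> _ _ h' | _ = ≤-trans (≤-trans (≤-trans (≤-trans (≤-trans (mk {z} {y} {x} (trans (dist-sym₁ (cls z) (cls y) (cls x)) (trans (dist-sym₂ (cls y) (cls z) (cls x)) (trans (dist-sym₁ (cls y) (cls x) (cls z)) d))) h' h) (m≤n+m _ (s z x y))) (m≤n+m _ (s y z x))) (m≤n+m _ (s y x z))) (m≤n+m _ (s x z y))) (m≤n+m _ (s x y z))

-- Heavy pairs, and what the absence of a rainbow copy says about them

swap : ∀ {n} → Fin n → Fin n → Fin n → Fin n
swap a b x = if x == a then b else (if x == b then a else x)

swap-left : ∀ {n} (a b : Fin n) → swap a b a ≡ b
swap-left a b rewrite ==-refl a = refl

swap-right : ∀ {n} (a b : Fin n) → swap a b b ≡ a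
swap-right a b with b Finₚ.≟ a
... | yes e = e
... | no _ rewrite ==-refl b = refl

swap-other : ∀ {n} {a b x : Fin n} → x ≢ a → x ≢ b → swap a b x ≡ x
swap-other x≢a x≢b rewrite ≢⇒== x≢a | ≢⇒== x≢b = refl

swap-involutive : ∀ {n} (a b x : Fin n) → swap a b (swap a b x) ≡ x
swap-involutive a b x = go (x Finₚ.≟ a) (x Finₚ.≟ b)
  where
  go : Dec (x ≡ a) → Dec (x ≡ b) → swap a b (swap a b x) ≡ x
  go (yes refl) _ = trans (cong (swap x b) (swap-left x b)) (swap-right x b)
  go (no _) (yes refl) = trans (cong (swap a x) (swap-right a x)) (swap-left a x)
  go (no p) (no q) = trans (cong (swap a b) (swap-other p q)) (swap-other p q)

swap-injective : ∀ {n} (a b : Fin n) {x y} → swap a b x ≡ swap a b y → x ≡ y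
swap-injective a b {x} {y} e = trans (sym (swap-involutive a b x)) (trans (cong (swap a b) e) (swap-involutive a b y))

-- The extra edges sit in the first part, for `γ` also in the second; a permutation of the parts
-- gives these roles to any two prescribed ones.
move : ∀ {l} (i k : Fin (2 + l)) → i ≢ k →
  Σ (Fin (2 + l) → Fin (2 + l)) λ σ → (∀ {x y} → σ x ≡ σ y → x ≡ y) × σ zero ≡ i × σ 1F ≡ k
move i k i≢k = σ , inj , σ0 , σ1
  where
  k' = swap zero i k
  σ = λ x → swap zero i (swap 1F k' x)
  inj : ∀ {x y} → σ x ≡ σ y → x ≡ y
  inj e = swap-injective 1F k' (swap-injective zero i e)
  k'≢0 : zero ≢ k'
  k'≢0 e = i≢k (sym (swap-injective zero i (trans (sym e) (sym (swap-right zero i)))))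
  σ0 : σ zero ≡ i
  σ0 = trans (cong (swap zero i) (swap-other {a = 1F} {k'} (λ ()) k'≢0)) (swap-left zero i)
  σ1 : σ 1F ≡ k
  σ1 = trans (cong (swap zero i) (swap-left 1F k')) (swap-involutive zero i k)

record FreshPair {n m N : ℕ} (im : Fin N → Fin n) (cand : Fin n → Bool) (col col₂ : Fin n → Fin m) : Set where
  field
    w₁ w₂ : Fin n
    w₁≢w₂ : w₁ ≢ w₂
    im≢w₁ : ∀ k → im k ≢ w₁
    im≢w₂ : ∀ k → im k ≢ w₂
    apart : col w₁ ≢ col₂ w₂

-- With `w₂` chosen first, `w₁` has `N + 2` exclusions among the candidates: the core, `w₂`, and the
-- one vertex that would repeat the colour of the second edge.
freshPair : ∀ {n m N} (im : Fin N → Fin n) (cand : Fin n → Bool) (col col₂ : Fin n → Fin m) →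
  (∀ x y → cand x ≡ true → cand y ≡ true → col x ≡ col y → x ≡ y) → N + 3 ≤ count cand → FreshPair im cand col col₂
freshPair {n} {m} {N} im cand col col₂ inj big
  with avoid Finₚ._≟_ id (tabulate im) (λ _ → true) 1 (λ _ _ _ _ e → e)
    (≤-trans (≤-reflexive (cong (_+ 1) (length-tabulate im))) (≤-trans (+-monoʳ-≤ N (s≤s z≤n)) (≤-trans big (count-mono {q = λ _ → true} λ _ _ → refl))))
... | free , _ , bigf , out with count-∃ bigf
... | w₂ , fw₂ with greedy-pick cand col (w₂ ∷ tabulate im) (col₂ w₂ ∷ []) inj
    (≤-trans (≤-reflexive (trans (cong (λ z → suc z + 2) (length-tabulate im)) (lem N))) big)
  where
  lem : ∀ z → suc z + 2 ≡ z + 3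
  lem = solve-∀
... | w₁ , _ , w₁∉ , c∉ = record
  { w₁ = w₁ ; w₂ = w₂ ; w₁≢w₂ = λ e → w₁∉ (here e) ; im≢w₁ = λ k e → w₁∉ (there (subst (_∈ tabulate im) e (∈-tabulate⁺ k)))
  ; im≢w₂ = λ k e → out w₂ fw₂ (subst (_∈ tabulate im) e (∈-tabulate⁺ k)) ; apart = λ e → c∉ (here e) }

-- No rainbow copy: any placement of the core with heavy cross pairs forces the two extra edges to have equal colours.
EmbProp : ∀ {n m} {χ : Coloring n m} (F : Family χ) (v : Variant) (l t' K : ℕ) → Set
EmbProp {n} {m} {χ} F v l t' K =
  (ψ : Pos (2 + l) (4 + t') → Fin n) → (∀ {p q} → ψ p ≡ ψ q → p ≡ q) →
  (∀ p q → proj₁ p ≢ proj₁ q → K ≤ count (Family.g F (ψ p) (ψ q))) →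
  ∀ w₁ w₂ → w₁ ≢ w₂ → (∀ p → ψ p ≢ w₁) → (∀ p → ψ p ≢ w₂) →
  χ (tri (ψ (zero , zero)) (ψ (zero , 1F)) w₁) ≡ χ (tri (ψ (proj₁ (e₂ v))) (ψ (proj₂ (e₂ v))) w₂)

module Heavy {n m : ℕ} {χ : Coloring n m} (F : Family χ) (v : Variant) (l t' K : ℕ)
  (K≥ : (2 + l) * (4 + t') + 4 ≤ K) (emb : EmbProp F v l t' K) where
  open Family F public

  ℓ t : ℕ
  ℓ = (2 + l)
  t = (4 + t')

  adj : Fin n → Fin n → Bool
  adj x y = does (K ≤? count (g x y))

  adj⇒ : ∀ {x y} → adj x y ≡ true → K ≤ count (g x y)
  adj⇒ {x} {y} = does-true (K ≤? count (g x y))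

  ¬adj⇒ : ∀ {x y} → adj x y ≡ false → count (g x y) ≤ K
  ¬adj⇒ {x} {y} e = <⇒≤ (≰⇒> (does-false (K ≤? count (g x y)) e))

  adj-sym : ∀ x y → adj x y ≡ adj y x
  adj-sym x y = cong (λ k → does (K ≤? k)) (sum-cong λ z → cong ⟦_⟧ (g-sym₁ x y z))

  adj-S : ∀ {x y} → adj x y ≡ true → S x ≡ true
  adj-S e = g-S (proj₂ (count-∃ (≤-trans (≤-trans (s≤s z≤n) (≤-trans (m≤n+m 4 (ℓ * t)) K≥)) (adj⇒ e))))

  adj-irr : ∀ x → adj x x ≡ false
  adj-irr x with adj x x in e
  ... | false = refl
  ... | true = ⊥-elim (g-≢ (proj₂ (count-∃ (≤-trans (≤-trans (s≤s z≤n) (≤-trans (m≤n+m 4 (ℓ * t)) K≥)) (adj⇒ e)))) refl)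

  adj-≢ : ∀ {x y} → adj x y ≡ true → x ≢ y
  adj-≢ {x} e refl = true≢false e (adj-irr x)

  -- Puts `x` and `y` at the two places joined by `e₁`, so that this extra edge becomes `xy`.
  over : Fin n → Fin n → (Fin ℓ → Fin t → Fin n) → Pos ℓ t → Fin n
  over x y κ (zero , zero) = x
  over x y κ (zero , 1F) = y
  over x y κ (zero , suc (suc r)) = κ zero (suc (suc r))
  over x y κ (suc p , r) = κ (suc p) r

  over-≢ : ∀ {x y κ w} → x ≢ w → y ≢ w → (∀ p r → κ p r ≢ w) → ∀ p → over x y κ p ≢ w
  over-≢ a b c (zero , zero) = a
  over-≢ a b c (zero , 1F) = b
  over-≢ a b c (zero , suc (suc r)) = c zero (suc (suc r))
  over-≢ a b c (suc p , r) = c (suc p) r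

  module _ (x y : Fin n) (κ : Fin ℓ → Fin t → Fin n) (x≢y : x ≢ y)
    (inj : ∀ p r r' → κ p r ≡ κ p r' → r ≡ r')
    (cross : ∀ p p' r r' → p ≢ p' → adj (κ p r) (κ p' r') ≡ true)
    (x-adj : ∀ p r → adj x (κ (suc p) r) ≡ true) (y-adj : ∀ p r → adj y (κ (suc p) r) ≡ true)
    (x≢ : ∀ r → x ≢ κ zero (suc (suc r))) (y≢ : ∀ r → y ≢ κ zero (suc (suc r))) where

    over-adj : ∀ p q → proj₁ p ≢ proj₁ q → adj (over x y κ p) (over x y κ q) ≡ true
    over-adj (zero , _) (zero , _) ne = ⊥-elim (ne refl)
    over-adj (zero , zero) (suc q , s) ne = x-adj q s
    over-adj (zero , 1F) (suc q , s) ne = y-adj q s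
    over-adj (zero , suc (suc r)) (suc q , s) ne = cross _ _ _ _ ne
    over-adj (suc p , r) (zero , zero) ne = trans (adj-sym _ _) (x-adj p r)
    over-adj (suc p , r) (zero , 1F) ne = trans (adj-sym _ _) (y-adj p r)
    over-adj (suc p , r) (zero , suc (suc s)) ne = cross _ _ _ _ ne
    over-adj (suc p , r) (suc q , s) ne = cross _ _ _ _ ne

    over-inj : ∀ {p q} → over x y κ p ≡ over x y κ q → p ≡ q
    over-inj {p} {q} e with proj₁ p Finₚ.≟ proj₁ q
    ... | no ne = ⊥-elim (adj-≢ (over-adj p q ne) e)
    over-inj {zero , zero} {zero , zero} e | yes _ = refl
    over-inj {zero , zero} {zero , 1F} e | yes _ = ⊥-elim (x≢y e)
    over-inj {zero , zero} {zero , suc (suc s)} e | yes _ = ⊥-elim (x≢ s e)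
    over-inj {zero , 1F} {zero , zero} e | yes _ = ⊥-elim (x≢y (sym e))
    over-inj {zero , 1F} {zero , 1F} e | yes _ = refl
    over-inj {zero , 1F} {zero , suc (suc s)} e | yes _ = ⊥-elim (y≢ s e)
    over-inj {zero , suc (suc r)} {zero , zero} e | yes _ = ⊥-elim (x≢ r (sym e))
    over-inj {zero , suc (suc r)} {zero , 1F} e | yes _ = ⊥-elim (y≢ r (sym e))
    over-inj {zero , suc (suc r)} {zero , suc (suc s)} e | yes _ = cong (zero ,_) (inj zero _ _ e)
    over-inj {suc p , r} {suc .p , s} e | yes refl = cong (suc p ,_) (inj (suc p) r s e)

    embOver : ∀ w₁ w₂ → w₁ ≢ w₂ → (∀ p → over x y κ p ≢ w₁) → (∀ p → over x y κ p ≢ w₂) →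
      χ (tri x y w₁) ≡ χ (tri (over x y κ (proj₁ (e₂ v))) (over x y κ (proj₂ (e₂ v))) w₂)
    embOver = emb (over x y κ) over-inj (λ p q ne → adj⇒ (over-adj p q ne))

    -- If xy is heavy, its expansion can avoid the colour of the other extra edge.
    ¬heavy : adj x y ≡ true → ⊥
    ¬heavy xy = apart (embOver w₁ w₂ w₁≢w₂ (miss im≢w₁) (miss im≢w₂))
      where
      fits : ℓ * t + 3 ≤ count (g x y)
      fits = ≤-trans (≤-trans (+-monoʳ-≤ (ℓ * t) (n≤1+n 3)) K≥) (adj⇒ xy)
      open FreshPair (freshPair (λ k → over x y κ (remQuot {ℓ} t k)) (g x y) (λ w → χ (tri x y w))
        (λ w → χ (tri (over x y κ (proj₁ (e₂ v))) (over x y κ (proj₂ (e₂ v))) w)) (λ a b → g-inj₃) fits)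
      miss : ∀ {w} → (∀ k → over x y κ (remQuot {ℓ} t k) ≢ w) → ∀ p → over x y κ p ≢ w
      miss h p e = h (combine (proj₁ p) (proj₂ p)) (trans (cong (over x y κ) (Finₚ.remQuot-combine {ℓ} {t} (proj₁ p) (proj₂ p))) e)

  other : (i : Fin ℓ) → ∃ λ k → i ≢ k
  other zero = 1F , λ ()
  other (suc i) = zero , λ ()

  -- A relabelling that makes `i` the first part reduces this to `¬heavy`.
  plusFree : (κ : Fin ℓ → Fin t → Fin n) → (∀ p r r' → κ p r ≡ κ p r' → r ≡ r') →
    (∀ p p' r r' → p ≢ p' → adj (κ p r) (κ p' r') ≡ true) → ∀ i x y →
    (∀ p r → p ≢ i → adj x (κ p r) ≡ true) → (∀ p r → p ≢ i → adj y (κ p r) ≡ true) →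
    (∀ r → x ≢ κ i r) → (∀ r → y ≢ κ i r) → adj x y ≡ false
  plusFree κ inj cross i x y x-adj y-adj x≢ y≢ with adj x y in xy | move i (proj₁ (other i)) (proj₂ (other i))
  ... | false | _ = refl
  ... | true | σ , σ-inj , refl , _ = ⊥-elim (¬heavy x y (κ ∘ σ) (adj-≢ xy) (λ p → inj (σ p)) (λ p p' r r' ne → cross _ _ r r' (ne ∘ σ-inj))
      (λ p r → x-adj _ r (λ e → case σ-inj e of λ ())) (λ p r → y-adj _ r (λ e → case σ-inj e of λ ())) (λ r → x≢ _) (λ r → y≢ _) xy)

  -- Since `x` is joined to everything, it can act as a vertex of the first part. Together with one
  -- vertex of that part it forms an edge inside a part of the remaining `K_ℓ[t]`.
  coneFree : ∀ x → Blow adj (adj x) ℓ (suc t) → ⊥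
  coneFree x B = true≢false (inP zero zero) (plusFree (λ p r → κ p (suc r)) (λ p r r' e → Finₚ.suc-injective (inj p _ _ e)) (λ p p' r r' → cross p p' _ _)
      zero x (κ zero zero) (λ p r _ → inP p (suc r)) (λ p r ne → cross zero p zero (suc r) (ne ∘ sym)) (λ r → adj-≢ (inP zero (suc r))) (λ r e → case inj zero _ _ e of λ ()))
    where open Blow B

-- All that the counting arguments below use of heavy pairs. The two forbidden configurations are
-- the same for every variant, so the variant does not appear.
record HeavyGraph {n m : ℕ} {χ : Coloring n m} (F : Family χ) (ℓ t K : ℕ) : Set where
  open Family F
  field
    adj     : Fin n → Fin n → Bool
    adj-sym : ∀ x y → adj x y ≡ adj y x
    adj-irr : ∀ x → adj x x ≡ false
    adj-S   : ∀ {x y} → adj x y ≡ true → S x ≡ true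
    ¬adj⇒   : ∀ {x y} → adj x y ≡ false → count (g x y) ≤ K
    coneFree : ∀ x → Blow adj (adj x) ℓ (suc t) → ⊥
    plusFree : (κ : Fin ℓ → Fin t → Fin n) → (∀ p r r' → κ p r ≡ κ p r' → r ≡ r') →
      (∀ p p' r r' → p ≢ p' → adj (κ p r) (κ p' r') ≡ true) → ∀ i x y →
      (∀ p r → p ≢ i → adj x (κ p r) ≡ true) → (∀ p r → p ≢ i → adj y (κ p r) ≡ true) →
      (∀ r → x ≢ κ i r) → (∀ r → y ≢ κ i r) → adj x y ≡ false

  adj-S' : ∀ {x y} → adj x y ≡ true → S y ≡ true
  adj-S' {x} {y} e = adj-S (trans (adj-sym y x) e)

  adj-≢ : ∀ {x y} → adj x y ≡ true → x ≢ y
  adj-≢ {x} e refl = true≢false e (adj-irr x)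

-- Density estimates for Erdős-Stone

*-reassoc : ∀ a b c → a * (b * c) ≡ b * (a * c)
*-reassoc = solve-∀

square-cancel : ∀ {a b} → a * a ≤ b * b → a ≤ b
square-cancel {a} {b} h with a ≤? b
... | yes p = p
... | no ¬p = ⊥-elim (<⇒≱ (*-mono-< (≰⇒> ¬p) (≰⇒> ¬p)) h)

-- A vertex of degree d with E'd + q ≤ E'jq would have a link dense enough for Erdős–Stone.
link-dense : ∀ j' e' q d e lt r → 1 ≤ j' → let j = suc j' ; E' = suc e' ; E = 2 * j * E' ; E3 = 4 * E' in
  j * j' * (q * q) ≤ e + (lt + r) → E3 * lt ≤ q * q → E3 * r ≤ q * q → E' * d + q ≤ E' * (j * q) →
  (j' * E + 1) * (d * d) ≤ j * E * e
link-dense j' e' q d e lt r 1≤j' hD hlt hr hd = *-cancelˡ-≤ (E' * E3) (+-cancelʳ-≤ (8 * (j * j) * (E' * E') * X) _ _ (begin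
  E' * E3 * ((j' * E + 1) * (d * d)) + 8 * (j * j) * (E' * E') * X
    ≤⟨ +-monoʳ-≤ (E' * E3 * ((j' * E + 1) * (d * d))) slack8 ⟩
  E' * E3 * ((j' * E + 1) * (d * d)) + (j' * E + 1) * E3 * (j * X) ≡⟨ l₁ E' E3 (j' * E + 1) (d * d) (j * X) ⟩
  (j' * E + 1) * E3 * (E' * (d * d) + j * X) ≤⟨ *-monoʳ-≤ ((j' * E + 1) * E3) B ⟩
  (j' * E + 1) * E3 * (E' * (j * j) * X) ≡⟨ l₂ j j' E E3 E' X ⟩
  j * E * E' * (E3 * (j * j' * X)) + E3 * (E' * (j * j) * X) ≤⟨ +-monoˡ-≤ _ (*-monoʳ-≤ (j * E * E') A) ⟩
  j * E * E' * (E3 * e + 2 * X) + E3 * (E' * (j * j) * X) ≡⟨ l₃ j E' e X ⟩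
  E' * E3 * (j * E * e) + 8 * (j * j) * (E' * E') * X ∎))
  where
  open ≤-Reasoning
  j E' E E3 X : ℕ
  j = suc j'
  E' = suc e'
  E = 2 * j * E'
  E3 = 4 * E'
  X = q * q
  A : E3 * (j * j' * X) ≤ E3 * e + 2 * X
  A = ≤-trans (*-monoʳ-≤ E3 hD) (≤-trans (≤-reflexive (lem E3 e lt r)) (+-monoʳ-≤ (E3 * e) (≤-trans (+-mono-≤ hlt hr) (≤-reflexive (cong (X +_) (sym (+-identityʳ X)))))))
    where
    lem : ∀ a e l r → a * (e + (l + r)) ≡ a * e + (a * l + a * r)
    lem = solve-∀
  B : E' * (d * d) + j * X ≤ E' * (j * j) * X
  B with slack hd
  ... | w , eq = *-cancelˡ-≤ E' (begin
    E' * (E' * (d * d) + j * X) ≡⟨ m₁ E' d j q ⟩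
    E' * d * (E' * d) + q * (E' * (j * q)) ≤⟨ +-monoʳ-≤ _ (*-monoˡ-≤ (E' * (j * q)) (≤-trans (m≤m+n q w) (m≤n+m (q + w) 0))) ⟩
    E' * d * (E' * d) + (q + w) * (E' * (j * q)) ≤⟨ m≤m+n _ (E' * d * (q + w)) ⟩
    E' * d * (E' * d) + (q + w) * (E' * (j * q)) + E' * d * (q + w) ≡⟨ cong (λ z → E' * d * (E' * d) + (q + w) * z + E' * d * (q + w)) eq ⟩
    E' * d * (E' * d) + (q + w) * (E' * d + q + w) + E' * d * (q + w) ≡⟨ m₂ (E' * d) q w ⟩
    (E' * d + q + w) * (E' * d + q + w) ≡⟨ cong₂ _*_ (sym eq) (sym eq) ⟩
    E' * (j * q) * (E' * (j * q)) ≡⟨ m₃ E' j q ⟩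
    E' * (E' * (j * j) * X) ∎)
    where
    m₁ : ∀ E d j q → E * (E * (d * d) + j * (q * q)) ≡ E * d * (E * d) + q * (E * (j * q))
    m₁ = solve-∀
    m₂ : ∀ a q w → a * a + (q + w) * (a + q + w) + a * (q + w) ≡ (a + q + w) * (a + q + w)
    m₂ = solve-∀
    m₃ : ∀ E j q → E * (j * q) * (E * (j * q)) ≡ E * (E * (j * j) * (q * q))
    m₃ = solve-∀
  slack8 : 8 * (j * j) * (E' * E') * X ≤ (j' * E + 1) * E3 * (j * X)
  slack8 = begin
    8 * (j * j) * (E' * E') * X ≡⟨ n₁' j E' X ⟩
    1 * E * E3 * (j * X) ≤⟨ *-monoˡ-≤ (j * X) (*-monoˡ-≤ E3 (≤-trans (*-monoˡ-≤ E 1≤j') (m≤m+n (j' * E) 1))) ⟩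
    (j' * E + 1) * E3 * (j * X) ∎
    where
    n₁' : ∀ j E X → 8 * (j * j) * (E * E) * X ≡ 1 * (2 * j * E) * (4 * E) * (j * X)
    n₁' = solve-∀
  l₁ : ∀ a b c d e → a * b * (c * d) + c * b * e ≡ c * b * (a * d + e)
  l₁ = solve-∀
  l₂ : ∀ j j' E E3 E' X → (j' * E + 1) * E3 * (E' * (j * j) * X) ≡ j * E * E' * (E3 * (j * j' * X)) + E3 * (E' * (j * j) * X)
  l₂ = solve-∀
  l₃ : ∀ j E' e X → j * (2 * j * E') * E' * (4 * E' * e + 2 * X) + 4 * E' * (E' * (j * j) * X) ≡ E' * (4 * E') * (j * (2 * j * E') * e) + 8 * (j * j) * (E' * E') * X
  l₃ = solve-∀

-- Makes the heavy neighbourhood large enough for the threshold `n₁`: the heavy edges of the link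
-- are about `j j' q²` or more, and they live on `d` vertices.
link-large : ∀ j' e' q d e lt r → 1 ≤ j' → let j = suc j' ; E3 = 4 * suc e' in
  j * j' * (q * q) ≤ e + (lt + r) → E3 * lt ≤ q * q → E3 * r ≤ q * q → e ≤ d * d → q ≤ d
link-large j' e' q d e lt r 1≤j' hD hlt hr hd = square-cancel (≤-trans (*-cancelˡ-≤ E3 (+-cancelʳ-≤ (2 * X) _ _ (begin
  E3 * X + 2 * X ≤⟨ +-monoʳ-≤ (E3 * X) (*-monoˡ-≤ X (≤-trans (s≤s (s≤s z≤n)) (m≤m*n 4 (suc e')))) ⟩
  E3 * X + E3 * X ≡⟨ l₁ E3 X ⟩
  E3 * (2 * X) ≤⟨ *-monoʳ-≤ E3 (*-monoˡ-≤ X (*-mono-≤ (s≤s 1≤j') 1≤j')) ⟩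
  E3 * (suc j' * j' * X) ≤⟨ *-monoʳ-≤ E3 hD ⟩
  E3 * (e + (lt + r)) ≡⟨ lem E3 e lt r ⟩
  E3 * e + (E3 * lt + E3 * r) ≤⟨ +-monoʳ-≤ (E3 * e) (≤-trans (+-mono-≤ hlt hr) (≤-reflexive (cong (X +_) (sym (+-identityʳ X))))) ⟩
  E3 * e + 2 * X ∎))) hd)
  where
  open ≤-Reasoning
  E3 X : ℕ
  E3 = 4 * suc e'
  X = q * q
  l₁ : ∀ a x → a * x + a * x ≡ a * (2 * x)
  l₁ = solve-∀
  lem : ∀ a e l r → a * (e + (l + r)) ≡ a * e + (a * l + a * r)
  lem = solve-∀

-- Degrees close to `jq` among at most about `ℓq` vertices mean density near `1 - 1/ℓ`, while
-- `1 - 1/(ℓ-1)` with some margin is enough; large `E'` and `q` absorb the errors.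
ok-dense : ∀ j' e' q p e → 1 ≤ j' → let j = suc j' ; E' = suc e' ; E = 2 * j * E' in
  2 * j + 2 ≤ E' → ((j * j + 1) * E + (j + 1)) * E' ≤ q → p ≤ q * suc j + suc j →
  p * (E' * (j * q)) ≤ E' * e + p * (2 * q) → (j' * E + 1) * (p * p) ≤ j * E * e
ok-dense j' e' q p e 1≤j' hE hq hp he = *-cancelˡ-≤ E' (+-cancelʳ-≤ (j * E * (p * (2 * q))) _ _ (begin
  E' * ((j' * E + 1) * (p * p)) + j * E * (p * (2 * q)) ≡⟨ l₁ E' (j' * E + 1) p (j * E) q ⟩
  p * ((j' * E + 1) * E' * p + j * E * (2 * q)) ≤⟨ *-monoʳ-≤ p inner ⟩
  p * (j * E * (E' * (j * q))) ≡⟨ *-reassoc p (j * E) _ ⟩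
  j * E * (p * (E' * (j * q))) ≤⟨ *-monoʳ-≤ (j * E) he ⟩
  j * E * (E' * e + p * (2 * q)) ≡⟨ l₂ (j * E) E' e (p * (2 * q)) ⟩
  E' * (j * E * e) + j * E * (p * (2 * q)) ∎))
  where
  open ≤-Reasoning
  j E' E : ℕ
  j = suc j'
  E' = suc e'
  E = 2 * j * E'
  l₁ : ∀ a b p c q → a * (b * (p * p)) + c * (p * (2 * q)) ≡ p * (b * a * p + c * (2 * q))
  l₁ = solve-∀
  l₂ : ∀ a b c d → a * (b * c + d) ≡ b * (a * c) + a * d
  l₂ = solve-∀
  inner : (j' * E + 1) * E' * p + j * E * (2 * q) ≤ j * E * (E' * (j * q))
  inner = begin
    (j' * E + 1) * E' * p + j * E * (2 * q) ≤⟨ +-monoˡ-≤ _ (*-monoʳ-≤ ((j' * E + 1) * E') hp) ⟩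
    (j' * E + 1) * E' * (q * suc j + suc j) + j * E * (2 * q) ≤⟨ +-monoˡ-≤ (j * E * (2 * q)) (m≤m+n ((j' * E + 1) * E' * (q * suc j + suc j)) (2 * E * E')) ⟩
    (j' * E + 1) * E' * (q * suc j + suc j) + 2 * E * E' + j * E * (2 * q) ≡⟨ n₁' j' E E' q ⟩
    j' * suc j * E * E' * q + (suc j * E' * q + 2 * j * E * q + ((j * j + 1) * E + (j + 1)) * E')
      ≤⟨ +-monoʳ-≤ (j' * suc j * E * E' * q) (+-mono-≤ (+-monoˡ-≤ (2 * j * E * q) (*-monoˡ-≤ q (*-monoˡ-≤ E' (s≤s (≤-trans (≤-reflexive (+-comm 1 j')) (+-monoʳ-≤ j' (s≤s z≤n))))))) (≤-trans hq (m≤n*m q E))) ⟩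
    j' * suc j * E * E' * q + ((j + (j + 0)) * E' * q + 2 * j * E * q + E * q) ≡⟨ n₂' j' E' q ⟩
    j' * suc j * E * E' * q + E * ((2 * j + 2) * q) ≤⟨ +-monoʳ-≤ (j' * suc j * E * E' * q) (*-monoʳ-≤ E (*-monoˡ-≤ q hE)) ⟩
    j' * suc j * E * E' * q + E * (E' * q) ≡⟨ n₃' j' E E' q ⟩
    j * E * (E' * (j * q)) ∎
    where
    n₁' : ∀ j' E E' q → (j' * E + 1) * E' * (q * suc (suc j') + suc (suc j')) + 2 * E * E' + suc j' * E * (2 * q) ≡
      j' * suc (suc j') * E * E' * q + (suc (suc j') * E' * q + 2 * suc j' * E * q + ((suc j' * suc j' + 1) * E + (suc j' + 1)) * E')
    n₁' = solve-∀
    n₂' : ∀ j' E' q → j' * suc (suc j') * (2 * suc j' * E') * E' * q + ((suc j' + (suc j' + 0)) * E' * q + 2 * suc j' * (2 * suc j' * E') * q + (2 * suc j' * E') * q) ≡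
      j' * suc (suc j') * (2 * suc j' * E') * E' * q + (2 * suc j' * E') * ((2 * suc j' + 2) * q)
    n₂' = solve-∀
    n₃' : ∀ j' E E' q → j' * suc (suc j') * E * E' * q + E * (E' * q) ≡ suc j' * E * (E' * (suc j' * q))
    n₃' = solve-∀

-- Heavy and light pairs in the link of a vertex

sum-⟦⟧-≤ : ∀ {n} {f : Fin n → Bool} {c} → (∀ x → f x ≡ true → count f ≤ c) → count f ≤ c
sum-⟦⟧-≤ {f = f} h with 1 ≤? count f
... | yes p = case count-∃ p of λ { (x , e) → h x e }
... | no ¬p = ≤-trans (≤-pred (≰⇒> ¬p)) z≤n

⟦⟧*-true : ∀ {b} k → b ≡ true → k ≤ ⟦ b ⟧ * k
⟦⟧*-true k refl = ≤-reflexive (sym (+-identityʳ k))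

module Light {n m : ℕ} {χ : Coloring n m} {F : Family χ} {ℓ t K : ℕ} (H : HeavyGraph F ℓ t K) where
  open Family F public
  open HeavyGraph H public
  open SimpleGraph adj adj-sym adj-irr public

  s : ℕ
  s = count S

  g-S₂ : ∀ {x y z} → g x y z ≡ true → S y ≡ true
  g-S₂ {x} {y} {z} e = g-S (trans (g-sym₁ y x z) e)

  g-S₃ : ∀ {x y z} → g x y z ≡ true → S z ≡ true
  g-S₃ {x} {y} {z} e = g-S₂ (trans (g-sym₂ x z y) e)

  -- A light pair `vx` extends to at most `K` triples, and `x` ranges over `S`.
  lightRow : ∀ v → sum (λ x → sum λ y → ⟦ g v x y ∧ not (adj v x) ⟧) ≤ s * K
  lightRow v = ≤-trans (sum-mono row) (≤-reflexive (sym (sum-* _ K)))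
    where
    row : ∀ x → sum (λ y → ⟦ g v x y ∧ not (adj v x) ⟧) ≤ ⟦ S x ⟧ * K
    row x = sum-⟦⟧-≤ {f = λ y → g v x y ∧ not (adj v x)} λ y e → ≤-trans (≤-trans (count-mono {q = g v x} λ z e' → ∧-proj₁ {g v x z} e') (¬adj⇒ (not-elim (∧-proj₂ {g v x y} e))))
      (⟦⟧*-true K (g-S₂ (∧-proj₁ {g v x y} e)))

  lightCol : ∀ v → sum (λ x → sum λ y → ⟦ g v x y ∧ not (adj v y) ⟧) ≤ s * K
  lightCol v = ≤-trans (≤-reflexive (trans (sum-swap _) (sum-cong λ y → sum-cong λ x → cong (λ b → ⟦ b ∧ not (adj v y) ⟧) (g-sym₂ v x y)))) (lightRow v)

  -- Counts light pairs opposite to `v`. Unlike the light pairs at `v` they are controlled only on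
  -- average over `v`, by `lt-total`.
  lt : Fin n → ℕ
  lt v = sum λ x → sum λ y → ⟦ g v x y ∧ not (adj x y) ⟧

  lt-total : sum lt ≤ s * (s * K)
  lt-total = ≤-trans (≤-reflexive (trans (sum-swap _) (sum-cong λ x → sum-swap _)))
    (≤-trans (sum-mono λ x → sum-mono λ y → cell x y) (≤-reflexive (trans (sum-cong λ x → trans (sym (*-sum ⟦ S x ⟧ _)) (cong (⟦ S x ⟧ *_) (sym (sum-* _ K)))) (sym (sum-* _ (s * K))))))
    where
    cell : ∀ x y → sum (λ v → ⟦ g v x y ∧ not (adj x y) ⟧) ≤ ⟦ S x ⟧ * (⟦ S y ⟧ * K)
    cell x y = sum-⟦⟧-≤ {f = λ v → g v x y ∧ not (adj x y)} λ v e →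
      ≤-trans (≤-trans (count-mono {q = g x y} λ w e' → trans (sym (trans (g-sym₁ w x y) (g-sym₂ x w y))) (∧-proj₁ {g w x y} e')) (¬adj⇒ (not-elim (∧-proj₂ {g v x y} e))))
        (≤-trans (⟦⟧*-true K (g-S₃ (∧-proj₁ {g v x y} e))) (⟦⟧*-true _ (g-S₂ (∧-proj₁ {g v x y} e))))

  link-split : ∀ v → sum (λ x → sum λ y → ⟦ g v x y ⟧) ≤ edges (adj v) + (lt v + 2 * (s * K))
  link-split v = begin
    sum (λ x → sum λ y → ⟦ g v x y ⟧) ≤⟨ sum-mono (λ x → sum-mono λ y → pt x y) ⟩
    sum (λ x → sum λ y → ⟦ adj v x ⟧ * ⟦ adj v y ∧ adj x y ⟧ + (⟦ g v x y ∧ not (adj x y) ⟧ + (⟦ g v x y ∧ not (adj v x) ⟧ + ⟦ g v x y ∧ not (adj v y) ⟧)))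
      ≡⟨ trans (sum₂-+ (λ x y → ⟦ adj v x ⟧ * ⟦ adj v y ∧ adj x y ⟧) _) (cong₂ _+_ (sum-cong λ x → sym (*-sum ⟦ adj v x ⟧ _)) (trans (sum₂-+ (λ x y → ⟦ g v x y ∧ not (adj x y) ⟧) _) (cong (lt v +_) (sum₂-+ _ _)))) ⟩
    edges (adj v) + (lt v + (sum (λ x → sum λ y → ⟦ g v x y ∧ not (adj v x) ⟧) + sum (λ x → sum λ y → ⟦ g v x y ∧ not (adj v y) ⟧)))
      ≤⟨ +-monoʳ-≤ (edges (adj v)) (+-monoʳ-≤ (lt v) (+-mono-≤ (lightRow v) (≤-trans (lightCol v) (≤-reflexive (sym (+-identityʳ (s * K))))))) ⟩
    edges (adj v) + (lt v + 2 * (s * K)) ∎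
    where
    open ≤-Reasoning
    sum₂-+ : ∀ (f h : Fin n → Fin n → ℕ) → sum (λ x → sum λ y → f x y + h x y) ≡ sum (λ x → sum λ y → f x y) + sum (λ x → sum λ y → h x y)
    sum₂-+ f h = trans (sum-cong λ x → sum-+ _ _) (sum-+ _ _)
    pt : ∀ x y → ⟦ g v x y ⟧ ≤ ⟦ adj v x ⟧ * ⟦ adj v y ∧ adj x y ⟧ + (⟦ g v x y ∧ not (adj x y) ⟧ + (⟦ g v x y ∧ not (adj v x) ⟧ + ⟦ g v x y ∧ not (adj v y) ⟧))
    pt x y = bools (g v x y) (adj v x) (adj v y) (adj x y)
      where
      bools : ∀ a b c d → ⟦ a ⟧ ≤ ⟦ b ⟧ * ⟦ c ∧ d ⟧ + (⟦ a ∧ not d ⟧ + (⟦ a ∧ not b ⟧ + ⟦ a ∧ not c ⟧))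
      bools false b c d = z≤n
      bools true true true true = ≤-refl
      bools true true true false = s≤s z≤n
      bools true true false true = s≤s z≤n
      bools true true false false = s≤s z≤n
      bools true false true true = s≤s z≤n
      bools true false true false = s≤s z≤n
      bools true false false true = s≤s z≤n
      bools true false false false = s≤s z≤n

count-disjoint : ∀ {n} {p q r : Fin n → Bool} → p ⊑ r → q ⊑ r → (∀ x → p x ≡ true → q x ≡ true → ⊥) → count p + count q ≤ count r
count-disjoint {p = p} {q} {r} p⊑r q⊑r dis = ≤-trans (≤-reflexive (sym (sum-+ _ _))) (sum-mono pt)
  where
  pt : ∀ x → ⟦ p x ⟧ + ⟦ q x ⟧ ≤ ⟦ r x ⟧
  pt x with p x in ep | q x in eq
  ... | true | true = ⊥-elim (dis x ep eq)
  ... | true | false = ⟦⟧-true (p⊑r x ep)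
  ... | false | true = ⟦⟧-true (q⊑r x eq)
  ... | false | false = z≤n

count-both : ∀ {n} (p q : Fin n → Bool) → count p + count q ≤ n + count (λ x → p x ∧ q x)
count-both {n} p q = ≤-trans (≤-reflexive (sym (sum-+ _ _))) (≤-trans (sum-mono (λ x → pt (p x) (q x))) (≤-reflexive (trans (sum-+ (λ _ → 1) _) (cong (_+ count (λ x → p x ∧ q x)) (trans (sum-const n 1) (*-identityʳ n))))))
  where
  pt : ∀ a b → ⟦ a ⟧ + ⟦ b ⟧ ≤ 1 + ⟦ a ∧ b ⟧
  pt true true = ≤-refl
  pt true false = ≤-refl
  pt false true = ≤-refl
  pt false false = z≤n

-- Near-complete ℓ-partite structure with ℓ parts of size about q and error q/E.
record Parts {n : ℕ} (S : Fin n → Bool) (adj : Fin n → Fin n → Bool) (ℓ q E : ℕ) : Set where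
  field
    B        : Fin ℓ → Fin n → Bool
    B⊑S      : ∀ p → B p ⊑ S
    disjoint : ∀ {p p' x} → B p x ≡ true → B p' x ≡ true → p ≡ p'
    rest     : E * count (λ x → S x ∧ not (any λ p → B p x)) ≤ q
    B≤       : ∀ p → E * count (B p) ≤ suc E * q
    B≥       : ∀ p → E * q ≤ E * count (B p) + q
    sparse   : ∀ {p p' x} → p ≢ p' → B p x ≡ true → E * count (λ y → B p' y ∧ not (adj x y)) ≤ q

-- Arithmetic for `nf≤`: `Z` is squeezed between `ℓT(jq - q/E')` and `s(jT + t) - N t E'`, and `s`
-- is about `ℓq`, so the terms with `jT` nearly cancel.
notFull-bound : ∀ j' e' t q s Z N → let j = suc j' ; ℓ = suc j ; E' = suc e' ; T = suc t + 2 * (t * E') in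
  1 ≤ t → ℓ * T * (E' * (j * q)) ≤ E' * Z + ℓ * T * q → Z + N * (t * E') ≤ s * (j * T + t) → s ≤ q * ℓ + ℓ → j * T + t ≤ q → E' * N ≤ 6 * ℓ * q
notFull-bound j' e' t q s Z N 1≤t hL hU hs hq = *-cancelˡ-≤ (t * E') ⦃ m*n≢0 t E' ⦃ >-nonZero 1≤t ⦄ ⦄ (+-cancelʳ-≤ (ℓ * T * (E' * (j * q))) _ _ (begin
  t * E' * (E' * N) + ℓ * T * (E' * (j * q)) ≤⟨ +-monoʳ-≤ (t * E' * (E' * N)) hL ⟩
  t * E' * (E' * N) + (E' * Z + ℓ * T * q) ≡⟨ l₁ t E' N Z (ℓ * T * q) ⟩
  E' * (Z + N * (t * E')) + ℓ * T * q ≤⟨ +-monoˡ-≤ (ℓ * T * q) (*-monoʳ-≤ E' (≤-trans hU (*-monoˡ-≤ (j * T + t) hs))) ⟩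
  E' * ((q * ℓ + ℓ) * (j * T + t)) + ℓ * T * q ≡⟨ l₂ E' q ℓ j T t ⟩
  E' * (q * ℓ * t) + E' * ℓ * (j * T + t) + ℓ * T * q + ℓ * T * (E' * (j * q))
    ≤⟨ +-monoˡ-≤ (ℓ * T * (E' * (j * q))) (+-mono-≤ (+-monoʳ-≤ (E' * (q * ℓ * t)) (≤-trans (*-monoʳ-≤ (E' * ℓ) hq) (≤-trans (≤-reflexive (sym (*-identityʳ (E' * ℓ * q)))) (*-monoʳ-≤ (E' * ℓ * q) 1≤t)))) (*-monoˡ-≤ q (*-monoʳ-≤ ℓ T≤))) ⟩
  E' * (q * ℓ * t) + E' * ℓ * q * t + ℓ * (4 * (t * E')) * q + ℓ * T * (E' * (j * q)) ≡⟨ cong (_+ ℓ * T * (E' * (j * q))) (l₃ E' q ℓ t) ⟩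
  t * E' * (6 * ℓ * q) + ℓ * T * (E' * (j * q)) ∎))
  where
  open ≤-Reasoning
  j ℓ E' T : ℕ
  j = suc j'
  ℓ = suc j
  E' = suc e'
  T = suc t + 2 * (t * E')
  l₁ : ∀ t e N Z x → t * e * (e * N) + (e * Z + x) ≡ e * (Z + N * (t * e)) + x
  l₁ = solve-∀
  l₂ : ∀ e q l j T t → e * ((q * l + l) * (j * T + t)) + l * T * q ≡ e * (q * l * t) + e * l * (j * T + t) + l * T * q + l * T * (e * (j * q))
  l₂ = solve-∀
  l₃ : ∀ e q l t → e * (q * l * t) + e * l * q * t + l * (4 * (t * e)) * q ≡ t * e * (6 * l * q)
  l₃ = solve-∀
  T≤ : T ≤ 4 * (t * E')
  T≤ = ≤-trans (+-monoˡ-≤ (2 * (t * E')) (≤-trans (≤-trans (≤-reflexive (+-comm 1 t)) (+-monoʳ-≤ t 1≤t)) (+-mono-≤ (m≤m*n t E') (m≤m*n t E')))) (≤-reflexive (lem (t * E')))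
    where
    lem : ∀ x → x + x + 2 * x ≡ 4 * x
    lem = solve-∀

-- Vertices with few light pairs, and a large blow-up among them

module Dense {n m : ℕ} {χ : Coloring n m} {F : Family χ} {j' t K : ℕ} (H : HeavyGraph F (suc (suc j')) t K)
  (1≤j' : 1 ≤ j') (q e' T C₀ : ℕ) (1≤T : 1 ≤ T)
  (s≥ : q * suc (suc j') ≤ count (Family.S F)) (s≤ : count (Family.S F) ≤ q * suc (suc j') + suc (suc j'))
  (D≥ : ∀ v → Family.S F v ≡ true → suc j' * j' * (q * q) ≤ sum λ x → sum λ y → ⟦ Family.g F v x y ⟧)
  (C₀≡ : C₀ ≡ 4 * suc e' * (K * ((2 * suc (suc j')) * (2 * suc (suc j')))))
  (E'≥ : 2 * suc j' + 2 ≤ suc e')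
  (q≥₁ : n₁ j' (2 * suc j' * suc e') (suc t) ≤ q)
  (q≥₂ : 4 * suc e' * (2 * ((2 * suc (suc j')) * K)) ≤ q)
  (q≥₃ : ((suc j' * suc j' + 1) * (2 * suc j' * suc e') + (suc j' + 1)) * suc e' ≤ q)
  (q≥₄ : suc e' * C₀ ≤ q)
  (q≥₅ : n₁ j' (2 * suc j' * suc e') T + C₀ ≤ q) where

  open Light H public

  ℓ j E' E E3 : ℕ
  ℓ = suc (suc j')
  j = suc j'
  E' = suc e'
  E = 2 * j * E'
  E3 = 4 * E'

  1≤q : 1 ≤ q
  1≤q = ≤-trans (s≤s z≤n) q≥₃

  s≤2ℓq : s ≤ 2 * ℓ * q
  s≤2ℓq = ≤-trans s≤ (≤-trans (+-monoʳ-≤ (q * ℓ) (m≤n*m ℓ q ⦃ >-nonZero 1≤q ⦄)) (≤-reflexive (lem q ℓ)))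
    where
    lem : ∀ q l → q * l + q * l ≡ 2 * l * q
    lem = solve-∀

  OK bad : Fin n → Bool
  OK v = S v ∧ does (E3 * lt v ≤? q * q)
  bad v = S v ∧ not (does (E3 * lt v ≤? q * q))

  -- Markov's inequality: the total of `lt` and the threshold are both quadratic in `q`, so the
  -- number of exceptions is bounded by a constant.
  bad≤ : count bad ≤ C₀
  bad≤ = *-cancelʳ-≤ (count bad) C₀ (q * q) ⦃ m*n≢0 q q ⦃ >-nonZero 1≤q ⦄ ⦃ >-nonZero 1≤q ⦄ ⦄ (begin
    count bad * (q * q) ≤⟨ sum-on-≥ bad (q * q) (λ v e → <⇒≤ (≰⇒> (does-false (E3 * lt v ≤? q * q) (not-elim (∧-proj₂ {S v} e))))) ⟩
    sum (λ v → ⟦ bad v ⟧ * (E3 * lt v)) ≤⟨ sum-mono (λ v → ≤-trans (*-monoˡ-≤ (E3 * lt v) (⟦⟧≤1 (bad v))) (≤-reflexive (+-identityʳ _))) ⟩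
    sum (λ v → E3 * lt v) ≡⟨ sym (*-sum E3 lt) ⟩
    E3 * sum lt ≤⟨ *-monoʳ-≤ E3 (≤-trans lt-total (*-mono-≤ s≤2ℓq (*-monoˡ-≤ K s≤2ℓq))) ⟩
    E3 * (2 * ℓ * q * (2 * ℓ * q * K)) ≡⟨ lem E3 (2 * ℓ) q K ⟩
    E3 * (K * (2 * ℓ * (2 * ℓ))) * (q * q) ≡⟨ cong (_* (q * q)) (sym C₀≡) ⟩
    C₀ * (q * q) ∎)
    where
    open ≤-Reasoning
    lem : ∀ e l q k → e * (l * q * (l * q * k)) ≡ e * (k * (l * l)) * (q * q)
    lem = solve-∀

  -- Otherwise the heavy edges of the link would be crowded into so small a neighbourhood that
  -- Erdős-Stone yields a `K_ℓ[t+1]` there, against `coneFree`.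
  minDeg : ∀ v → OK v ≡ true → E' * (j * q) ≤ E' * count (adj v) + q
  minDeg v ok with E' * (j * q) ≤? E' * count (adj v) + q
  ... | yes h = h
  ... | no ¬h = ⊥-elim (coneFree v (erdős-stone adj adj-sym adj-irr j' (pred E) (suc t) (adj v) (s≤s z≤n)
          (≤-trans q≥₁ (link-large j' e' q (count (adj v)) (edges (adj v)) (lt v) (2 * (s * K)) 1≤j' hD hlt hr (edges-≤ (adj v))))
          (link-dense j' e' q (count (adj v)) (edges (adj v)) (lt v) (2 * (s * K)) 1≤j' hD hlt hr (<⇒≤ (≰⇒> ¬h)))))
    where
    hD : j * j' * (q * q) ≤ edges (adj v) + (lt v + 2 * (s * K))
    hD = ≤-trans (D≥ v (∧-proj₁ {S v} ok)) (link-split v)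
    hlt : E3 * lt v ≤ q * q
    hlt = does-true (E3 * lt v ≤? q * q) (∧-proj₂ {S v} ok)
    hr : E3 * (2 * (s * K)) ≤ q * q
    hr = ≤-trans (*-monoʳ-≤ E3 (*-monoʳ-≤ 2 (*-monoˡ-≤ K s≤2ℓq))) (≤-trans (≤-reflexive (lem E3 (2 * ℓ) q K)) (*-monoˡ-≤ q q≥₂))
      where
      lem : ∀ e l q k → e * (2 * (l * q * k)) ≡ e * (2 * (l * k)) * q
      lem = solve-∀

  anchor : Blow adj OK ℓ T
  anchor = erdős-stone adj adj-sym adj-irr j' (pred E) T OK 1≤T big
      (ok-dense j' e' q (count OK) (edges OK) 1≤j' E'≥ q≥₃ (≤-trans (count-mono {q = S} λ x → ∧-proj₁ {S x}) s≤) total)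
    where
    big : n₁ j' E T ≤ count OK
    big = +-cancelʳ-≤ C₀ _ _ (≤-trans q≥₅ (≤-trans (≤-trans (m≤m*n q ℓ) s≥) (≤-trans (≤-reflexive (count-split S (λ v → does (E3 * lt v ≤? q * q)))) (+-monoʳ-≤ (count OK) bad≤))))
    degOK : ∀ x → OK x ≡ true → E' * (j * q) ≤ E' * deg OK x + 2 * q
    degOK x ok = begin
      E' * (j * q) ≤⟨ minDeg x ok ⟩
      E' * count (adj x) + q ≤⟨ +-monoˡ-≤ q (*-monoʳ-≤ E' (≤-trans (count-or {r = bad} (λ z e → sort z e)) (+-monoʳ-≤ (deg OK x) bad≤))) ⟩
      E' * (deg OK x + C₀) + q ≡⟨ cong (_+ q) (*-distribˡ-+ E' (deg OK x) C₀) ⟩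
      E' * deg OK x + E' * C₀ + q ≤⟨ +-monoˡ-≤ q (+-monoʳ-≤ (E' * deg OK x) q≥₄) ⟩
      E' * deg OK x + q + q ≡⟨ lem (E' * deg OK x) q ⟩
      E' * deg OK x + 2 * q ∎
      where
      open ≤-Reasoning
      lem : ∀ a q → a + q + q ≡ a + 2 * q
      lem = solve-∀
      sort : ∀ z → adj x z ≡ true → OK z ∧ adj x z ≡ true ⊎ bad z ≡ true
      sort z e rewrite adj-S' e with does (E3 * lt z ≤? q * q)
      ... | true = inj₁ e
      ... | false = inj₂ refl
    total : count OK * (E' * (j * q)) ≤ E' * edges OK + count OK * (2 * q)
    total = ≤-trans (sum-on-≥ OK (E' * (j * q)) degOK) (≤-reflexive (trans (sum-cong λ x → lem ⟦ OK x ⟧ E' (deg OK x) (2 * q)) (trans (sum-+ _ _) (cong₂ _+_ (sym (*-sum E' _)) (sym (sum-* _ (2 * q)))))))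
      where
      lem : ∀ b e d q → b * (e * d + q) ≡ e * (b * d) + b * q
      lem = solve-∀

  -- More than `t` neighbours in every part of the anchor would contain a configuration forbidden by
  -- `coneFree`.
  lowPart : (A : Blow adj OK ℓ T) → ∀ x → ∃ λ p → count (λ r → adj x (Blow.κ A p r)) ≤ t
  lowPart A x with decide∃ (λ p → does (count (λ r → adj x (Blow.κ A p r)) ≤? t))
  ... | inj₁ (p , e) = p , does-true (count (λ r → adj x (Blow.κ A p r)) ≤? t) e
  ... | inj₂ none = ⊥-elim (coneFree x (record { κ = λ p r → κ p (proj₁ (sel p) r) ; inP = λ p r → proj₂ (proj₂ (sel p)) r
      ; inj = λ p r r' e → proj₁ (proj₂ (sel p)) r r' (inj p _ _ e) ; cross = λ p p' r r' → cross p p' _ _ }))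
    where
    open Blow A
    sel : ∀ p → Σ (Fin (suc t) → Fin T) λ f → (∀ r r' → f r ≡ f r' → r ≡ r') × (∀ r → adj x (κ p (f r)) ≡ true)
    sel p = select (suc t) (λ r → adj x (κ p r)) (≰⇒> (does-false (count (λ r → adj x (κ p r)) ≤? t) (none p)))

-- Classifying vertices by their neighbours in the anchor

module Split {n m : ℕ} {χ : Coloring n m} {F : Family χ} {j' t K : ℕ} (H : HeavyGraph F (suc (suc j')) t K) (q e' T C₀ : ℕ)
  (s≥ : q * suc (suc j') ≤ count (Family.S F)) (s≤ : count (Family.S F) ≤ q * suc (suc j') + suc (suc j'))
  (OK : Fin n → Bool) (OK⊑S : OK ⊑ Family.S F) (bad≤ : count (λ v → Family.S F v ∧ not (OK v)) ≤ C₀)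
  (minDeg : ∀ v → OK v ≡ true → suc e' * (suc j' * q) ≤ suc e' * count (HeavyGraph.adj H v) + q)
  (anchor : Blow (HeavyGraph.adj H) OK (suc (suc j')) T)
  (low : Fin n → Fin (suc (suc j'))) (low≤ : ∀ x → count (λ r → HeavyGraph.adj H x (Blow.κ anchor (low x) r)) ≤ t)
  (T≡ : T ≡ suc t + 2 * (t * suc e')) (1≤t : 1 ≤ t)
  (q≥₄ : suc e' * C₀ ≤ q) (q≥₆ : suc j' * T + t ≤ q) (q≥₇ : suc e' * suc (suc j') ≤ q) where

  open Light H
  open Blow anchor

  private
    ℓ j E' T' : ℕ
    ℓ = suc (suc j')
    j = suc j'
    E' = suc e'
    T' = t * E'

  nb : Fin n → Fin ℓ → ℕ
  nb x p = count (λ r → adj x (κ p r))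

  nb≤T : ∀ x p → nb x p ≤ T
  nb≤T x p = count≤n _

  -- The tolerance `T' = t * E'` balances two needs. As `T = t + 1 + 2T'`, two full vertices with
  -- the same low part have `t + 1` common neighbours in each other part; and `T'` is `E'` times the
  -- surplus `t` that a low part may contribute, so few vertices fail to be full.
  fullAt : Fin n → Fin ℓ → Bool
  fullAt x p = (low x == p) ∨ does (T ≤? nb x p + T')

  full : Fin n → Bool
  full x = all (fullAt x)

  full⇒ : ∀ {x p} → full x ≡ true → p ≢ low x → T ≤ nb x p + T'
  full⇒ {x} {p} e ne with ∨-elim {low x == p} (all-true (fullAt x) e p)
  ... | inj₁ h = ⊥-elim (ne (sym (==⇒≡ h)))
  ... | inj₂ h = does-true (T ≤? nb x p + T') h

  others≤ : ∀ x q → others (nb x) (low x) q ≤ ⟦ not (low x == q) ⟧ * T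
  others≤ x q = *-monoʳ-≤ ⟦ not (low x == q) ⟧ (nb≤T x q)

  jT : ∀ x → sum (λ q → ⟦ not (low x == q) ⟧ * T) ≡ j * T
  jT x = trans (sym (sum-* _ T)) (cong (_* T) (Turán.nonlast j' (low x)))

  nbSum : Fin n → ℕ
  nbSum x = sum (nb x)

  nbSum≤ : ∀ x → nbSum x ≤ j * T + t
  nbSum≤ x = ≤-trans (≤-reflexive (sym (others-sum (nb x) (low x)))) (+-mono-≤ (≤-trans (sum-mono (others≤ x)) (≤-reflexive (jT x))) (low≤ x))

  nbSum-nf : ∀ x → full x ≡ false → nbSum x + T' ≤ j * T + t
  nbSum-nf x e with all-false (fullAt x) e
  ... | p , ep = ≤-trans (≤-reflexive (trans (cong (_+ T') (sym (others-sum (nb x) (low x)))) (lem (sum (others (nb x) (low x))) (nb x (low x)) T')))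
      (+-mono-≤ (≤-trans (≤-reflexive (trans (cong (sum (others (nb x) (low x)) +_) (sym (sum-δ p (λ _ → T')))) (sym (sum-+ _ _)))) (≤-trans (sum-mono pt) (≤-reflexive (jT x)))) (low≤ x))
    where
    lem : ∀ a b c → a + b + c ≡ a + c + b
    lem = solve-∀
    p≢ : (low x == p) ≡ false
    p≢ with low x == p
    ... | false = refl
    small : nb x p + T' ≤ T
    small = <⇒≤ (≰⇒> (does-false (T ≤? nb x p + T') (subst (λ b → b ∨ does (T ≤? nb x p + T') ≡ false) p≢ ep)))
    pt : ∀ q → others (nb x) (low x) q + ⟦ q == p ⟧ * T' ≤ ⟦ not (low x == q) ⟧ * T
    pt q with q Finₚ.≟ p
    ... | no _ = ≤-trans (≤-reflexive (+-identityʳ _)) (others≤ x q)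
    ... | yes refl rewrite p≢ = ≤-trans (≤-reflexive (cong₂ _+_ (+-identityʳ (nb x q)) (+-identityʳ T'))) (≤-trans small (≤-reflexive (sym (+-identityʳ T))))

  nf : Fin n → Bool
  nf x = S x ∧ not (full x)

  -- Double counting between `S` and the anchor. Anchor vertices have degree nearly `jq`, so the
  -- average of `nbSum` is close to its maximum `jT + t`, whereas each vertex that is not full falls
  -- short of it by `T'`.
  nf≤ : E' * count nf ≤ 6 * ℓ * q
  nf≤ = notFull-bound j' e' t q s (sum nbSum) (count nf) 1≤t (subst (λ T → ℓ * T * (E' * (j * q)) ≤ E' * sum nbSum + ℓ * T * q) T≡ lower)
      (subst (λ T → sum nbSum + count nf * T' ≤ s * (j * T + t)) T≡ upper) s≤ (subst (λ T → j * T + t ≤ q) T≡ q≥₆)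
    where
    const₂ : ∀ c → sum (λ (p : Fin ℓ) → sum λ (r : Fin T) → c) ≡ ℓ * T * c
    const₂ c = trans (sum-cong λ q → sum-const T c) (trans (sum-const ℓ _) (sym (*-assoc ℓ T c)))
    flip : sum nbSum ≡ sum (λ p → sum λ r → count (adj (κ p r)))
    flip = trans (sum-swap _) (sum-cong λ p → trans (sum-swap _) (sum-cong λ r → sum-cong λ x → cong ⟦_⟧ (adj-sym x (κ p r))))
    lower : ℓ * T * (E' * (j * q)) ≤ E' * sum nbSum + ℓ * T * q
    lower = begin
      ℓ * T * (E' * (j * q)) ≡⟨ sym (const₂ (E' * (j * q))) ⟩
      sum (λ (p : Fin ℓ) → sum λ (r : Fin T) → E' * (j * q)) ≤⟨ sum-mono (λ p → sum-mono λ r → minDeg (κ p r) (inP p r)) ⟩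
      sum (λ p → sum λ r → E' * count (adj (κ p r)) + q) ≡⟨ trans (sum-cong λ p → sum-+ _ _) (sum-+ _ _) ⟩
      sum (λ p → sum λ r → E' * count (adj (κ p r))) + sum (λ (p : Fin ℓ) → sum λ (r : Fin T) → q)
        ≡⟨ cong₂ _+_ (trans (sum-cong λ p → sym (*-sum E' _)) (trans (sym (*-sum E' _)) (cong (E' *_) (sym flip)))) (const₂ q) ⟩
      E' * sum nbSum + ℓ * T * q ∎
      where open ≤-Reasoning
    upper : sum nbSum + count nf * T' ≤ s * (j * T + t)
    upper = ≤-trans (≤-reflexive (trans (cong (sum nbSum +_) (sum-* _ T')) (sym (sum-+ _ _)))) (≤-trans (sum-mono pt) (≤-reflexive (sym (sum-* _ (j * T + t)))))
      where
      zero-out : ∀ x → S x ≡ false → nbSum x ≤ 0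
      zero-out x e = ≤-trans (sum-mono λ p → ≤-trans (sum-mono λ r → ⟦⟧-≤ {adj x (κ p r)} {0} λ a → ⊥-elim (true≢false (adj-S a) e)) (≤-reflexive (sum-zero T))) (≤-reflexive (sum-zero ℓ))
      pt : ∀ x → nbSum x + ⟦ nf x ⟧ * T' ≤ ⟦ S x ⟧ * (j * T + t)
      pt x with S x in eS | full x in ef
      ... | true | true = ≤-trans (≤-reflexive (+-identityʳ _)) (≤-trans (nbSum≤ x) (≤-reflexive (sym (+-identityʳ _))))
      ... | true | false = ≤-trans (≤-reflexive (cong (nbSum x +_) (+-identityʳ T'))) (≤-trans (nbSum-nf x ef) (≤-reflexive (sym (+-identityʳ _))))
      ... | false | _ = ≤-trans (≤-reflexive (+-identityʳ _)) (zero-out x eS)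

  B : Fin ℓ → Fin n → Bool
  B p x = OK x ∧ (full x ∧ (low x == p))

  module _ {p x} (e : B p x ≡ true) where
    B-OK : OK x ≡ true
    B-OK = ∧-proj₁ {OK x} e
    B-S : S x ≡ true
    B-S = OK⊑S x B-OK
    B-full : full x ≡ true
    B-full = ∧-proj₁ {full x} (∧-proj₂ {OK x} e)
    B-low : low x ≡ p
    B-low = ==⇒≡ (∧-proj₂ {full x} (∧-proj₂ {OK x} e))

  -- Common neighbours of `x` and `y` in the other anchor parts, together with vertices of part `i`
  -- different from `x` and `y`, form the blow-up to which `plusFree` applies.
  independent : ∀ {i x y} → B i x ≡ true → B i y ≡ true → adj x y ≡ false
  independent {i} {x} {y} ex ey = plusFree κ' inj' (λ p p' r r' → cross p p' _ _) i x y
      (λ p r ne → ∧-proj₁ {adj x (κ' p r)} (sel-ok p r ne)) (λ p r ne → ∧-proj₂ {adj x (κ' p r)} (sel-ok p r ne))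
      (λ r e → true≢false (subst (λ z → (κ' i r == z) ≡ true) (sym e) (==-refl (κ' i r))) (not-elim (∧-proj₁ {not (κ' i r == x)} (sel-i r))))
      (λ r e → true≢false (subst (λ z → (κ' i r == z) ≡ true) (sym e) (==-refl (κ' i r))) (not-elim (∧-proj₂ {not (κ' i r == x)} (sel-i r))))
    where
    Q : Fin ℓ → Fin T → Bool
    Q p r = if p == i then not (κ p r == x) ∧ not (κ p r == y) else adj x (κ p r) ∧ adj y (κ p r)
    big : ∀ p → t ≤ count (Q p)
    big p with p Finₚ.≟ i
    ... | yes refl = ≤-pred (≤-pred (≤-trans t+2≤T (≤-trans (≤-reflexive (sym (count-all T))) (≤-trans (count-avoid (λ _ → true) (λ r → κ p r == x) (λ r r' _ a _ b → inj p r r' (trans (==⇒≡ a) (sym (==⇒≡ b)))))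
            (s≤s (count-avoid (λ r → not (κ p r == x)) (λ r → κ p r == y) (λ r r' _ a _ b → inj p r r' (trans (==⇒≡ a) (sym (==⇒≡ b))))))))))
      where
      t+2≤T : suc (suc t) ≤ T
      t+2≤T = ≤-trans (s≤s (≤-trans (≤-reflexive (+-comm 1 t)) (+-monoʳ-≤ t (≤-trans 1≤t (≤-trans (m≤m*n t E') (m≤n*m (t * E') 2)))))) (≤-reflexive (sym T≡))
    ... | no ne = ≤-trans (n≤1+n t) (+-cancelʳ-≤ (2 * T') (suc t) _ (≤-trans (≤-reflexive (sym T≡)) (+-cancelˡ-≤ T _ _ (begin
        T + T ≤⟨ +-mono-≤ (full⇒ (B-full ex) (λ e → ne (trans e (B-low ex)))) (full⇒ (B-full ey) (λ e → ne (trans e (B-low ey)))) ⟩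
        nb x p + T' + (nb y p + T') ≡⟨ lem (nb x p) T' (nb y p) ⟩
        nb x p + nb y p + 2 * T' ≤⟨ +-monoˡ-≤ (2 * T') (count-both (λ r → adj x (κ p r)) (λ r → adj y (κ p r))) ⟩
        T + count (λ r → adj x (κ p r) ∧ adj y (κ p r)) + 2 * T' ≡⟨ +-assoc T _ _ ⟩
        T + (count (λ r → adj x (κ p r) ∧ adj y (κ p r)) + 2 * T') ∎))))
      where
      open ≤-Reasoning
      lem : ∀ a b c → a + b + (c + b) ≡ a + c + 2 * b
      lem = solve-∀
    sel : ∀ p → Σ (Fin t → Fin T) λ f → (∀ r r' → f r ≡ f r' → r ≡ r') × (∀ r → Q p (f r) ≡ true)
    sel p = select t (Q p) (big p)
    κ' : Fin ℓ → Fin t → Fin n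
    κ' p r = κ p (proj₁ (sel p) r)
    inj' : ∀ p r r' → κ' p r ≡ κ' p r' → r ≡ r'
    inj' p r r' e = proj₁ (proj₂ (sel p)) r r' (inj p _ _ e)
    sel-ok : ∀ p r → p ≢ i → adj x (κ' p r) ∧ adj y (κ' p r) ≡ true
    sel-ok p r ne = subst (λ b → (if b then not (κ' p r == x) ∧ not (κ' p r == y) else adj x (κ' p r) ∧ adj y (κ' p r)) ≡ true) (≢⇒== ne) (proj₂ (proj₂ (sel p)) r)
    sel-i : ∀ r → not (κ' i r == x) ∧ not (κ' i r == y) ≡ true
    sel-i r = subst (λ b → (if b then not (κ' i r == x) ∧ not (κ' i r == y) else adj x (κ' i r) ∧ adj y (κ' i r)) ≡ true) (==-refl i) (proj₂ (proj₂ (sel i)) r)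

  degSum : ∀ {b d} → b + d ≤ s → E' * (j * q) ≤ E' * d + q → E' * b ≤ (E' + 2) * q
  degSum {b} {d} h hd = +-cancelʳ-≤ (E' * (j * q)) _ _ (begin
    E' * b + E' * (j * q) ≤⟨ +-monoʳ-≤ (E' * b) hd ⟩
    E' * b + (E' * d + q) ≡⟨ l₁ E' b d q ⟩
    E' * (b + d) + q ≤⟨ +-monoˡ-≤ q (*-monoʳ-≤ E' (≤-trans h s≤)) ⟩
    E' * (q * ℓ + ℓ) + q ≡⟨ l₂ E' q j' ⟩
    E' * ℓ + (E' * q + q + E' * (j * q)) ≤⟨ +-monoˡ-≤ _ q≥₇ ⟩
    q + (E' * q + q + E' * (j * q)) ≡⟨ l₃ E' q (E' * (j * q)) ⟩
    (E' + 2) * q + E' * (j * q) ∎)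
    where
    open ≤-Reasoning
    l₁ : ∀ e b d q → e * b + (e * d + q) ≡ e * (b + d) + q
    l₁ = solve-∀
    l₂ : ∀ e q j' → e * (q * suc (suc j') + suc (suc j')) + q ≡ e * suc (suc j') + (e * q + q + e * (suc j' * q))
    l₂ = solve-∀
    l₃ : ∀ e q x → q + (e * q + q + x) ≡ (e + 2) * q + x
    l₃ = solve-∀

  -- A member of `B i` has nearly `jq` neighbours, and by independence all of them lie outside
  -- `B i`.
  size≤ : ∀ i → E' * count (B i) ≤ (E' + 2) * q
  size≤ i with decide∃ (B i)
  ... | inj₁ (x , e) = degSum (count-disjoint {p = B i} {adj x} (λ y ey → B-S ey) (λ y → adj-S') (λ y ey a → true≢false a (independent e ey))) (minDeg x (B-OK e))
  ... | inj₂ none = ≤-trans (*-monoʳ-≤ E' (≤-trans (sum-mono λ x → ⟦⟧-≤ {B i x} {0} λ e → ⊥-elim (true≢false e (none x))) (≤-reflexive (sum-zero n)))) (≤-trans (≤-reflexive (*-zeroʳ E')) z≤n)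

  U : Fin n → Bool
  U x = S x ∧ not (any λ p → B p x)

  U≤ : E' * count U ≤ 7 * ℓ * q
  U≤ = begin
    E' * count U ≤⟨ *-monoʳ-≤ E' (≤-trans (count-or {p = U} {λ v → S v ∧ not (OK v)} {nf} sort) (+-monoˡ-≤ (count nf) bad≤)) ⟩
    E' * (C₀ + count nf) ≡⟨ *-distribˡ-+ E' C₀ (count nf) ⟩
    E' * C₀ + E' * count nf ≤⟨ +-mono-≤ (≤-trans q≥₄ (m≤n*m q ℓ)) nf≤ ⟩
    ℓ * q + 6 * ℓ * q ≡⟨ lem ℓ q ⟩
    7 * ℓ * q ∎
    where
    open ≤-Reasoning
    lem : ∀ l q → l * q + 6 * l * q ≡ 7 * l * q
    lem = solve-∀
    sort : ∀ x → U x ≡ true → S x ∧ not (OK x) ≡ true ⊎ nf x ≡ true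
    sort x e = go (OK x) (full x) refl refl
      where
      Sx : S x ≡ true
      Sx = ∧-proj₁ {S x} e
      go : ∀ a b → OK x ≡ a → full x ≡ b → S x ∧ not (OK x) ≡ true ⊎ nf x ≡ true
      go false _ ea _ = inj₁ (∧-intro Sx (not-intro ea))
      go true false _ eb = inj₂ (∧-intro Sx (not-intro eb))
      go true true ea eb = ⊥-elim (true≢false (any-intro (λ p → B p x) (low x) (∧-intro ea (∧-intro eb (==-refl (low x))))) (not-elim (∧-proj₂ {S x} e)))

  -- What the other parts and `U` leave of the `ℓq` vertices. The error `9ℓ` is made up of `2j` from
  -- `size≤` and `7ℓ` from `U≤`, rounded up by 2.
  size≥ : ∀ i → E' * q ≤ E' * count (B i) + 9 * ℓ * q
  size≥ i = +-cancelʳ-≤ (j * (E' * q)) _ _ (begin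
    E' * q + j * (E' * q) ≡⟨ l₁ E' q j' ⟩
    E' * (q * ℓ) ≤⟨ *-monoʳ-≤ E' (≤-trans s≥ cover) ⟩
    E' * (sum sz + count U) ≡⟨ trans (*-distribˡ-+ E' (sum sz) (count U)) (cong (λ z → E' * z + E' * count U) (sym (others-sum sz i))) ⟩
    E' * (sum (others sz i) + sz i) + E' * count U ≡⟨ cong (_+ E' * count U) (*-distribˡ-+ E' (sum (others sz i)) (sz i)) ⟩
    E' * sum (others sz i) + E' * sz i + E' * count U ≤⟨ +-mono-≤ (+-monoˡ-≤ (E' * sz i) rest≤) U≤ ⟩
    j * ((E' + 2) * q) + E' * sz i + 7 * ℓ * q ≤⟨ m≤m+n _ (2 * q) ⟩
    j * ((E' + 2) * q) + E' * sz i + 7 * ℓ * q + 2 * q ≡⟨ l₂ E' q j' (E' * sz i) ⟩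
    E' * sz i + 9 * ℓ * q + j * (E' * q) ∎)
    where
    open ≤-Reasoning
    sz : Fin ℓ → ℕ
    sz p = count (B p)
    l₁ : ∀ e q j' → e * q + suc j' * (e * q) ≡ e * (q * suc (suc j'))
    l₁ = solve-∀
    l₂ : ∀ e q j' x → suc j' * ((e + 2) * q) + x + 7 * suc (suc j') * q + 2 * q ≡ x + 9 * suc (suc j') * q + suc j' * (e * q)
    l₂ = solve-∀
    rest≤ : E' * sum (others sz i) ≤ j * ((E' + 2) * q)
    rest≤ = ≤-trans (≤-reflexive (*-sum E' (others sz i))) (≤-trans (sum-mono λ p → ≤-trans (≤-reflexive (*-reassoc E' ⟦ not (i == p) ⟧ (sz p))) (*-monoʳ-≤ ⟦ not (i == p) ⟧ (size≤ p)))
      (≤-reflexive (trans (sym (sum-* _ ((E' + 2) * q))) (cong (_* ((E' + 2) * q)) (Turán.nonlast j' i)))))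
    cover : s ≤ sum sz + count U
    cover = ≤-trans (sum-mono pt) (≤-reflexive (trans (sum-+ _ _) (cong (_+ count U) (sum-swap _))))
      where
      pt : ∀ x → ⟦ S x ⟧ ≤ sum (λ p → ⟦ B p x ⟧) + ⟦ U x ⟧
      pt x with any (λ p → B p x) in ea
      ... | true = ⟦⟧-≤ λ _ → ≤-trans (case any-true _ ea of λ { (p , e) → count-pos {p = λ p → B p x} p e }) (m≤m+n _ _)
      ... | false = ≤-trans (≤-reflexive (cong ⟦_⟧ (sym (∧-identityʳ (S x))))) (m≤n+m _ _)

  -- The part of `x`, its neighbours and its non-neighbours in `B p` are disjoint, and the first two
  -- already fill almost all of `S`.
  nonnbr : ∀ {i p x} → i ≢ p → B i x ≡ true → E' * count (λ y → B p y ∧ not (adj x y)) ≤ 11 * ℓ * q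
  nonnbr {i} {p} {x} i≢p ex = +-cancelʳ-≤ (E' * q + E' * (j * q)) _ _ (begin
    E' * N + (E' * q + E' * (j * q)) ≤⟨ +-monoʳ-≤ (E' * N) (+-mono-≤ (size≥ i) (minDeg x (B-OK ex))) ⟩
    E' * N + (E' * count (B i) + 9 * ℓ * q + (E' * count (adj x) + q)) ≡⟨ l₁ E' N (count (B i)) (9 * ℓ * q) (count (adj x)) q ⟩
    E' * (count (B i) + (N + count (adj x))) + (9 * ℓ * q + q) ≤⟨ +-monoˡ-≤ _ (*-monoʳ-≤ E' (≤-trans (≤-trans (+-monoʳ-≤ (count (B i)) NA) BA) s≤)) ⟩
    E' * (q * ℓ + ℓ) + (9 * ℓ * q + q) ≡⟨ l₂ E' q j' ⟩
    E' * ℓ + (9 * ℓ * q + q + (E' * q + E' * (j * q))) ≤⟨ +-monoˡ-≤ _ q≥₇ ⟩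
    q + (9 * ℓ * q + q + (E' * q + E' * (j * q))) ≤⟨ m≤m+n _ (2 * j * q) ⟩
    q + (9 * ℓ * q + q + (E' * q + E' * (j * q))) + 2 * j * q ≡⟨ l₃ q j' (E' * q + E' * (j * q)) ⟩
    11 * ℓ * q + (E' * q + E' * (j * q)) ∎)
    where
    open ≤-Reasoning
    N : ℕ
    N = count (λ y → B p y ∧ not (adj x y))
    out : Fin n → Bool
    out y = S y ∧ not (B i y)
    NA : N + count (adj x) ≤ count out
    NA = count-disjoint {p = λ y → B p y ∧ not (adj x y)} {adj x}
      (λ y e → ∧-intro (B-S (∧-proj₁ {B p y} e)) (flip y (∧-proj₁ {B p y} e)))
      (λ y a → ∧-intro (adj-S' a) (flip' y a)) (λ y e a → true≢false a (not-elim (∧-proj₂ {B p y} e)))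
      where
      flip : ∀ y → B p y ≡ true → not (B i y) ≡ true
      flip y e with B i y in eb
      ... | false = refl
      ... | true = ⊥-elim (i≢p (trans (sym (B-low eb)) (B-low e)))
      flip' : ∀ y → adj x y ≡ true → not (B i y) ≡ true
      flip' y a with B i y in eb
      ... | false = refl
      ... | true = ⊥-elim (true≢false a (independent ex eb))
    BA : count (B i) + count out ≤ s
    BA = count-disjoint {p = B i} {out} (λ y → B-S) (λ y e → ∧-proj₁ {S y} e) (λ y e o → true≢false e (not-elim (∧-proj₂ {S y} o)))
    l₁ : ∀ e N b x a q → e * N + (e * b + x + (e * a + q)) ≡ e * (b + (N + a)) + (x + q)
    l₁ = solve-∀
    l₂ : ∀ e q j' → e * (q * suc (suc j') + suc (suc j')) + (9 * suc (suc j') * q + q) ≡ e * suc (suc j') + (9 * suc (suc j') * q + q + (e * q + e * (suc j' * q)))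
    l₂ = solve-∀
    l₃ : ∀ q j' x → q + (9 * suc (suc j') * q + q + x) + 2 * suc j' * q ≡ 11 * suc (suc j') * q + x
    l₃ = solve-∀

  -- The largest error above is `11ℓq / E'`, so `E' = 11ℓE₁` brings all of them down to `q / E₁`.
  parts : ∀ E₁ → E' ≡ 11 * ℓ * E₁ → Parts S adj ℓ q E₁
  parts E₁ E'≡ = record
    { B = B ; B⊑S = λ p x → B-S ; disjoint = λ a b → trans (sym (B-low a)) (B-low b)
    ; rest = scale (≤-trans U≤ (*-monoˡ-≤ q (*-monoˡ-≤ ℓ (m≤m+n 7 4))))
    ; B≤ = λ p → *-cancelˡ-≤ (11 * ℓ) (begin
        11 * ℓ * (E₁ * count (B p)) ≡⟨ trans (sym (*-assoc (11 * ℓ) E₁ _)) (cong (_* count (B p)) (sym E'≡)) ⟩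
        E' * count (B p) ≤⟨ size≤ p ⟩
        (E' + 2) * q ≤⟨ *-monoˡ-≤ q (+-monoʳ-≤ E' (s≤s (s≤s z≤n))) ⟩
        (E' + 11 * ℓ) * q ≡⟨ cong (λ z → (z + 11 * ℓ) * q) E'≡ ⟩
        (11 * ℓ * E₁ + 11 * ℓ) * q ≡⟨ lem (11 * ℓ) E₁ q ⟩
        11 * ℓ * (suc E₁ * q) ∎)
    ; B≥ = λ p → *-cancelˡ-≤ (11 * ℓ) (begin
        11 * ℓ * (E₁ * q) ≡⟨ trans (sym (*-assoc (11 * ℓ) E₁ _)) (cong (_* q) (sym E'≡)) ⟩
        E' * q ≤⟨ size≥ p ⟩
        E' * count (B p) + 9 * ℓ * q ≤⟨ +-monoʳ-≤ (E' * count (B p)) (*-monoˡ-≤ q (*-monoˡ-≤ ℓ (m≤m+n 9 2))) ⟩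
        E' * count (B p) + 11 * ℓ * q ≡⟨ cong (λ z → z * count (B p) + 11 * ℓ * q) E'≡ ⟩
        11 * ℓ * E₁ * count (B p) + 11 * ℓ * q ≡⟨ lem' (11 * ℓ) E₁ (count (B p)) q ⟩
        11 * ℓ * (E₁ * count (B p) + q) ∎)
    ; sparse = λ ne e → scale (nonnbr ne e) }
    where
    open ≤-Reasoning
    lem : ∀ a e q → (a * e + a) * q ≡ a * (suc e * q)
    lem = solve-∀
    lem' : ∀ a e b q → a * e * b + a * q ≡ a * (e * b + q)
    lem' = solve-∀
    scale : ∀ {x} → E' * x ≤ 11 * ℓ * q → E₁ * x ≤ q
    scale {x} h = *-cancelˡ-≤ (11 * ℓ) (≤-trans (≤-reflexive (trans (sym (*-assoc (11 * ℓ) E₁ x)) (cong (_* x) (sym E'≡)))) h)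

-- Pairs of parts whose inner triples are forced to share a colour.
Compat : Variant → ∀ {ℓ} → Fin ℓ → Fin ℓ → Set
Compat γ i i' = ⊤
Compat _ i i' = i ≡ i'

-- Expresses that `x` and `y` could join part `i` of the core. Of `w` only freshness is asked, so
-- the triple may lie outside the family.
record Fit {n ℓ T : ℕ} (adj : Fin n → Fin n → Bool) (κ : Fin ℓ → Fin T → Fin n) (i : Fin ℓ) (x y w : Fin n) : Set where
  field
    x≢y : x ≢ y
    x≢w : x ≢ w
    y≢w : y ≢ w
    x-adj : ∀ p r → p ≢ i → adj x (κ p r) ≡ true
    y-adj : ∀ p r → p ≢ i → adj y (κ p r) ≡ true
    x≢κ : ∀ r → x ≢ κ i r
    y≢κ : ∀ r → y ≢ κ i r
    κ≢w : ∀ p r → κ p r ≢ w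

SameColour : ∀ {n m} → Coloring n m → (adj : Fin n → Fin n → Bool) → Variant → (ℓ T : ℕ) → Set
SameColour {n} χ adj v ℓ T = (κ : Fin ℓ → Fin T → Fin n) → (∀ p r r' → κ p r ≡ κ p r' → r ≡ r') →
  (∀ p p' r r' → p ≢ p' → adj (κ p r) (κ p' r') ≡ true) →
  ∀ {i i' x y w x' y' w'} → Compat v i i' → Fit adj κ i x y w → Fit adj κ i' x' y' w' → χ (tri x y w) ≡ χ (tri x' y' w')

-- Comparing the colours of two inner triples

module Compare {n m : ℕ} {χ : Coloring n m} (F : Family χ) (v : Variant) (l t' K : ℕ)
  (K≥ : (3 + l) * (4 + t') + 4 ≤ K) (emb : EmbProp F v (suc l) t' K) where
  open Heavy F v (suc l) t' K K≥ emb

  heavyGraph : HeavyGraph F ℓ t K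
  heavyGraph = record { adj = adj ; adj-sym = adj-sym ; adj-irr = adj-irr ; adj-S = adj-S ; ¬adj⇒ = ¬adj⇒ ; coneFree = coneFree ; plusFree = plusFree }

  -- The other extra edge when `e₁` is placed on `xy`: for `α` it continues the path at `y`, for `β`
  -- and `γ` it involves core vertices only.
  target : Variant → (Fin ℓ → Fin t → Fin n) → (i k : Fin ℓ) → Fin n → Fin n → Subset n
  target plain κ i k y w = tri y (κ i 2F) w
  target α κ i k y w = tri y (κ i 2F) w
  target β κ i k y w = tri (κ i 2F) (κ i 3F) w
  target γ κ i k y w = tri (κ k zero) (κ k 1F) w

  module _ (κ : Fin ℓ → Fin t → Fin n) (inj : ∀ p r r' → κ p r ≡ κ p r' → r ≡ r')
    (cross : ∀ p p' r r' → p ≢ p' → adj (κ p r) (κ p' r') ≡ true)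
    (i k : Fin ℓ) (i≢k : i ≢ k) (x y w₁ w₂ : Fin n) (x≢y : x ≢ y)
    (x-adj : ∀ p r → p ≢ i → adj x (κ p r) ≡ true) (y-adj : ∀ p r → p ≢ i → adj y (κ p r) ≡ true)
    (x≢κ : ∀ r → x ≢ κ i (suc (suc r))) (y≢κ : ∀ r → y ≢ κ i (suc (suc r)))
    (w₁≢w₂ : w₁ ≢ w₂) (x≢w₁ : x ≢ w₁) (y≢w₁ : y ≢ w₁) (x≢w₂ : x ≢ w₂) (y≢w₂ : y ≢ w₂)
    (κ≢w₁ : ∀ p r → κ p r ≢ w₁) (κ≢w₂ : ∀ p r → κ p r ≢ w₂) where

    private
      σ : Fin ℓ → Fin ℓ
      σ = proj₁ (move i k i≢k)
      σ-inj : ∀ {a b} → σ a ≡ σ b → a ≡ b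
      σ-inj = proj₁ (proj₂ (move i k i≢k))
      σ0 : σ zero ≡ i
      σ0 = proj₁ (proj₂ (proj₂ (move i k i≢k)))
      σ1 : σ 1F ≡ k
      σ1 = proj₂ (proj₂ (proj₂ (move i k i≢k)))
      κσ : Fin ℓ → Fin t → Fin n
      κσ p r = κ (σ p) r
      away : ∀ p → σ (suc p) ≢ i
      away p e = case σ-inj {suc p} {zero} (trans e (sym σ0)) of λ ()

      step : χ (tri x y w₁) ≡ χ (tri (over x y κσ (proj₁ (e₂ v))) (over x y κσ (proj₂ (e₂ v))) w₂)
      step = embOver x y κσ x≢y (λ p → inj (σ p)) (λ p p' r r' ne → cross (σ p) (σ p') r r' (λ e → ne (σ-inj {p} {p'} e)))
        (λ p r → x-adj _ r (away p)) (λ p r → y-adj _ r (away p))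
        (λ r e → x≢κ r (trans e (cong (λ p → κ p (suc (suc r))) σ0))) (λ r e → y≢κ r (trans e (cong (λ p → κ p (suc (suc r))) σ0)))
        w₁ w₂ w₁≢w₂ (over-≢ {x} {y} {κσ} x≢w₁ y≢w₁ (λ p r → κ≢w₁ (σ p) r)) (over-≢ {x} {y} {κσ} x≢w₂ y≢w₂ (λ p r → κ≢w₂ (σ p) r))

      arrive : ∀ v → tri (over x y κσ (proj₁ (e₂ v))) (over x y κσ (proj₂ (e₂ v))) w₂ ≡ target v κ i k y w₂
      arrive plain = cong (λ p → tri y (κ p 2F) w₂) σ0
      arrive α = cong (λ p → tri y (κ p 2F) w₂) σ0
      arrive β = cong (λ p → tri (κ p 2F) (κ p 3F) w₂) σ0
      arrive γ = cong (λ p → tri (κ p zero) (κ p 1F) w₂) σ1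

    compare : χ (tri x y w₁) ≡ χ (target v κ i k y w₂)
    compare = trans step (cong χ (arrive v))

  -- Exists because ℓ ≥ 3. For `γ` it hosts the edge with which inner triples of both parts are
  -- compared.
  third : (i i' : Fin ℓ) → ∃ λ k → i ≢ k × i' ≢ k
  third zero zero = 1F , (λ ()) , λ ()
  third zero 1F = 2F , (λ ()) , λ ()
  third zero (suc (suc i')) = 1F , (λ ()) , λ ()
  third 1F zero = 2F , (λ ()) , λ ()
  third (suc (suc i)) zero = 1F , (λ ()) , λ ()
  third (suc i) (suc i') = zero , (λ ()) , λ ()

  module _ (κ : Fin ℓ → Fin (2 + t) → Fin n) (inj : ∀ p r r' → κ p r ≡ κ p r' → r ≡ r')
    (cross : ∀ p p' r r' → p ≢ p' → adj (κ p r) (κ p' r') ≡ true) where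
    private
      -- The first two vertices of each part are set aside as expansion vertices. `κ₂` moves vertex
      -- `2F` of `κ₁` to place 0, which `over` overwrites, so that this vertex can be an end of the
      -- next inner edge.
      κ₁ κ₂ : Fin ℓ → Fin t → Fin n
      κ₁ p r = κ p (suc (suc r))
      κ₂ p r = κ₁ p (swap zero 2F r)

      κ₁≢ : ∀ p p' {r r'} → suc (suc r) ≢ r' → κ₁ p r ≢ κ p' r'
      κ₁≢ p p' {r} {r'} ne e with p Finₚ.≟ p'
      ... | yes refl = ne (inj p _ _ e)
      ... | no p≢ = adj-≢ (cross p p' (suc (suc r)) r' p≢) e

      fit-≢ : ∀ {i x y w} → Fit adj κ i x y w → ∀ p r → x ≢ κ p r × y ≢ κ p r
      fit-≢ {i} fit p r with p Finₚ.≟ i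
      ... | yes refl = Fit.x≢κ fit r , Fit.y≢κ fit r
      ... | no ne = adj-≢ (Fit.x-adj fit p r ne) , adj-≢ (Fit.y-adj fit p r ne)

      first : ∀ {i x y w} (k k' : Fin ℓ) → i ≢ k → Fit adj κ i x y w → χ (tri x y w) ≡ χ (target v κ₁ i k y (κ k' zero))
      first {i} {x} {y} {w} k k' i≢k fit = compare κ₁ (λ p r r' e → Finₚ.suc-injective (Finₚ.suc-injective (inj p _ _ e))) (λ p p' r r' → cross p p' _ _)
          i k i≢k x y w (κ k' zero) x≢y (λ p r → x-adj p _) (λ p r → y-adj p _) (λ r → x≢κ _) (λ r → y≢κ _)
          (λ e → κ≢w k' zero (sym e)) x≢w y≢w (proj₁ (fit-≢ fit k' zero)) (proj₂ (fit-≢ fit k' zero)) (λ p r → κ≢w p _) (λ p r → κ₁≢ p k' (λ ()))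
        where open Fit fit

      -- Needed for `α`, where one comparison still leaves `y` in the triple: a further step along
      -- the path `y`, `κ₁ i 2F`, `κ₁ i zero` removes it.
      second : ∀ {i x y w} (k : Fin ℓ) → i ≢ k → Fit adj κ i x y w →
        χ (tri y (κ₁ i 2F) (κ i zero)) ≡ χ (target v κ₂ i k (κ₁ i 2F) (κ i 1F))
      second {i} {x} {y} {w} k i≢k fit = compare κ₂ (λ p r r' e → swap-injective zero 2F (Finₚ.suc-injective (Finₚ.suc-injective (inj p _ _ e)))) (λ p p' r r' → cross p p' _ _)
          i k i≢k y z (κ i zero) (κ i 1F) (y≢κ _) (λ p r → y-adj p _) (λ p r ne → cross i p _ _ (ne ∘ sym)) (λ r → y≢κ _)
          (λ r e → moved r (Finₚ.suc-injective (Finₚ.suc-injective (inj i _ _ e))))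
          (λ e → case inj i _ _ e of λ ()) (y≢κ zero) (κ₁≢ i i (λ ())) (y≢κ _) (κ₁≢ i i (λ ())) (λ p r → κ₁≢ p i (λ ())) (λ p r → κ₁≢ p i (λ ()))
        where
        open Fit fit
        z : Fin n
        z = κ₁ i 2F
        moved : ∀ (r : Fin (suc (suc t'))) → 2F ≢ swap zero 2F (suc (suc r))
        moved r e = case swap-injective zero 2F {zero} {suc (suc r)} (trans (swap-left zero 2F) e) of λ ()

    -- Both triples are led to the same triple of core vertices, by one comparison for `β` and `γ`
    -- and by two for `α`.
    sameColour : ∀ {i i' x y w x' y' w'} → Compat v i i' → Fit adj κ i x y w → Fit adj κ i' x' y' w' → χ (tri x y w) ≡ χ (tri x' y' w')
    sameColour {i} {i'} {x} {y} {w} {x'} {y'} {w'} c fit fit' = go v refl c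
      where
      k = proj₁ (third i i')
      i≢k = proj₁ (proj₂ (third i i'))
      i'≢k = proj₂ (proj₂ (third i i'))
      a : ∀ k' → χ (tri x y w) ≡ χ (target v κ₁ i k y (κ k' zero))
      a k' = first k k' i≢k fit
      a' : ∀ k' → χ (tri x' y' w') ≡ χ (target v κ₁ i' k y' (κ k' zero))
      a' k' = first k k' i'≢k fit'
      go : ∀ u → v ≡ u → Compat u i i' → χ (tri x y w) ≡ χ (tri x' y' w')
      go plain refl refl = trans (a i) (trans (second k i≢k fit) (sym (trans (a' i) (second k i≢k fit'))))
      go α refl refl = trans (a i) (trans (second k i≢k fit) (sym (trans (a' i) (second k i≢k fit'))))
      go β refl refl = trans (a i) (sym (a' i))
      go γ refl _ = trans (a i) (sym (a' i))

-- Complete blow-ups inside nearly complete parts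

union-bound : ∀ {n k} (P : Fin n → Bool) (Q : Fin k → Fin n → Bool) →
  count P ≤ count (λ x → P x ∧ all (λ i → Q i x)) + sum (λ i → count (λ x → P x ∧ not (Q i x)))
union-bound {n} {k} P Q = ≤-trans (sum-mono pt) (≤-reflexive (trans (sum-+ _ _) (cong (count (λ x → P x ∧ all (λ i → Q i x)) +_) (sum-swap _))))
  where
  pt : ∀ x → ⟦ P x ⟧ ≤ ⟦ P x ∧ all (λ i → Q i x) ⟧ + sum (λ i → ⟦ P x ∧ not (Q i x) ⟧)
  pt x = go (all (λ i → Q i x)) refl
    where
    go : ∀ b → all (λ i → Q i x) ≡ b → ⟦ P x ⟧ ≤ ⟦ P x ∧ b ⟧ + sum (λ i → ⟦ P x ∧ not (Q i x) ⟧)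
    go true e = ≤-trans (≤-reflexive (cong ⟦_⟧ (sym (∧-identityʳ (P x))))) (m≤m+n _ _)
    go false e = case all-false (λ i → Q i x) e of λ { (i , ne) →
      ≤-trans (≤-reflexive (cong ⟦_⟧ (trans (sym (∧-identityʳ (P x))) (cong (λ b → P x ∧ not b) (sym ne))))) (≤-trans (term≤sum (λ i → ⟦ P x ∧ not (Q i x) ⟧) i) (m≤n+m _ _)) }

module Pool {n : ℕ} (adj : Fin n → Fin n → Bool) (adj-sym : ∀ x y → adj x y ≡ adj y x) (T q E : ℕ) (1≤E : 1 ≤ E) where

  -- The parts are filled one at a time. Each vertex chosen before excludes at most `q / E` vertices
  -- of the current set, whose size allows for all these exclusions and `T` vertices more.
  pool : ∀ k (C : Fin k → Fin n → Bool) →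
    (∀ {p p' x} → p ≢ p' → C p x ≡ true → E * count (λ y → C p' y ∧ not (adj x y)) ≤ q) →
    (∀ p → T * E + k * T * q ≤ E * count (C p)) →
    Σ (Fin k → Fin T → Fin n) λ κ → (∀ p r → C p (κ p r) ≡ true) × (∀ p r r' → κ p r ≡ κ p r' → r ≡ r') ×
      (∀ p p' r r' → p ≢ p' → adj (κ p r) (κ p' r') ≡ true)
  pool zero C sparse big = (λ ()) , (λ ()) , (λ ()) , (λ ())
  pool (suc k) C sparse big with pool k (C ∘ suc) (λ ne → sparse (ne ∘ Finₚ.suc-injective)) (λ p → ≤-trans (+-monoʳ-≤ (T * E) (*-monoˡ-≤ q (*-monoˡ-≤ T (n≤1+n k)))) (big (suc p)))
  ... | κ , inC , inj , cross = κ' , inC' , inj' , cross'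
    where
    near : Fin (k * T) → Fin n → Bool
    near a x = adj (uncurry κ (remQuot {k} T a)) x
    avail : Fin n → Bool
    avail x = C zero x ∧ all (λ a → near a x)
    T≤ : T ≤ count avail
    T≤ = *-cancelˡ-≤ E ⦃ >-nonZero 1≤E ⦄ (+-cancelʳ-≤ (k * T * q) _ _ (begin
      E * T + k * T * q ≤⟨ m≤m+n _ (T * q) ⟩
      E * T + k * T * q + T * q ≡⟨ lem E T k q ⟩
      T * E + suc k * T * q ≤⟨ big zero ⟩
      E * count (C zero) ≤⟨ *-monoʳ-≤ E (union-bound (C zero) near) ⟩
      E * (count avail + sum (λ a → count (λ x → C zero x ∧ not (near a x)))) ≡⟨ trans (*-distribˡ-+ E _ _) (cong (E * count avail +_) (*-sum E _)) ⟩
      E * count avail + sum (λ a → E * count (λ x → C zero x ∧ not (near a x))) ≤⟨ +-monoʳ-≤ (E * count avail) (sum-mono λ a → sparse {suc (proj₁ (remQuot {k} T a))} {zero} (λ ()) (inC _ _)) ⟩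
      E * count avail + sum (λ (a : Fin (k * T)) → q) ≡⟨ cong (E * count avail +_) (sum-const (k * T) q) ⟩
      E * count avail + k * T * q ∎))
      where
      open ≤-Reasoning
      lem : ∀ e t k q → e * t + k * t * q + t * q ≡ t * e + suc k * t * q
      lem = solve-∀
    new = select T avail T≤
    κ' : Fin (suc k) → Fin T → Fin n
    κ' zero r = proj₁ new r
    κ' (suc p) r = κ p r
    inC' : ∀ p r → C p (κ' p r) ≡ true
    inC' zero r = ∧-proj₁ {C zero (κ' zero r)} (proj₂ (proj₂ new) r)
    inC' (suc p) r = inC p r
    inj' : ∀ p r r' → κ' p r ≡ κ' p r' → r ≡ r'
    inj' zero = proj₁ (proj₂ new)
    inj' (suc p) = inj p
    new-adj : ∀ p r r' → adj (κ p r) (κ' zero r') ≡ true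
    new-adj p r r' = subst (λ a → adj (uncurry κ a) (κ' zero r') ≡ true) (Finₚ.remQuot-combine {k} {T} p r)
      (all-true (λ a → near a (κ' zero r')) (∧-proj₂ {C zero (κ' zero r')} (proj₂ (proj₂ new) r')) (combine p r))
    cross' : ∀ p p' r r' → p ≢ p' → adj (κ' p r) (κ' p' r') ≡ true
    cross' zero zero r r' ne = ⊥-elim (ne refl)
    cross' zero (suc p') r r' ne = trans (adj-sym _ _) (new-adj p' r' r)
    cross' (suc p) zero r r' ne = new-adj p r r'
    cross' (suc p) (suc p') r r' ne = cross p p' r r' (ne ∘ cong suc)

-- `b` is the size of a part and `c` what remains of it after excluding six vertices (`48 = 8 * 6`)
-- and four times `q/8` non-neighbours, about half of the part.
pool-size : ∀ ℓ T q E b c → 2 * (2 * (ℓ * T) + 2) ≤ E → 2 * (2 * T + 12) ≤ q →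
  E * q ≤ E * b + q → 8 * b ≤ 8 * c + (48 + 4 * q) → T * E + ℓ * T * q ≤ E * c
pool-size ℓ T q E b c hE hq hb hc = *-cancelˡ-≤ 8 (+-cancelʳ-≤ (48 * E + 8 * q + 4 * (E * q)) _ _ (begin
  8 * (T * E + ℓ * T * q) + (48 * E + 8 * q + 4 * (E * q)) ≡⟨ l₁ T E (ℓ * T) q ⟩
  2 * (2 * (2 * T + 12) * E + 2 * (2 * (ℓ * T) + 2) * q) + 4 * (E * q) ≤⟨ +-monoˡ-≤ (4 * (E * q)) (*-monoʳ-≤ 2 (+-mono-≤ (*-monoˡ-≤ E hq) (*-monoˡ-≤ q hE))) ⟩
  2 * (q * E + E * q) + 4 * (E * q) ≡⟨ l₂ E q ⟩
  8 * (E * q) ≤⟨ *-monoʳ-≤ 8 hb ⟩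
  8 * (E * b + q) ≡⟨ l₃ E b q ⟩
  E * (8 * b) + 8 * q ≤⟨ +-monoˡ-≤ (8 * q) (*-monoʳ-≤ E hc) ⟩
  E * (8 * c + (48 + 4 * q)) + 8 * q ≡⟨ l₄ E c q ⟩
  8 * (E * c) + (48 * E + 8 * q + 4 * (E * q)) ∎))
  where
  open ≤-Reasoning
  l₁ : ∀ t e x q → 8 * (t * e + x * q) + (48 * e + 8 * q + 4 * (e * q)) ≡ 2 * (2 * (2 * t + 12) * e + 2 * (2 * x + 2) * q) + 4 * (e * q)
  l₁ = solve-∀
  l₂ : ∀ e q → 2 * (q * e + e * q) + 4 * (e * q) ≡ 8 * (e * q)
  l₂ = solve-∀
  l₃ : ∀ e b q → 8 * (e * b + q) ≡ e * (8 * b) + 8 * q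
  l₃ = solve-∀
  l₄ : ∀ e c q → e * (8 * c + (48 + 4 * q)) + 8 * q ≡ 8 * (e * c) + (48 * e + 8 * q + 4 * (e * q))
  l₄ = solve-∀

-- The link of a vertex is too small if the vertex misses q/8 neighbours in a part other than its own.
link-small : ∀ j' c₁ E q s K u n w c d → let j = suc j' ; ℓ = suc j in
  1 ≤ j' → 1 ≤ q → 16 * ℓ * (3 + 2 * c₁) + 24 * (j * j') ≤ E → 1 ≤ E →
  j * j' * (q * q) ≤ 2 * (s * K) + (2 * (u * s) + (2 * (n * s) + (w + c))) → E * c ≤ w * (j' * (suc E * q)) → w ≤ s →
  s ≤ 2 * ℓ * q → E * u ≤ q → E * n ≤ c₁ * q → E * (2 * K + 1) ≤ q → E * w + E * d ≤ j * (suc E * q) → q ≤ 8 * d → ⊥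
link-small j' c₁ E q s K u n w c d 1≤j' 1≤q hE 1≤E hD hc hw hs hu hn hK hwd hd =
  <⇒≱ (≤-refl {suc E}) (≤-trans (≤-trans (≤-reflexive (sym (*-identityʳ (suc E)))) (*-monoʳ-≤ (suc E) 1≤j')) (≤-trans final hE))
  where
  open ≤-Reasoning
  j ℓ X : ℕ
  j = suc j'
  ℓ = suc j
  X = q * q
  h₁ : 8 * (E * E) * (j * j' * X) ≤ 16 * ℓ * E * (3 + 2 * c₁) * X + 8 * (E * w) * (j' * (suc E * q))
  h₁ = begin
    8 * (E * E) * (j * j' * X) ≤⟨ *-monoʳ-≤ (8 * (E * E)) (≤-trans hD (+-monoʳ-≤ (2 * (s * K)) (+-monoʳ-≤ (2 * (u * s)) (+-monoʳ-≤ (2 * (n * s)) (+-monoˡ-≤ c hw))))) ⟩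
    8 * (E * E) * (2 * (s * K) + (2 * (u * s) + (2 * (n * s) + (s + c)))) ≡⟨ l₁ E s K u n c ⟩
    8 * E * (s * (E * (2 * K + 1) + 2 * (E * u) + 2 * (E * n))) + 8 * E * (E * c)
      ≤⟨ +-mono-≤ (*-monoʳ-≤ (8 * E) (*-mono-≤ hs (+-mono-≤ (+-mono-≤ hK (*-monoʳ-≤ 2 hu)) (*-monoʳ-≤ 2 hn)))) (*-monoʳ-≤ (8 * E) hc) ⟩
    8 * E * (2 * ℓ * q * (q + 2 * q + 2 * (c₁ * q))) + 8 * E * (w * (j' * (suc E * q))) ≡⟨ l₂ E ℓ q c₁ w (j' * (suc E * q)) ⟩
    16 * ℓ * E * (3 + 2 * c₁) * X + 8 * (E * w) * (j' * (suc E * q)) ∎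
    where
    l₁ : ∀ E s K u n c → 8 * (E * E) * (2 * (s * K) + (2 * (u * s) + (2 * (n * s) + (s + c)))) ≡ 8 * E * (s * (E * (2 * K + 1) + 2 * (E * u) + 2 * (E * n))) + 8 * E * (E * c)
    l₁ = solve-∀
    l₂ : ∀ E l q c₁ w y → 8 * E * (2 * l * q * (q + 2 * q + 2 * (c₁ * q))) + 8 * E * (w * y) ≡ 16 * l * E * (3 + 2 * c₁) * (q * q) + 8 * (E * w) * y
    l₂ = solve-∀
  h₂ : 8 * (E * w) + E * q ≤ 8 * (j * (suc E * q))
  h₂ = ≤-trans (+-monoʳ-≤ (8 * (E * w)) (≤-trans (*-monoʳ-≤ E hd) (≤-reflexive (*-reassoc E 8 d)))) (≤-trans (≤-reflexive (sym (*-distribˡ-+ 8 (E * w) (E * d)))) (*-monoʳ-≤ 8 hwd))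
  final : suc E * j' ≤ 16 * ℓ * (3 + 2 * c₁) + 24 * (j * j')
  final = *-cancelˡ-≤ (E * X) ⦃ m*n≢0 E X ⦃ >-nonZero 1≤E ⦄ ⦃ m*n≢0 q q ⦃ >-nonZero 1≤q ⦄ ⦃ >-nonZero 1≤q ⦄ ⦄ ⦄ (+-cancelˡ-≤ (8 * (E * E) * (j * j' * X)) _ _ (begin
    8 * (E * E) * (j * j' * X) + E * X * (suc E * j') ≤⟨ +-monoˡ-≤ _ h₁ ⟩
    16 * ℓ * E * (3 + 2 * c₁) * X + 8 * (E * w) * (j' * (suc E * q)) + E * X * (suc E * j') ≡⟨ l₁ (16 * ℓ * E * (3 + 2 * c₁) * X) (8 * (E * w)) E q j' ⟩
    16 * ℓ * E * (3 + 2 * c₁) * X + (8 * (E * w) + E * q) * (j' * (suc E * q)) ≤⟨ +-monoʳ-≤ (16 * ℓ * E * (3 + 2 * c₁) * X) (*-monoˡ-≤ (j' * (suc E * q)) h₂) ⟩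
    16 * ℓ * E * (3 + 2 * c₁) * X + 8 * (j * (suc E * q)) * (j' * (suc E * q)) ≡⟨ l₂ (16 * ℓ * E * (3 + 2 * c₁) * X) j j' E q ⟩
    8 * (E * E) * (j * j' * X) + (16 * ℓ * E * (3 + 2 * c₁) * X + (16 * E + 8 * 1) * (j * j' * X))
      ≤⟨ +-monoʳ-≤ (8 * (E * E) * (j * j' * X)) (+-monoʳ-≤ (16 * ℓ * E * (3 + 2 * c₁) * X) (*-monoˡ-≤ (j * j' * X) (+-monoʳ-≤ (16 * E) (*-monoʳ-≤ 8 1≤E)))) ⟩
    8 * (E * E) * (j * j' * X) + (16 * ℓ * E * (3 + 2 * c₁) * X + (16 * E + 8 * E) * (j * j' * X)) ≡⟨ cong (8 * (E * E) * (j * j' * X) +_) (l₃ ℓ E (3 + 2 * c₁) X (j * j')) ⟩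
    8 * (E * E) * (j * j' * X) + E * X * (16 * ℓ * (3 + 2 * c₁) + 24 * (j * j')) ∎))
    where
    l₁ : ∀ a b E q j' → a + b * (j' * (suc E * q)) + E * (q * q) * (suc E * j') ≡ a + (b + E * q) * (j' * (suc E * q))
    l₁ = solve-∀
    l₂ : ∀ a j j' E q → a + 8 * (j * (suc E * q)) * (j' * (suc E * q)) ≡ 8 * (E * E) * (j * j' * (q * q)) + (a + (16 * E + 8 * 1) * (j * j' * (q * q)))
    l₂ = solve-∀
    l₃ : ∀ l E a X y → 16 * l * E * a * X + (16 * E + 8 * E) * (y * X) ≡ E * X * (16 * l * a + 24 * y)
    l₃ = solve-∀

sum-lookup : ∀ {n} (xs : Vec.Vec ℕ n) → sum (Vec.lookup xs) ≡ Vec.sum xs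
sum-lookup [] = sum-empty _
sum-lookup (x ∷ xs) = trans (sum-suc _) (cong (x +_) (sum-lookup xs))

count≤1 : ∀ {n} {p : Fin n → Bool} → (∀ x y → p x ≡ true → p y ≡ true → x ≡ y) → count p ≤ 1
count≤1 {n} {p} h = ≤-trans (count-avoid p (λ _ → true) (λ x y px _ py _ → h x y px py))
  (s≤s (≤-trans (sum-mono λ x → ≤-reflexive (cong ⟦_⟧ (∧-zeroʳ (p x)))) (≤-reflexive (sum-zero n))))

⟦⟧*⟦⟧-true : ∀ {a b} → a ≡ true → b ≡ true → 1 ≤ ⟦ a ⟧ * ⟦ b ⟧
⟦⟧*⟦⟧-true refl refl = ≤-refl

-- Every vertex belongs to a part

module Last {n m : ℕ} {χ : Coloring n m} {F : Family χ} {j' t K : ℕ} (H : HeavyGraph F (suc (suc j')) t K) (v : Variant)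
  (same : SameColour χ (HeavyGraph.adj H) v (suc (suc j')) (2 + t)) (q E : ℕ)
  (P : Parts (Family.S F) (HeavyGraph.adj H) (suc (suc j')) q E)
  (hE : 2 * (2 * (suc (suc j') * (2 + t)) + 2) ≤ E) (hq : 2 * (2 * (2 + t) + 12) ≤ q) where

  open Light H public
  open Parts P public

  private
    ℓ j : ℕ
    ℓ = suc (suc j')
    j = suc j'

    8≤E : 8 ≤ E
    8≤E = ≤-trans (≤-trans (m≤m+n 8 _) (≤-reflexive (lem (suc t + suc j' * (2 + t))))) hE
      where
      lem : ∀ x → 8 + 4 * x ≡ 2 * (2 * (1 + x) + 2)
      lem = solve-∀

    1≤E : 1 ≤ E
    1≤E = ≤-trans (s≤s z≤n) 8≤E

  -- x behaves like a vertex of part i.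
  Typ : Fin ℓ → Fin n → Set
  Typ i x = ∀ p → p ≢ i → 8 * count (λ y → B p y ∧ not (adj x y)) ≤ q

  B-typ : ∀ {i x} → B i x ≡ true → Typ i x
  B-typ {i} {x} e p p≢i = ≤-trans (*-monoˡ-≤ (count (λ y → B p y ∧ not (adj x y))) 8≤E) (sparse (p≢i ∘ sym) e)

  -- Only `x` and `y` have to be typical. With the bound `q/8` the four typical vertices of two such
  -- triples still have about half of each relevant part in common, and a core for `same` is found
  -- there.
  record Inner (i : Fin ℓ) (x y w : Fin n) : Set where
    constructor inner
    field
      typ-x : Typ i x
      typ-y : Typ i y
      x≢y : x ≢ y
      x≢w : x ≢ w
      y≢w : y ≢ w

  module _ {i i' x y w x' y' w'} (c : Compat v i i') (I : Inner i x y w) (I' : Inner i' x' y' w') where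
    private
      module I = Inner I
      module I' = Inner I'
      a : Fin 6 → Fin n
      a = Vec.lookup (x ∷ y ∷ w ∷ x' ∷ y' ∷ w' ∷ [])
      u : Fin 4 → Fin n
      u = Vec.lookup (x ∷ y ∷ x' ∷ y' ∷ [])
      part : Fin 4 → Fin ℓ
      part = Vec.lookup (i ∷ i ∷ i' ∷ i' ∷ [])
      u-typ : ∀ k → Typ (part k) (u k)
      u-typ zero = I.typ-x
      u-typ 1F = I.typ-y
      u-typ 2F = I'.typ-x
      u-typ 3F = I'.typ-y
      fresh : Fin 6 → Fin n → Bool
      fresh k z = not (z == a k)
      near : Fin ℓ → Fin 4 → Fin n → Bool
      near p k z = (p == part k) ∨ adj (u k) z
      C₁ C : Fin ℓ → Fin n → Bool
      C₁ p z = B p z ∧ all (λ k → fresh k z)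
      C p z = C₁ p z ∧ all (λ k → near p k z)

      C⊑B : ∀ p → C p ⊑ B p
      C⊑B p z e = ∧-proj₁ {B p z} (∧-proj₁ {C₁ p z} e)

      lost₁ : ∀ p k → count (λ z → B p z ∧ not (fresh k z)) ≤ 1
      lost₁ p k = ≤-trans (count-mono {q = _== a k} λ z e → dbl (∧-proj₂ {B p z} e)) (≤-reflexive (count-== (a k)))
        where
        dbl : ∀ {b} → not (not b) ≡ true → b ≡ true
        dbl {true} _ = refl

      lost₂ : ∀ p k → 8 * count (λ z → C₁ p z ∧ not (near p k z)) ≤ q
      lost₂ p k with p Finₚ.≟ part k
      ... | yes e = ≤-trans (*-monoʳ-≤ 8 (≤-trans (sum-mono λ z → ≤-reflexive (cong ⟦_⟧ (∧-zeroʳ (C₁ p z)))) (≤-reflexive (sum-zero n)))) z≤n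
      ... | no ne = ≤-trans (*-monoʳ-≤ 8 (count-mono λ z e → ∧-intro (∧-proj₁ {B p z} (∧-proj₁ {C₁ p z} e)) (∧-proj₂ {C₁ p z} e))) (u-typ k p ne)

      size : ∀ p → 8 * count (B p) ≤ 8 * count (C p) + (48 + 4 * q)
      size p = begin
        8 * count (B p) ≤⟨ *-monoʳ-≤ 8 (≤-trans (union-bound (B p) fresh) (+-mono-≤ (union-bound (C₁ p) (near p)) (≤-trans (sum-mono (lost₁ p)) (≤-reflexive (sum-const 6 1))))) ⟩
        8 * (count (C p) + sum (λ k → count (λ z → C₁ p z ∧ not (near p k z))) + 6) ≡⟨ lem (count (C p)) _ ⟩
        8 * count (C p) + (48 + 8 * sum (λ k → count (λ z → C₁ p z ∧ not (near p k z)))) ≤⟨ +-monoʳ-≤ (8 * count (C p)) (+-monoʳ-≤ 48 (≤-trans (≤-reflexive (*-sum 8 _)) (≤-trans (sum-mono (lost₂ p)) (≤-reflexive (sum-const 4 q))))) ⟩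
        8 * count (C p) + (48 + 4 * q) ∎
        where
        open ≤-Reasoning
        lem : ∀ c s → 8 * (c + s + 6) ≡ 8 * c + (48 + 8 * s)
        lem = solve-∀

      pools = Pool.pool adj adj-sym (2 + t) q E 1≤E ℓ C
        (λ {p} {p'} ne e → ≤-trans (*-monoʳ-≤ E (count-mono λ z e' → ∧-intro (C⊑B p' z (∧-proj₁ {C p' z} e')) (∧-proj₂ {C p' z} e'))) (sparse ne (C⊑B p _ e)))
        (λ p → pool-size ℓ (2 + t) q E (count (B p)) (count (C p)) hE hq (B≥ p) (size p))

      module Colours (κ : Fin ℓ → Fin (2 + t) → Fin n) (inC : ∀ p r → C p (κ p r) ≡ true) (inj : ∀ p r r' → κ p r ≡ κ p r' → r ≡ r')
        (cross : ∀ p p' r r' → p ≢ p' → adj (κ p r) (κ p' r') ≡ true) where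

        avoids : ∀ k p r → κ p r ≢ a k
        avoids k p r e = true≢false (subst (λ z → (κ p r == z) ≡ true) e (==-refl (κ p r)))
          (not-elim (all-true (λ k → fresh k (κ p r)) (∧-proj₂ {B p (κ p r)} (∧-proj₁ {C₁ p (κ p r)} (inC p r))) k))

        joins : ∀ k p r → p ≢ part k → adj (u k) (κ p r) ≡ true
        joins k p r ne with ∨-elim {p == part k} (all-true (λ k → near p k (κ p r)) (∧-proj₂ {C₁ p (κ p r)} (inC p r)) k)
        ... | inj₁ e = ⊥-elim (ne (==⇒≡ e))
        ... | inj₂ e = e

        colours : χ (tri x y w) ≡ χ (tri x' y' w')
        colours = same κ inj cross c
          (record { x≢y = I.x≢y ; x≢w = I.x≢w ; y≢w = I.y≢w ; x-adj = joins zero ; y-adj = joins 1F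
                  ; x≢κ = λ r e → avoids zero i r (sym e) ; y≢κ = λ r e → avoids 1F i r (sym e) ; κ≢w = avoids 2F })
          (record { x≢y = I'.x≢y ; x≢w = I'.x≢w ; y≢w = I'.y≢w ; x-adj = joins 2F ; y-adj = joins 3F
                  ; x≢κ = λ r e → avoids 3F i' r (sym e) ; y≢κ = λ r e → avoids 4F i' r (sym e) ; κ≢w = avoids 5F })

    inner-colour : χ (tri x y w) ≡ χ (tri x' y' w')
    inner-colour = Colours.colours (proj₁ pools) (proj₁ (proj₂ pools)) (proj₁ (proj₂ (proj₂ pools))) (proj₂ (proj₂ (proj₂ pools)))

  compat-refl : ∀ (i : Fin ℓ) → Compat v i i
  compat-refl i = go v
    where
    go : ∀ v → Compat v i i
    go plain = refl
    go α = refl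
    go β = refl
    go γ = Data.Unit.tt

  c₁ : ℕ
  c₁ = ℓ * suc t + 1

  module _ (hq₂ : suc t * E ≤ q) where
    -- Otherwise `x` has so many neighbours in every part that `pool` finds a `K_ℓ[t+1]` among them,
    -- against `coneFree`.
    home : ∀ x → ∃ λ i → E * count (λ y → B i y ∧ adj x y) ≤ c₁ * q
    home x with decide∃ (λ i → does (E * count (λ y → B i y ∧ adj x y) ≤? c₁ * q))
    ... | inj₁ (i , e) = i , does-true (E * count (λ y → B i y ∧ adj x y) ≤? c₁ * q) e
    ... | inj₂ none = ⊥-elim (cone (Pool.pool adj adj-sym (suc t) q E 1≤E ℓ (λ p y → B p y ∧ adj x y)
        (λ {p} {p'} {z} ne e → ≤-trans (*-monoʳ-≤ E (count-mono λ y e' → ∧-intro (∧-proj₁ {B p' y} (∧-proj₁ {B p' y ∧ adj x y} e')) (∧-proj₂ {B p' y ∧ adj x y} e'))) (sparse ne (∧-proj₁ {B p z} e)))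
        (λ p → ≤-trans (+-monoˡ-≤ (ℓ * suc t * q) hq₂) (≤-trans (≤-reflexive (lem (ℓ * suc t) q)) (<⇒≤ (≰⇒> (does-false (E * count (λ y → B p y ∧ adj x y) ≤? c₁ * q) (none p))))))))
      where
      lem : ∀ a q → q + a * q ≡ (a + 1) * q
      lem = solve-∀
      cone : (Σ (Fin ℓ → Fin (suc t) → Fin n) λ κ → (∀ p r → B p (κ p r) ∧ adj x (κ p r) ≡ true) × (∀ p r r' → κ p r ≡ κ p r' → r ≡ r') ×
        (∀ p p' r r' → p ≢ p' → adj (κ p r) (κ p' r') ≡ true)) → ⊥
      cone (κ , inC , inj , cross) = coneFree x (record { κ = κ ; inP = λ p r → ∧-proj₂ {B p (κ p r)} (inC p r) ; inj = inj ; cross = cross })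

  module _ (1≤j' : 1 ≤ j') (1≤q : 1 ≤ q) (hE₂ : 16 * ℓ * (3 + 2 * c₁) + 24 * (j * j') ≤ E) (s≤ : s ≤ 2 * ℓ * q) (hK : E * (2 * K + 1) ≤ q)
    (D≥ : ∀ o → S o ≡ true → j * j' * (q * q) ≤ sum λ x → sum λ y → ⟦ g o x y ⟧) where

    -- The link of `o` is estimated against its lower bound. Light pairs at `o`, uncovered vertices
    -- and neighbours in the home part `i` contribute little, and so do pairs inside one part. The
    -- remaining pairs start in `W` and end in one of the `j'` parts other than `i` and their own;
    -- if `o` misses `q/8` vertices of part `p`, then `W` is too small to make up the link.
    module Settle {o : Fin n} (So : S o ≡ true) (i : Fin ℓ) (few : E * count (λ y → B i y ∧ adj o y) ≤ c₁ * q)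
      (p : Fin ℓ) (p≢i : p ≢ i) (many : q ≤ 8 * count (λ y → B p y ∧ not (adj o y))) where

      U In W Df : Fin n → Bool
      U x = S x ∧ not (any λ r → B r x)
      In x = B i x ∧ adj o x
      W x = adj o x ∧ any (λ r → not (i == r) ∧ B r x)
      Df x = B p x ∧ not (adj o x)

      sameB crossB : Fin n → Fin n → Bool
      sameB x y = any (λ r → B r x ∧ B r y)
      crossB x y = any (λ r → not (i == r) ∧ (B r y ∧ not (B r x)))

      terms : Fin n → Fin n → Vec.Vec ℕ 8
      terms x y = ⟦ g o x y ∧ not (adj o x) ⟧ ∷ ⟦ g o x y ∧ not (adj o y) ⟧ ∷ ⟦ U x ⟧ * ⟦ S y ⟧ ∷ ⟦ S x ⟧ * ⟦ U y ⟧ ∷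
        ⟦ In x ⟧ * ⟦ S y ⟧ ∷ ⟦ S x ⟧ * ⟦ In y ⟧ ∷ ⟦ W x ⟧ * ⟦ g o x y ∧ sameB x y ⟧ ∷ ⟦ W x ⟧ * ⟦ crossB x y ⟧ ∷ []

      cls-W : ∀ {x} r → B r x ≡ true → adj o x ≡ true → In x ≡ false → W x ≡ true
      cls-W {x} r Bx ax notIn = ∧-intro ax (any-intro _ r (∧-intro (not-intro (≢⇒== {x = i} {r} λ { refl → true≢false (∧-intro Bx ax) notIn })) Bx))

      classify : ∀ x y → g o x y ≡ true → 1 ≤ sum (Vec.lookup (terms x y))
      classify x y e = step₁ (adj o x) refl
        where
        put : ∀ k → 1 ≤ Vec.lookup (terms x y) k → 1 ≤ sum (Vec.lookup (terms x y))
        put k h = ≤-trans h (term≤sum (Vec.lookup (terms x y)) k)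
        Sx : S x ≡ true
        Sx = g-S₂ e
        Sy : S y ≡ true
        Sy = g-S₃ e
        Goal : Set
        Goal = 1 ≤ sum (Vec.lookup (terms x y))
        step₅ : adj o x ≡ true → adj o y ≡ true → ∀ r r' → B r x ≡ true → B r' y ≡ true → ∀ a b → In x ≡ a → In y ≡ b → Goal
        step₅ ax ay r r' Bx By true _ ea _ = put 4F (⟦⟧*⟦⟧-true ea Sy)
        step₅ ax ay r r' Bx By false true _ eb = put 5F (⟦⟧*⟦⟧-true Sx eb)
        step₅ ax ay r r' Bx By false false ea eb = go (B r' x) refl
          where
          go : ∀ b → B r' x ≡ b → Goal
          go true e' = put 6F (⟦⟧*⟦⟧-true (cls-W r Bx ax ea) (∧-intro e (any-intro _ r' (∧-intro e' By))))
          go false e' = put 7F (⟦⟧*⟦⟧-true (cls-W r Bx ax ea)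
            (any-intro _ r' (∧-intro (not-intro (≢⇒== {x = i} {r'} λ { refl → true≢false (∧-intro By ay) eb })) (∧-intro By (not-intro e')))))
        step₃ : adj o x ≡ true → adj o y ≡ true → ∀ a b → any (λ r → B r x) ≡ a → any (λ r → B r y) ≡ b → Goal
        step₃ ax ay false _ ea _ = put 2F (⟦⟧*⟦⟧-true (∧-intro Sx (not-intro ea)) Sy)
        step₃ ax ay true false _ eb = put 3F (⟦⟧*⟦⟧-true Sx (∧-intro Sy (not-intro eb)))
        step₃ ax ay true true ea eb = case any-true _ ea of λ { (r , Bx) → case any-true _ eb of λ { (r' , By) → step₅ ax ay r r' Bx By (In x) (In y) refl refl } }
        step₂ : adj o x ≡ true → ∀ b → adj o y ≡ b → Goal
        step₂ ax false ay = put 1F (⟦⟧-true (∧-intro e (not-intro ay)))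
        step₂ ax true ay = step₃ ax ay (any (λ r → B r x)) (any (λ r → B r y)) refl refl
        step₁ : ∀ a → adj o x ≡ a → Goal
        step₁ false ax = put zero (⟦⟧-true (∧-intro e (not-intro ax)))
        step₁ true ax = step₂ ax (adj o y) refl

      prod : ∀ (a b : Fin n → Bool) → sum (λ x → sum λ y → ⟦ a x ⟧ * ⟦ b y ⟧) ≡ count a * count b
      prod a b = trans (sum-cong λ x → sym (*-sum ⟦ a x ⟧ _)) (sym (sum-* _ (count b)))

      cross : ℕ
      cross = sum λ x → ⟦ W x ⟧ * count (crossB x)

      bounds : Vec.Vec ℕ 8
      bounds = s * K ∷ s * K ∷ count U * s ∷ count U * s ∷ count In * s ∷ count In * s ∷ count W ∷ cross ∷ []

      -- For a given `x`, the triples `o x y` with `y` in the part of `x` all have the same colour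
      -- by `inner-colour`, and the family contains only one triple of it.
      same≤ : sum (λ x → sum λ y → ⟦ W x ⟧ * ⟦ g o x y ∧ sameB x y ⟧) ≤ count W
      same≤ = ≤-trans (≤-reflexive (sum-cong λ x → sym (*-sum ⟦ W x ⟧ _))) (≤-trans (sum-on W 1 (λ x _ → count≤1 (uniq x))) (≤-reflexive (*-identityʳ _)))
        where
        uniq : ∀ x y y' → g o x y ∧ sameB x y ≡ true → g o x y' ∧ sameB x y' ≡ true → y ≡ y'
        uniq x y y' e e' with any-true _ (∧-proj₂ {g o x y} e) | any-true _ (∧-proj₂ {g o x y'} e')
        ... | r , b | r' , b' = g-inj₃ gy gy' (trans (cong χ (rot y)) (trans (inner-colour (compat-refl r) (mk y gy (∧-proj₂ {B r x} b))
              (mk y' gy' (subst (λ z → B z y' ≡ true) (disjoint (∧-proj₁ {B r' x} b') (∧-proj₁ {B r x} b)) (∧-proj₂ {B r' x} b')))) (sym (cong χ (rot y')))))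
          where
          gy : g o x y ≡ true
          gy = ∧-proj₁ {g o x y} e
          gy' : g o x y' ≡ true
          gy' = ∧-proj₁ {g o x y'} e'
          rot : ∀ z → tri o x z ≡ tri x z o
          rot z = trans (tri-sym₁ o x z) (tri-sym₂ x o z)
          mk : ∀ z → g o x z ≡ true → B r z ≡ true → Inner r x z o
          mk z gz Bz = inner (B-typ (∧-proj₁ {B r x} b)) (B-typ Bz) (g-≢₂₃ gz) (g-≢ gz ∘ sym) (g-≢₁₃ gz ∘ sym)

      bound : ∀ k → sum (λ x → sum λ y → Vec.lookup (terms x y) k) ≤ Vec.lookup bounds k
      bound zero = lightRow o
      bound 1F = lightCol o
      bound 2F = ≤-reflexive (prod U S)
      bound 3F = ≤-reflexive (trans (prod S U) (*-comm s (count U)))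
      bound 4F = ≤-reflexive (prod In S)
      bound 5F = ≤-reflexive (trans (prod S In) (*-comm s (count In)))
      bound 6F = same≤
      bound 7F = ≤-reflexive (sum-cong λ x → sym (*-sum ⟦ W x ⟧ _))

      linkSize : j * j' * (q * q) ≤ 2 * (s * K) + (2 * (count U * s) + (2 * (count In * s) + (count W + cross)))
      linkSize = begin
        j * j' * (q * q) ≤⟨ D≥ o So ⟩
        sum (λ x → sum λ y → ⟦ g o x y ⟧) ≤⟨ sum-mono (λ x → sum-mono λ y → ⟦⟧-≤ (classify x y)) ⟩
        sum (λ x → sum λ y → sum λ k → Vec.lookup (terms x y) k) ≡⟨ trans (sum-cong λ x → sum-swap _) (sum-swap _) ⟩
        sum (λ k → sum λ x → sum λ y → Vec.lookup (terms x y) k) ≤⟨ sum-mono bound ⟩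
        sum (Vec.lookup bounds) ≡⟨ sum-lookup bounds ⟩
        Vec.sum bounds ≡⟨ lem (s * K) (count U * s) (count In * s) (count W) cross ⟩
        2 * (s * K) + (2 * (count U * s) + (2 * (count In * s) + (count W + cross))) ∎
        where
        open ≤-Reasoning
        lem : ∀ a b c d e → a + (a + (b + (b + (c + (c + (d + (e + 0))))))) ≡ 2 * a + (2 * b + (2 * c + (d + e)))
        lem = solve-∀

      cross≤ : E * cross ≤ count W * (j' * (suc E * q))
      cross≤ = ≤-trans (≤-reflexive (trans (*-sum E _) (sum-cong λ x → *-reassoc E ⟦ W x ⟧ (count (crossB x))))) (sum-on W (j' * (suc E * q)) row)
        where
        row : ∀ x → W x ≡ true → E * count (crossB x) ≤ j' * (suc E * q)
        row x e with any-true _ (∧-proj₂ {adj o x} e)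
        ... | r₀ , b = begin
          E * count (crossB x) ≤⟨ *-monoʳ-≤ E (≤-trans (sum-mono pt) (≤-reflexive (trans (sum-swap _) (sum-cong λ r → sym (*-sum (wt r) _))))) ⟩
          E * sum (λ r → wt r * count (B r)) ≡⟨ trans (*-sum E _) (sum-cong λ r → *-reassoc E (wt r) _) ⟩
          sum (λ r → wt r * (E * count (B r))) ≤⟨ sum-mono (λ r → *-monoʳ-≤ (wt r) (B≤ r)) ⟩
          sum (λ r → wt r * (suc E * q)) ≡⟨ trans (sym (sum-* wt _)) (cong (_* (suc E * q)) wt-sum) ⟩
          j' * (suc E * q) ∎
          where
          open ≤-Reasoning
          -- Weight 1 for the `j'` parts different from both the home part `i` and the part `r₀` of
          -- `x`.
          wt : Fin ℓ → ℕ
          wt = others (λ r → ⟦ not (i == r) ⟧) r₀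
          wt-sum : sum wt ≡ j'
          wt-sum = +-cancelʳ-≡ 1 _ j' (trans (cong (sum wt +_) (sym (cong ⟦_⟧ (∧-proj₁ {not (i == r₀)} b)))) (trans (others-sum (λ r → ⟦ not (i == r) ⟧) r₀) (trans (Turán.nonlast j' i) (+-comm 1 j'))))
          pt : ∀ y → ⟦ crossB x y ⟧ ≤ sum (λ r → wt r * ⟦ B r y ⟧)
          pt y = ⟦⟧-≤ λ c → case any-true _ c of λ { (r , d) → ≤-trans
            (*-mono-≤ (⟦⟧*⟦⟧-true (not-intro (≢⇒== {x = r₀} {r} λ { refl → true≢false (∧-proj₂ {not (i == r)} b) (not-elim (∧-proj₂ {B r y} (∧-proj₂ {not (i == r)} d))) })) (∧-proj₁ {not (i == r)} d))
              (⟦⟧-true (∧-proj₁ {B r y} (∧-proj₂ {not (i == r)} d)))) (term≤sum (λ r → wt r * ⟦ B r y ⟧) r) }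

      W≤ : E * count W + E * count Df ≤ j * (suc E * q)
      W≤ = begin
        E * count W + E * count Df ≡⟨ sym (*-distribˡ-+ E (count W) (count Df)) ⟩
        E * (count W + count Df) ≤⟨ *-monoʳ-≤ E (≤-trans (≤-reflexive (sym (sum-+ _ _))) (≤-trans (sum-mono pt) (≤-reflexive (trans (sum-swap _) (sum-cong λ r → sym (*-sum ⟦ not (i == r) ⟧ _)))))) ⟩
        E * sum (λ r → ⟦ not (i == r) ⟧ * count (B r)) ≡⟨ trans (*-sum E _) (sum-cong λ r → *-reassoc E ⟦ not (i == r) ⟧ _) ⟩
        sum (λ r → ⟦ not (i == r) ⟧ * (E * count (B r))) ≤⟨ sum-mono (λ r → *-monoʳ-≤ ⟦ not (i == r) ⟧ (B≤ r)) ⟩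
        sum (λ r → ⟦ not (i == r) ⟧ * (suc E * q)) ≡⟨ trans (sym (sum-* _ _)) (cong (_* (suc E * q)) (Turán.nonlast j' i)) ⟩
        j * (suc E * q) ∎
        where
        open ≤-Reasoning
        pt : ∀ x → ⟦ W x ⟧ + ⟦ Df x ⟧ ≤ sum (λ r → ⟦ not (i == r) ⟧ * ⟦ B r x ⟧)
        pt x = go (W x) (Df x) refl refl
          where
          go : ∀ a b → W x ≡ a → Df x ≡ b → ⟦ a ⟧ + ⟦ b ⟧ ≤ sum (λ r → ⟦ not (i == r) ⟧ * ⟦ B r x ⟧)
          go true true ea eb = ⊥-elim (true≢false (∧-proj₁ {adj o x} ea) (not-elim (∧-proj₂ {B p x} eb)))
          go true false ea eb = case any-true _ (∧-proj₂ {adj o x} ea) of λ { (r , b) → ≤-trans (⟦⟧*⟦⟧-true (∧-proj₁ {not (i == r)} b) (∧-proj₂ {not (i == r)} b)) (term≤sum (λ r → ⟦ not (i == r) ⟧ * ⟦ B r x ⟧) r) }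
          go false true ea eb = ≤-trans (⟦⟧*⟦⟧-true (not-intro (≢⇒== (p≢i ∘ sym))) (∧-proj₁ {B p x} eb)) (term≤sum (λ r → ⟦ not (i == r) ⟧ * ⟦ B r x ⟧) p)
          go false false _ _ = z≤n

      absurd : ⊥
      absurd = link-small j' c₁ E q s K (count U) (count In) (count W) cross (count Df) 1≤j' 1≤q hE₂ 1≤E linkSize cross≤
        (count-mono {q = S} λ x e → adj-S' (∧-proj₁ {adj o x} e)) s≤ rest few hK W≤ many

    settle : ∀ {o} → S o ≡ true → ∀ i → E * count (λ y → B i y ∧ adj o y) ≤ c₁ * q → Typ i o
    settle {o} So i few p p≢i with 8 * count (λ y → B p y ∧ not (adj o y)) ≤? q
    ... | yes h = h
    ... | no ¬h = ⊥-elim (Settle.absurd So i few p p≢i (<⇒≤ (≰⇒> ¬h)))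

-- Counting the triples that are not transversal

extraColours : Variant → ℕ → ℕ
extraColours γ ℓ = 1
extraColours _ ℓ = ℓ

∨-introˡ : ∀ {a b} → a ≡ true → a ∨ b ≡ true
∨-introˡ refl = refl

∨-introʳ : ∀ a {b} → b ≡ true → a ∨ b ≡ true
∨-introʳ true refl = refl
∨-introʳ false refl = refl

sum-pos : ∀ {n} {f : Fin n → ℕ} → 1 ≤ sum f → ∃ λ x → 1 ≤ f x
sum-pos {n} h = sum-<⇒∃ {f = λ _ → 0} (≤-trans (≤-reflexive (cong suc (sum-zero n))) h)

sum₃ : ∀ {n} → (Fin n → Fin n → Fin n → ℕ) → ℕ
sum₃ f = sum λ x → sum λ y → sum λ z → f x y z

sum₃-mono : ∀ {n} {f h : Fin n → Fin n → Fin n → ℕ} → (∀ x y z → f x y z ≤ h x y z) → sum₃ f ≤ sum₃ h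
sum₃-mono h = sum-mono λ x → sum-mono λ y → sum-mono λ z → h x y z

sum₃-swap : ∀ {n k} (f : Fin k → Fin n → Fin n → Fin n → ℕ) → sum₃ (λ x y z → sum λ i → f i x y z) ≡ sum (λ i → sum₃ (f i))
sum₃-swap f = trans (sum-cong λ x → trans (sum-cong λ y → sum-swap _) (sum-swap _)) (sum-swap _)

module _ {n m : ℕ} {χ : Coloring n m} (F : Family χ) where
  open Family F

  point : Fin n → Fin n → Fin n → Fin n → Fin n → Fin n → ℕ
  point a b c x y z = ⟦ x == a ⟧ * (⟦ y == b ⟧ * ⟦ z == c ⟧)

  point-sum : ∀ a b c → sum₃ (point a b c) ≡ 1
  point-sum a b c = trans (sum-cong λ x → trans (sum-cong λ y → trans (sym (*-sum ⟦ x == a ⟧ _)) (cong (⟦ x == a ⟧ *_) (trans (sym (*-sum ⟦ y == b ⟧ _)) (cong (⟦ y == b ⟧ *_) (count-== c)))))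
      (trans (sym (*-sum ⟦ x == a ⟧ _)) (cong (⟦ x == a ⟧ *_) (sum-δ b (λ _ → 1))))) (sum-δ a (λ _ → 1))

  -- A colour class of the family is a single triple, i.e. six ordered ones.
  six : (R : Fin n → Fin n → Fin n → Bool) → (∀ {x y z} → R x y z ≡ true → g x y z ≡ true) →
    (∀ {x y z x' y' z'} → R x y z ≡ true → R x' y' z' ≡ true → χ (tri x y z) ≡ χ (tri x' y' z')) → sum₃ (λ x y z → ⟦ R x y z ⟧) ≤ 6
  six R R⇒g R-col with 1 ≤? sum₃ (λ x y z → ⟦ R x y z ⟧)
  ... | no ¬h = ≤-trans (≤-pred (≰⇒> ¬h)) z≤n
  ... | yes h with sum-pos h
  ... | a , h₁ with sum-pos h₁
  ... | b , h₂ with sum-pos h₂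
  ... | c , h₃ = ≤-trans (sum₃-mono λ x y z → ⟦⟧-≤ (perm x y z)) (≤-trans (≤-reflexive (sum₃-swap _)) (≤-trans (sum-mono λ k → ≤-reflexive (total k)) (≤-reflexive (sum-const 6 1))))
    where
    Rabc : R a b c ≡ true
    Rabc = ⟦⟧-pos h₃
    points : Fin n → Fin n → Fin n → Vec.Vec ℕ 6
    points x y z = point a b c x y z ∷ point a c b x y z ∷ point b a c x y z ∷ point b c a x y z ∷ point c a b x y z ∷ point c b a x y z ∷ []
    total : ∀ k → sum₃ (λ x y z → Vec.lookup (points x y z) k) ≡ 1
    total zero = point-sum a b c
    total 1F = point-sum a c b
    total 2F = point-sum b a c
    total 3F = point-sum b c a
    total 4F = point-sum c a b
    total 5F = point-sum c b a
    perm : ∀ x y z → R x y z ≡ true → 1 ≤ sum (λ k → Vec.lookup (points x y z) k)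
    perm x y z e = go (∈-tri⁻ (member (∈-tri₁ x y z))) (∈-tri⁻ (member (∈-tri₂ x y z))) (∈-tri⁻ (member (∈-tri₃ x y z)))
      where
      gx : g x y z ≡ true
      gx = R⇒g e
      member : ∀ {u} → u ∈ₛ tri x y z → u ∈ₛ tri a b c
      member {u} = subst (u ∈ₛ_) (g-inj gx (R⇒g Rabc) (R-col e Rabc))
      put : ∀ k → 1 ≤ Vec.lookup (points x y z) k → 1 ≤ sum (λ k → Vec.lookup (points x y z) k)
      put k h = ≤-trans h (term≤sum (λ k → Vec.lookup (points x y z) k) k)
      eq : ∀ {u u'} → u ≡ u' → 1 ≤ ⟦ u == u' ⟧
      eq {u} refl = ⟦⟧-true (==-refl u)
      three : ∀ {a b c} → x ≡ a → y ≡ b → z ≡ c → 1 ≤ point a b c x y z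
      three p q r = *-mono-≤ (eq p) (*-mono-≤ (eq q) (eq r))
      xy : ∀ {u} → x ≡ u → y ≡ u → ⊥
      xy p q = g-≢ gx (trans p (sym q))
      xz : ∀ {u} → x ≡ u → z ≡ u → ⊥
      xz p q = g-≢₁₃ gx (trans p (sym q))
      yz : ∀ {u} → y ≡ u → z ≡ u → ⊥
      yz p q = g-≢₂₃ gx (trans p (sym q))
      go : x ≡ a ⊎ x ≡ b ⊎ x ≡ c → y ≡ a ⊎ y ≡ b ⊎ y ≡ c → z ≡ a ⊎ z ≡ b ⊎ z ≡ c → 1 ≤ sum (λ k → Vec.lookup (points x y z) k)
      go (inj₁ p) (inj₁ q) _ = ⊥-elim (xy p q)
      go (inj₁ p) (inj₂ (inj₁ q)) (inj₁ r) = ⊥-elim (xz p r)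
      go (inj₁ p) (inj₂ (inj₁ q)) (inj₂ (inj₁ r)) = ⊥-elim (yz q r)
      go (inj₁ p) (inj₂ (inj₁ q)) (inj₂ (inj₂ r)) = put zero (three p q r)
      go (inj₁ p) (inj₂ (inj₂ q)) (inj₁ r) = ⊥-elim (xz p r)
      go (inj₁ p) (inj₂ (inj₂ q)) (inj₂ (inj₁ r)) = put 1F (three p q r)
      go (inj₁ p) (inj₂ (inj₂ q)) (inj₂ (inj₂ r)) = ⊥-elim (yz q r)
      go (inj₂ (inj₁ p)) (inj₁ q) (inj₁ r) = ⊥-elim (yz q r)
      go (inj₂ (inj₁ p)) (inj₁ q) (inj₂ (inj₁ r)) = ⊥-elim (xz p r)
      go (inj₂ (inj₁ p)) (inj₁ q) (inj₂ (inj₂ r)) = put 2F (three p q r)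
      go (inj₂ (inj₁ p)) (inj₂ (inj₁ q)) _ = ⊥-elim (xy p q)
      go (inj₂ (inj₁ p)) (inj₂ (inj₂ q)) (inj₁ r) = put 3F (three p q r)
      go (inj₂ (inj₁ p)) (inj₂ (inj₂ q)) (inj₂ (inj₁ r)) = ⊥-elim (xz p r)
      go (inj₂ (inj₁ p)) (inj₂ (inj₂ q)) (inj₂ (inj₂ r)) = ⊥-elim (yz q r)
      go (inj₂ (inj₂ p)) (inj₁ q) (inj₁ r) = ⊥-elim (yz q r)
      go (inj₂ (inj₂ p)) (inj₁ q) (inj₂ (inj₁ r)) = put 4F (three p q r)
      go (inj₂ (inj₂ p)) (inj₁ q) (inj₂ (inj₂ r)) = ⊥-elim (xz p r)
      go (inj₂ (inj₂ p)) (inj₂ (inj₁ q)) (inj₁ r) = put 5F (three p q r)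
      go (inj₂ (inj₂ p)) (inj₂ (inj₁ q)) (inj₂ (inj₁ r)) = ⊥-elim (yz q r)
      go (inj₂ (inj₂ p)) (inj₂ (inj₁ q)) (inj₂ (inj₂ r)) = ⊥-elim (xz p r)
      go (inj₂ (inj₂ p)) (inj₂ (inj₂ q)) _ = ⊥-elim (xy p q)

module FinalCount {n m : ℕ} {χ : Coloring n m} (F : Family χ) (v : Variant) {j' : ℕ} (1≤j' : 1 ≤ j') (f : Fin n → Fin (suc (suc j')))
  (colour : ∀ {i i' x y w x' y' w'} → Compat v i i' → f x ≡ i → f y ≡ i → f x' ≡ i' → f y' ≡ i' →
    Family.g F x y w ≡ true → Family.g F x' y' w' ≡ true → χ (tri x y w) ≡ χ (tri x' y' w')) where
  open Family F

  private
    ℓ : ℕ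
    ℓ = suc (suc j')

  record Double (x y z : Fin n) (i : Fin ℓ) : Set where
    constructor double
    field
      {a b c} : Fin n
      fa : f a ≡ i
      fb : f b ≡ i
      gabc : g a b c ≡ true
      tri≡ : tri x y z ≡ tri a b c

  double-colour : ∀ {i i' x y z x' y' z'} → Compat v i i' → Double x y z i → Double x' y' z' i' → χ (tri x y z) ≡ χ (tri x' y' z')
  double-colour c (double fa fb ga e) (double fa' fb' ga' e') = trans (cong χ e) (trans (colour c fa fb fa' fb' ga ga') (sym (cong χ e')))

  two : Fin ℓ → Fin n → Fin n → Fin n → Bool
  two i x y z = (f x == i) ∧ (f y == i) ∨ ((f x == i) ∧ (f z == i) ∨ (f y == i) ∧ (f z == i))

  two⇒ : ∀ i {x y z} → g x y z ≡ true → two i x y z ≡ true → Double x y z i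
  two⇒ i {x} {y} {z} e h with ∨-elim {(f x == i) ∧ (f y == i)} h
  ... | inj₁ p = double (==⇒≡ (∧-proj₁ {f x == i} p)) (==⇒≡ (∧-proj₂ {f x == i} p)) e refl
  ... | inj₂ h' with ∨-elim {(f x == i) ∧ (f z == i)} h'
  ... | inj₁ p = double (==⇒≡ (∧-proj₁ {f x == i} p)) (==⇒≡ (∧-proj₂ {f x == i} p)) (trans (sym (g-sym₂ x y z)) e) (tri-sym₂ x y z)
  ... | inj₂ p = double (==⇒≡ (∧-proj₁ {f y == i} p)) (==⇒≡ (∧-proj₂ {f y == i} p)) (trans (sym (trans (g-sym₁ x y z) (g-sym₂ y x z))) e) (trans (tri-sym₁ x y z) (tri-sym₂ y x z))

  back : ∀ {u w : Fin ℓ} → u ≡ w → (w == u) ≡ true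
  back {u} refl = ==-refl u

  bad⇒two : ∀ x y z → dist (f x) (f y) (f z) ≡ false → ∃ λ i → two i x y z ≡ true
  bad⇒two x y z e with f x Finₚ.≟ f y | f x Finₚ.≟ f z | f y Finₚ.≟ f z
  ... | yes p | _ | _ = f x , ∨-introˡ (∧-intro (==-refl (f x)) (back p))
  ... | no _ | yes p | _ = f x , ∨-introʳ ((f x == f x) ∧ (f y == f x)) (∨-introˡ (∧-intro (==-refl (f x)) (back p)))
  ... | no _ | no _ | yes p = f y , ∨-introʳ ((f x == f y) ∧ (f y == f y)) (∨-introʳ ((f x == f y) ∧ (f z == f y)) (∧-intro (==-refl (f y)) (back p)))

  bad : Fin n → Fin n → Fin n → Bool
  bad x y z = g x y z ∧ not (dist (f x) (f y) (f z))

  bad-double : ∀ {x y z} → bad x y z ≡ true → ∃ λ i → two i x y z ≡ true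
  bad-double {x} {y} {z} e = bad⇒two x y z (not-elim (∧-proj₂ {g x y z} e))

  -- A triple that is not transversal is inner for some part. Such triples use one colour per part,
  -- for `γ` one colour in all, and `six` bounds each colour.
  bad≤ : sum₃ (λ x y z → ⟦ bad x y z ⟧) ≤ 6 * extraColours v ℓ
  bad≤ = go v refl
    where
    byPart : (∀ i → Compat v {ℓ} i i) → sum₃ (λ x y z → ⟦ bad x y z ⟧) ≤ 6 * ℓ
    byPart c = ≤-trans (sum₃-mono pt) (≤-trans (≤-reflexive (sum₃-swap _)) (≤-trans (sum-mono part) (≤-reflexive (trans (sum-const ℓ 6) (*-comm ℓ 6)))))
      where
      R : Fin ℓ → Fin n → Fin n → Fin n → Bool
      R i x y z = g x y z ∧ two i x y z
      pt : ∀ x y z → ⟦ bad x y z ⟧ ≤ sum (λ i → ⟦ R i x y z ⟧)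
      pt x y z = ⟦⟧-≤ λ e → case bad-double e of λ { (i , h) → count-pos {p = λ i → R i x y z} i (∧-intro (∧-proj₁ {g x y z} e) h) }
      part : ∀ i → sum₃ (λ x y z → ⟦ R i x y z ⟧) ≤ 6
      part i = six F (R i) (λ {x} {y} {z} → ∧-proj₁ {g x y z}) λ {x} {y} {z} {x'} {y'} {z'} e e' →
        double-colour (c i) (two⇒ i (∧-proj₁ {g x y z} e) (∧-proj₂ {g x y z} e)) (two⇒ i (∧-proj₁ {g x' y' z'} e') (∧-proj₂ {g x' y' z'} e'))
    go : ∀ u → v ≡ u → sum₃ (λ x y z → ⟦ bad x y z ⟧) ≤ 6 * extraColours u ℓ
    go plain refl = byPart (λ i → refl)
    go α refl = byPart (λ i → refl)
    go β refl = byPart (λ i → refl)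
    go γ refl = six F bad (λ {x} {y} {z} → ∧-proj₁ {g x y z}) λ {x} {y} {z} {x'} {y'} {z'} e e' →
      case bad-double e of λ { (i , h) → case bad-double e' of λ { (i' , h') →
        double-colour {i} {i'} Data.Unit.tt (two⇒ i (∧-proj₁ {g x y z} e) h) (two⇒ i' (∧-proj₁ {g x' y' z'} e') h') } }

  finalCount : sum₃ (λ x y z → ⟦ g x y z ⟧) ≤ e3 (Turán.bal j' (count S)) + 6 * extraColours v ℓ
  finalCount = ≤-trans (sum₃-mono pt) (≤-trans (≤-reflexive (trans (sum-cong λ x → trans (sum-cong λ y → sum-+ _ _) (sum-+ _ _)) (sum-+ _ _)))
      (+-mono-≤ (≤-trans (≤-reflexive regroup) (Turán.transversal≤ j' S f 1≤j')) bad≤))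
    where
    good : Fin n → Fin n → Fin n → ℕ
    good x y z = ⟦ S x ⟧ * (⟦ S y ⟧ * (⟦ S z ⟧ * ⟦ dist (f x) (f y) (f z) ⟧))
    regroup : sum₃ good ≡ sum (λ x → ⟦ S x ⟧ * sum λ y → ⟦ S y ⟧ * sum λ z → ⟦ S z ⟧ * ⟦ dist (f x) (f y) (f z) ⟧)
    regroup = sum-cong λ x → trans (sum-cong λ y → trans (sym (*-sum ⟦ S x ⟧ _)) (cong (⟦ S x ⟧ *_) (sym (*-sum ⟦ S y ⟧ _)))) (sym (*-sum ⟦ S x ⟧ _))
    pt : ∀ x y z → ⟦ g x y z ⟧ ≤ good x y z + ⟦ bad x y z ⟧
    pt x y z = ⟦⟧-≤ λ e → go e (dist (f x) (f y) (f z)) refl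
      where
      go : g x y z ≡ true → ∀ d → dist (f x) (f y) (f z) ≡ d → 1 ≤ good x y z + ⟦ bad x y z ⟧
      go e true d = ≤-trans (*-mono-≤ (⟦⟧-true (g-S e)) (*-mono-≤ (⟦⟧-true (g-S (trans (sym (g-sym₁ x y z)) e))) (⟦⟧*⟦⟧-true (g-S {z} {x} {y} (trans (g-sym₁ z x y) (trans (sym (g-sym₂ x y z)) e))) d))) (m≤m+n _ _)
      go e false d = ≤-trans (⟦⟧-true (∧-intro e (not-intro d))) (m≤n+m _ (good x y z))

-- Assembling the structure and fixing the constants

lookup≤sum : ∀ {n} (xs : Vec.Vec ℕ n) k → Vec.lookup xs k ≤ Vec.sum xs
lookup≤sum xs k = ≤-trans (term≤sum (Vec.lookup xs) k) (≤-reflexive (sum-lookup xs))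

module Core {n m : ℕ} {χ : Coloring n m} {F : Family χ} {j' t K : ℕ} (H : HeavyGraph F (suc (suc j')) t K) (v : Variant)
  (same : SameColour χ (HeavyGraph.adj H) v (suc (suc j')) (2 + t)) (1≤j' : 1 ≤ j') (1≤t : 1 ≤ t) (q E₁ e' T C₀ : ℕ)
  (s≥ : q * suc (suc j') ≤ count (Family.S F)) (s≤ : count (Family.S F) ≤ q * suc (suc j') + suc (suc j'))
  (D≥ : ∀ o → Family.S F o ≡ true → suc j' * j' * (q * q) ≤ sum λ x → sum λ y → ⟦ Family.g F o x y ⟧)
  (E'≡ : suc e' ≡ 11 * suc (suc j') * E₁) (C₀≡ : C₀ ≡ 4 * suc e' * (K * ((2 * suc (suc j')) * (2 * suc (suc j')))))
  (T≡ : T ≡ suc t + 2 * (t * suc e'))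
  (E₁≥₁ : 2 * (2 * (suc (suc j') * (2 + t)) + 2) ≤ E₁)
  (E₁≥₂ : 16 * suc (suc j') * (3 + 2 * (suc (suc j') * suc t + 1)) + 24 * (suc j' * j') ≤ E₁)
  (E'≥ : 2 * suc j' + 2 ≤ suc e')
  (q≥₁ : n₁ j' (2 * suc j' * suc e') (suc t) ≤ q)
  (q≥₂ : 4 * suc e' * (2 * ((2 * suc (suc j')) * K)) ≤ q)
  (q≥₃ : ((suc j' * suc j' + 1) * (2 * suc j' * suc e') + (suc j' + 1)) * suc e' ≤ q)
  (q≥₄ : suc e' * C₀ ≤ q)
  (q≥₅ : n₁ j' (2 * suc j' * suc e') T + C₀ ≤ q)
  (q≥₆ : suc j' * T + t ≤ q)
  (q≥₇ : suc e' * suc (suc j') ≤ q)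
  (q≥₈ : 2 * (2 * (2 + t) + 12) ≤ q)
  (q≥₉ : suc t * E₁ ≤ q)
  (q≥₁₀ : E₁ * (2 * K + 1) ≤ q) where
  open Family F
  open HeavyGraph H

  private
    ℓ : ℕ
    ℓ = suc (suc j')
    1≤T : 1 ≤ T
    1≤T = ≤-trans (s≤s z≤n) (≤-reflexive (sym T≡))
    module D = Dense H 1≤j' q e' T C₀ 1≤T s≥ s≤ D≥ C₀≡ E'≥ q≥₁ q≥₂ q≥₃ q≥₄ q≥₅

    module WithAnchor (A : Blow adj D.OK ℓ T) (low : ∀ x → ∃ λ p → count (λ r → adj x (Blow.κ A p r)) ≤ t) where
      parts : Parts S adj ℓ q E₁
      parts = Split.parts H q e' T C₀ s≥ s≤ D.OK (λ x → ∧-proj₁ {S x}) (≤-trans (count-mono widen) D.bad≤) D.minDeg A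
        (λ x → proj₁ (low x)) (λ x → proj₂ (low x)) T≡ 1≤t q≥₄ q≥₆ q≥₇ E₁ E'≡
        where
        widen : (λ x → S x ∧ not (D.OK x)) ⊑ D.bad
        widen x e = go (S x) (does (D.E3 * D.lt x ≤? q * q)) e
          where
          go : ∀ a b → a ∧ not (a ∧ b) ≡ true → a ∧ not b ≡ true
          go true b e = e

    module WithParts (P : Parts S adj ℓ q E₁) where
      module L = Last H v same q E₁ P E₁≥₁ q≥₈

      module WithHome (home : ∀ x → ∃ λ i → E₁ * count (λ y → L.B i y ∧ adj x y) ≤ L.c₁ * q) where
        part : Fin n → Fin ℓ
        part x = proj₁ (home x)

        part-typ : ∀ {x} → S x ≡ true → L.Typ (part x) x
        part-typ {x} Sx = L.settle 1≤j' D.1≤q E₁≥₂ D.s≤2ℓq q≥₁₀ D≥ Sx (part x) (proj₂ (home x))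

        mk : ∀ {i x y w} → part x ≡ i → part y ≡ i → g x y w ≡ true → L.Inner i x y w
        mk {i} {x} {y} {w} fx fy e = L.inner (subst (λ z → L.Typ z x) fx (part-typ (g-S e))) (subst (λ z → L.Typ z y) fy (part-typ (g-S (trans (sym (g-sym₁ x y w)) e)))) (g-≢ e) (g-≢₁₃ e) (g-≢₂₃ e)

        result : sum₃ (λ x y z → ⟦ g x y z ⟧) ≤ e3 (Turán.bal j' (count S)) + 6 * extraColours v ℓ
        result = FinalCount.finalCount F v 1≤j' part λ c fx fy fx' fy' e e' → L.inner-colour c (mk fx fy e) (mk fx' fy' e')

      result : sum₃ (λ x y z → ⟦ g x y z ⟧) ≤ e3 (Turán.bal j' (count S)) + 6 * extraColours v ℓ
      result = WithHome.result (L.home q≥₉)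

  coloursBound : sum₃ (λ x y z → ⟦ g x y z ⟧) ≤ e3 (Turán.bal j' (count S)) + 6 * extraColours v ℓ
  coloursBound = WithParts.result (WithAnchor.parts D.anchor (D.lowPart D.anchor))

-- `E₁` depends on ℓ and `t`; it determines `e'`, and this `T` and, with `K`, also `C₀`. The list
-- `thresholds` collects what is then required of `q`, and its sum serves as a single bound.
record Constants (j' t K : ℕ) : Set where
  field
    E₁ e' T C₀ : ℕ
    E'≡ : suc e' ≡ 11 * suc (suc j') * E₁
    C₀≡ : C₀ ≡ 4 * suc e' * (K * ((2 * suc (suc j')) * (2 * suc (suc j'))))
    T≡ : T ≡ suc t + 2 * (t * suc e')
    E₁≥₁ : 2 * (2 * (suc (suc j') * (2 + t)) + 2) ≤ E₁
    E₁≥₂ : 16 * suc (suc j') * (3 + 2 * (suc (suc j') * suc t + 1)) + 24 * (suc j' * j') ≤ E₁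
    E'≥ : 2 * suc j' + 2 ≤ suc e'

  thresholds : Vec.Vec ℕ 10
  thresholds = n₁ j' (2 * suc j' * suc e') (suc t) ∷ 4 * suc e' * (2 * ((2 * suc (suc j')) * K)) ∷ ((suc j' * suc j' + 1) * (2 * suc j' * suc e') + (suc j' + 1)) * suc e' ∷
    suc e' * C₀ ∷ n₁ j' (2 * suc j' * suc e') T + C₀ ∷ suc j' * T + t ∷ suc e' * suc (suc j') ∷ 2 * (2 * (2 + t) + 12) ∷ suc t * E₁ ∷ E₁ * (2 * K + 1) ∷ []

constants : ∀ j' t K → Constants j' t K
constants j' t K = build (suc (a + b)) (≤-trans (m≤n+m b a) (n≤1+n (a + b))) (≤-trans (m≤m+n a b) (n≤1+n (a + b)))
  where
  a b : ℕ
  a = 16 * suc (suc j') * (3 + 2 * (suc (suc j') * suc t + 1)) + 24 * (suc j' * j')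
  b = 2 * (2 * (suc (suc j') * (2 + t)) + 2)
  build : ∀ E₁ → b ≤ E₁ → a ≤ E₁ → Constants j' t K
  build E₁ h₁ h₂ = record { E₁ = E₁ ; e' = pred E' ; T = _ ; C₀ = _ ; E'≡ = suc-pred E' ; C₀≡ = refl ; T≡ = refl ; E₁≥₁ = h₁ ; E₁≥₂ = h₂
      ; E'≥ = ≤-trans large (≤-reflexive (sym (suc-pred E'))) }
    where
    E' : ℕ
    E' = 11 * suc (suc j') * E₁
    1≤E₁ : 1 ≤ E₁
    1≤E₁ = ≤-trans (s≤s z≤n) h₁
    instance
      E₁≢0 : NonZero E₁
      E₁≢0 = >-nonZero 1≤E₁
      E'≢0 : NonZero E'
      E'≢0 = m*n≢0 (11 * suc (suc j')) E₁
    large : 2 * suc j' + 2 ≤ E'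
    large = ≤-trans (≤-trans (m≤m+n _ (9 * j' + 18)) (≤-reflexive (lem j'))) (m≤m*n (11 * suc (suc j')) E₁)
      where
      lem : ∀ j → 2 * suc j + 2 + (9 * j + 18) ≡ 11 * suc (suc j)
      lem = solve-∀

module _ {n m : ℕ} {χ : Coloring n m} {F : Family χ} {j' t K : ℕ} (H : HeavyGraph F (suc (suc j')) t K) (v : Variant)
  (same : SameColour χ (HeavyGraph.adj H) v (suc (suc j')) (2 + t)) (1≤j' : 1 ≤ j') (1≤t : 1 ≤ t) (c : Constants j' t K) where
  open Constants c
  open Family F

  bounded : ∀ q → Vec.sum thresholds ≤ q → q * suc (suc j') ≤ count S → count S ≤ q * suc (suc j') + suc (suc j') →
    (∀ o → S o ≡ true → suc j' * j' * (q * q) ≤ sum λ x → sum λ y → ⟦ g o x y ⟧) →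
    sum₃ (λ x y z → ⟦ g x y z ⟧) ≤ e3 (Turán.bal j' (count S)) + 6 * extraColours v (suc (suc j'))
  bounded q Q≤q s≥ s≤ D≥ = Core.coloursBound H v same 1≤j' 1≤t q E₁ e' T C₀ s≥ s≤ D≥ E'≡ C₀≡ T≡ E₁≥₁ E₁≥₂ E'≥
      (big zero) (big 1F) (big 2F) (big 3F) (big 4F)
      (big 5F) (big 6F) (big 7F)
      (big 8F) (big 9F)
    where
    big : ∀ k → Vec.lookup thresholds k ≤ q
    big k = ≤-trans (lookup≤sum thresholds k) Q≤q

-- One representative triple for each colour

∣∣≡count : ∀ {n} (τ : Subset n) → ∣ τ ∣ ≡ count (Vec.lookup τ)
∣∣≡count [] = sym (sum-empty _)
∣∣≡count (true ∷ τ) = trans (cong suc (∣∣≡count τ)) (sym (sum-suc _))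
∣∣≡count (false ∷ τ) = trans (∣∣≡count τ) (sym (sum-suc _))

∈⇒lookup : ∀ {n} {τ : Subset n} {x} → x ∈ₛ τ → Vec.lookup τ x ≡ true
∈⇒lookup = Vecₚ.[]=⇒lookup

lookup⇒∈ : ∀ {n} {τ : Subset n} {x} → Vec.lookup τ x ≡ true → x ∈ₛ τ
lookup⇒∈ {τ = τ} {x} = Vecₚ.lookup⇒[]= x τ

_≟ₛ_ : ∀ {n} (σ τ : Subset n) → Dec (σ ≡ τ)
_≟ₛ_ = Vecₚ.≡-dec Boolₚ._≟_

∖-true : ∀ {n} (p : Fin n → Bool) {v x} → p x ≡ true → x ≢ v → (p ∖ v) x ≡ true
∖-true p e ne = ∧-intro e (not-intro (≢⇒== ne))

tri-full : ∀ {n} (τ : Subset n) {x y z} → ∣ τ ∣ ≡ 3 → x ∈ₛ τ → y ∈ₛ τ → z ∈ₛ τ → x ≢ y → x ≢ z → y ≢ z → tri x y z ≡ τ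
tri-full τ {x} {y} {z} size x∈ y∈ z∈ x≢y x≢z y≢z = Subₚ.⊆-antisym into onto
  where
  p = Vec.lookup τ
  into : ∀ {u} → u ∈ₛ tri x y z → u ∈ₛ τ
  into {u} h with ∈-tri⁻ h
  ... | inj₁ refl = x∈
  ... | inj₂ (inj₁ refl) = y∈
  ... | inj₂ (inj₂ refl) = z∈
  empty : count (((p ∖ x) ∖ y) ∖ z) ≡ 0
  empty = suc-injective (suc-injective (suc-injective (trans (cong (λ k → suc (suc k)) (sym (count-∖-≡ ((p ∖ x) ∖ y) z (∖-true (p ∖ x) (∖-true p (∈⇒lookup z∈) (x≢z ∘ sym)) (y≢z ∘ sym)))))
    (trans (cong suc (sym (count-∖-≡ (p ∖ x) y (∖-true p (∈⇒lookup y∈) (x≢y ∘ sym))))) (trans (sym (count-∖-≡ p x (∈⇒lookup x∈))) (trans (sym (∣∣≡count τ)) size))))))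
  onto : ∀ {u} → u ∈ₛ τ → u ∈ₛ tri x y z
  onto {u} h with u Finₚ.≟ x | u Finₚ.≟ y | u Finₚ.≟ z
  ... | yes refl | _ | _ = ∈-tri₁ u y z
  ... | no _ | yes refl | _ = ∈-tri₂ x u z
  ... | no _ | no _ | yes refl = ∈-tri₃ x y u
  ... | no a | no b | no c = ⊥-elim (<⇒≱ (count-pos {p = ((p ∖ x) ∖ y) ∖ z} u (∖-true ((p ∖ x) ∖ y) (∖-true (p ∖ x) (∖-true p (∈⇒lookup h) a) b) c)) (≤-reflexive empty))

dist⇒ : ∀ {n} {x y z : Fin n} → dist x y z ≡ true → x ≢ y × x ≢ z × y ≢ z
dist⇒ {x = x} {y} {z} e = ne (∧-proj₁ {not (x == y)} e) , ne (∧-proj₁ {not (x == z)} (∧-proj₂ {not (x == y)} e)) , ne (∧-proj₂ {not (x == z)} (∧-proj₂ {not (x == y)} e))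
  where
  ne : ∀ {a b : Fin _} → not (a == b) ≡ true → a ≢ b
  ne {a} h refl = true≢false (==-refl a) (not-elim h)

six-orders : ∀ {n} (τ : Subset n) → ∣ τ ∣ ≡ 3 → 6 ≤ sum₃ (λ x y z → ⟦ dist x y z ∧ does (tri x y z ≟ₛ τ) ⟧)
six-orders {n} τ size = begin
  3 * 2 ≡⟨ cong (_* 2) (trans (sym size) (∣∣≡count τ)) ⟩
  count p * 2 ≤⟨ sum-on-≥ p 2 (λ x px → inner₂ x px) ⟩
  sum (λ x → ⟦ p x ⟧ * sum (λ y → ⟦ (p ∖ x) y ⟧ * count ((p ∖ x) ∖ y))) ≡⟨ sum-cong (λ x → trans (*-sum ⟦ p x ⟧ _) (sum-cong λ y → trans (cong (⟦ p x ⟧ *_) (*-sum ⟦ (p ∖ x) y ⟧ _)) (*-sum ⟦ p x ⟧ _))) ⟩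
  sum₃ (λ x y z → ⟦ p x ⟧ * (⟦ (p ∖ x) y ⟧ * ⟦ ((p ∖ x) ∖ y) z ⟧)) ≤⟨ sum₃-mono pt ⟩
  sum₃ (λ x y z → ⟦ dist x y z ∧ does (tri x y z ≟ₛ τ) ⟧) ∎
  where
  open ≤-Reasoning
  p = Vec.lookup τ
  c3 : 3 ≤ count p
  c3 = ≤-reflexive (trans (sym size) (∣∣≡count τ))
  inner₂ : ∀ x → p x ≡ true → 2 ≤ sum (λ y → ⟦ (p ∖ x) y ⟧ * count ((p ∖ x) ∖ y))
  inner₂ x px = ≤-trans c2 (≤-trans (≤-reflexive (sym (*-identityʳ _))) (sum-on-≥ (p ∖ x) 1 λ y _ → ≤-pred (≤-trans c2 (count-∖ (p ∖ x) y))))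
    where
    c2 : 2 ≤ count (p ∖ x)
    c2 = ≤-pred (≤-trans c3 (count-∖ p x))
  pt : ∀ x y z → ⟦ p x ⟧ * (⟦ (p ∖ x) y ⟧ * ⟦ ((p ∖ x) ∖ y) z ⟧) ≤ ⟦ dist x y z ∧ does (tri x y z ≟ₛ τ) ⟧
  pt x y z = ≤-trans (≤-reflexive (trans (cong (⟦ p x ⟧ *_) (sym (⟦⟧-∧ ((p ∖ x) y) _))) (sym (⟦⟧-∧ (p x) _)))) (⟦⟧-≤ λ e → ⟦⟧-true (hit e))
    where
    hit : p x ∧ ((p ∖ x) y ∧ ((p ∖ x) ∖ y) z) ≡ true → dist x y z ∧ does (tri x y z ≟ₛ τ) ≡ true
    hit e = ∧-intro (∧-intro (not-intro (≢⇒== x≢y)) (∧-intro (not-intro (≢⇒== x≢z)) (not-intro (≢⇒== y≢z))))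
        (dec-true (tri x y z ≟ₛ τ) (tri-full τ size (lookup⇒∈ px) (lookup⇒∈ (∧-proj₁ {p y} ey)) (lookup⇒∈ (∧-proj₁ {p z} ez₁)) x≢y x≢z y≢z))
      where
      px : p x ≡ true
      px = ∧-proj₁ {p x} e
      ey : (p ∖ x) y ≡ true
      ey = ∧-proj₁ {(p ∖ x) y} (∧-proj₂ {p x} e)
      ez : ((p ∖ x) ∖ y) z ≡ true
      ez = ∧-proj₂ {(p ∖ x) y} (∧-proj₂ {p x} e)
      ez₁ : (p ∖ x) z ≡ true
      ez₁ = ∧-proj₁ {(p ∖ x) z} ez
      ne : ∀ {a b : Fin n} → not (a == b) ≡ true → b ≢ a
      ne {a} h refl = true≢false (==-refl a) (not-elim h)
      x≢y : x ≢ y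
      x≢y = ne (∧-proj₂ {p y} ey)
      x≢z : x ≢ z
      x≢z = ne (∧-proj₂ {p z} ez₁)
      y≢z : y ≢ z
      y≢z = ne (∧-proj₂ {(p ∖ x) z} ez)

module Represent {n m : ℕ} (χ : Coloring n m) (surj : Surjective3 χ) where
  rep : Fin m → Subset n
  rep c = proj₁ (surj c)

  isRep : Fin n → Fin n → Fin n → Bool
  isRep x y z = does (rep (χ (tri x y z)) ≟ₛ tri x y z)

  gAll : Fin n → Fin n → Fin n → Bool
  gAll x y z = dist x y z ∧ isRep x y z

  gIn : (Fin n → Bool) → Fin n → Fin n → Fin n → Bool
  gIn Q x y z = gAll x y z ∧ (Q x ∧ (Q y ∧ Q z))

  gAll-sym₁ : ∀ x y z → gAll x y z ≡ gAll y x z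
  gAll-sym₁ x y z = cong₂ _∧_ (dist-sym₁ x y z) (cong (λ τ → does (rep (χ τ) ≟ₛ τ)) (tri-sym₁ x y z))

  gAll-sym₂ : ∀ x y z → gAll x y z ≡ gAll x z y
  gAll-sym₂ x y z = cong₂ _∧_ (dist-sym₂ x y z) (cong (λ τ → does (rep (χ τ) ≟ₛ τ)) (tri-sym₂ x y z))

  family : (Fin n → Bool) → Family χ
  family Q = record
    { S = Q ; g = gIn Q
    ; g-sym₁ = λ x y z → cong₂ _∧_ (gAll-sym₁ x y z) (trans (sym (∧-assoc (Q x) (Q y) (Q z))) (trans (cong (_∧ Q z) (∧-comm (Q x) (Q y))) (∧-assoc (Q y) (Q x) (Q z))))
    ; g-sym₂ = λ x y z → cong₂ _∧_ (gAll-sym₂ x y z) (cong (Q x ∧_) (∧-comm (Q y) (Q z)))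
    ; g-≢ = λ {x} {y} {z} e → proj₁ (dist⇒ (∧-proj₁ {dist x y z} (∧-proj₁ {gAll x y z} e)))
    ; g-S = λ {x} {y} {z} e → ∧-proj₁ {Q x} (∧-proj₂ {gAll x y z} e)
    ; g-inj = λ {x} {y} {z} {x'} {y'} {z'} e e' c → trans (sym (isR e)) (trans (cong rep c) (isR e'))
    }
    where
    isR : ∀ {x y z} → gIn Q x y z ≡ true → rep (χ (tri x y z)) ≡ tri x y z
    isR {x} {y} {z} e = does-true (rep (χ (tri x y z)) ≟ₛ tri x y z) (∧-proj₂ {dist x y z} (∧-proj₁ {gAll x y z} e))

  total : (Fin n → Bool) → ℕ
  total Q = sum₃ (λ x y z → ⟦ gIn Q x y z ⟧)

  linkSize : (Fin n → Bool) → Fin n → ℕ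
  linkSize Q o = sum λ x → sum λ y → ⟦ gIn Q o x y ⟧

  -- Representatives of different colours are different sets, and each appears in six orders.
  enough : 6 * m ≤ total (λ _ → true)
  enough = begin
    6 * m ≡⟨ trans (*-comm 6 m) (sym (sum-const m 6)) ⟩
    sum {m} (λ c → 6) ≤⟨ sum-mono (λ c → six-orders (rep c) (proj₁ (proj₂ (surj c)))) ⟩
    sum (λ c → sum₃ (λ x y z → ⟦ dist x y z ∧ does (tri x y z ≟ₛ rep c) ⟧)) ≡⟨ sym (sum₃-swap _) ⟩
    sum₃ (λ x y z → sum λ c → ⟦ dist x y z ∧ does (tri x y z ≟ₛ rep c) ⟧) ≤⟨ sum₃-mono pt ⟩
    total (λ _ → true) ∎
    where
    open ≤-Reasoning
    own : ∀ {x y z} c → dist x y z ∧ does (tri x y z ≟ₛ rep c) ≡ true → χ (tri x y z) ≡ c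
    own {x} {y} {z} c e = trans (cong χ (does-true (tri x y z ≟ₛ rep c) (∧-proj₂ {dist x y z} e))) (proj₂ (proj₂ (surj c)))
    pt : ∀ x y z → sum (λ c → ⟦ dist x y z ∧ does (tri x y z ≟ₛ rep c) ⟧) ≤ ⟦ gIn (λ _ → true) x y z ⟧
    pt x y z = sum-⟦⟧-≤ {f = λ c → dist x y z ∧ does (tri x y z ≟ₛ rep c)} λ c e →
      ≤-trans (count≤1 {p = λ c → dist x y z ∧ does (tri x y z ≟ₛ rep c)} λ c c' e e' → trans (sym (own {x} {y} {z} c e)) (own {x} {y} {z} c' e'))
        (⟦⟧-true (∧-intro (∧-intro (∧-proj₁ {dist x y z} e) (dec-true (rep (χ (tri x y z)) ≟ₛ tri x y z)
          (trans (cong rep (own {x} {y} {z} c e)) (sym (does-true (tri x y z ≟ₛ rep c) (∧-proj₂ {dist x y z} e)))))) refl))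

  total-∖ : ∀ Q o → Q o ≡ true → total Q ≤ total (Q ∖ o) + 3 * linkSize Q o
  total-∖ Q o _ = begin
    total Q ≤⟨ sum₃-mono pt ⟩
    sum₃ (λ x y z → sum (Vec.lookup (terms x y z))) ≡⟨ sum₃-swap _ ⟩
    sum (λ k → sum₃ (λ x y z → Vec.lookup (terms x y z) k)) ≡⟨ sum-cong part ⟩
    sum (Vec.lookup (total (Q ∖ o) ∷ linkSize Q o ∷ linkSize Q o ∷ linkSize Q o ∷ [])) ≡⟨ sum-lookup (total (Q ∖ o) ∷ linkSize Q o ∷ linkSize Q o ∷ linkSize Q o ∷ []) ⟩
    total (Q ∖ o) + 3 * linkSize Q o ∎
    where
    open ≤-Reasoning
    terms : Fin n → Fin n → Fin n → Vec.Vec ℕ 4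
    terms x y z = ⟦ gIn (Q ∖ o) x y z ⟧ ∷ ⟦ x == o ⟧ * ⟦ gIn Q o y z ⟧ ∷ ⟦ y == o ⟧ * ⟦ gIn Q o x z ⟧ ∷ ⟦ z == o ⟧ * ⟦ gIn Q o x y ⟧ ∷ []
    part : ∀ k → sum₃ (λ x y z → Vec.lookup (terms x y z) k) ≡ Vec.lookup (total (Q ∖ o) ∷ linkSize Q o ∷ linkSize Q o ∷ linkSize Q o ∷ []) k
    part zero = refl
    part 1F = trans (sum-swap _) (sum-cong λ y → trans (sum-swap _) (sum-cong λ z → sum-δ o (λ _ → ⟦ gIn Q o y z ⟧)))
    part 2F = sum-cong λ x → trans (sum-swap _) (sum-cong λ z → sum-δ o (λ _ → ⟦ gIn Q o x z ⟧))
    part 3F = sum-cong λ x → sum-cong λ y → sum-δ o (λ _ → ⟦ gIn Q o x y ⟧)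
    open Family (family Q) using (g-sym₁; g-sym₂)
    pt : ∀ x y z → ⟦ gIn Q x y z ⟧ ≤ sum (Vec.lookup (terms x y z))
    pt x y z = ⟦⟧-≤ (go (x Finₚ.≟ o) (y Finₚ.≟ o) (z Finₚ.≟ o))
      where
      put : ∀ k → 1 ≤ Vec.lookup (terms x y z) k → 1 ≤ sum (Vec.lookup (terms x y z))
      put k h = ≤-trans h (term≤sum (Vec.lookup (terms x y z)) k)
      is : ∀ {u} → u ≡ o → (u == o) ≡ true
      is refl = ==-refl o
      go : Dec (x ≡ o) → Dec (y ≡ o) → Dec (z ≡ o) → gIn Q x y z ≡ true → 1 ≤ sum (Vec.lookup (terms x y z))
      go (yes p) _ _ e = put 1F (⟦⟧*⟦⟧-true (is p) (subst (λ u → gIn Q u y z ≡ true) p e))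
      go (no _) (yes p) _ e = put 2F (⟦⟧*⟦⟧-true (is p) (trans (g-sym₁ o x z) (subst (λ u → gIn Q x u z ≡ true) p e)))
      go (no _) (no _) (yes p) e = put 3F (⟦⟧*⟦⟧-true (is p) (trans (g-sym₁ o x y) (trans (g-sym₂ x o y) (subst (λ u → gIn Q x y u ≡ true) p e))))
      go (no a) (no b) (no c) e = put zero (⟦⟧-true (∧-intro (∧-proj₁ {gAll x y z} e)
          (∧-intro (∖-true Q (∧-proj₁ {Q x} e') a) (∧-intro (∖-true Q (∧-proj₁ {Q y} (∧-proj₂ {Q x} e')) b) (∖-true Q (∧-proj₂ {Q y} (∧-proj₂ {Q x} e')) c)))))
        where e' = ∧-proj₂ {gAll x y z} e

  total≤ : ∀ Q → total Q ≤ count Q * (count Q * count Q)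
  total≤ Q = ≤-trans (sum₃-mono λ x y z → pt x y z) (≤-reflexive
      (trans (sum-cong λ x → trans (sum-cong λ y → trans (sym (*-sum ⟦ Q x ⟧ _)) (cong (⟦ Q x ⟧ *_) (sym (*-sum ⟦ Q y ⟧ _)))) (trans (sym (*-sum ⟦ Q x ⟧ _)) (cong (⟦ Q x ⟧ *_) (sym (sum-* _ (count Q)))))) (sym (sum-* _ (count Q * count Q)))))
    where
    pt : ∀ x y z → ⟦ gIn Q x y z ⟧ ≤ ⟦ Q x ⟧ * (⟦ Q y ⟧ * ⟦ Q z ⟧)
    pt x y z = ≤-trans (⟦⟧-≤ λ e → ⟦⟧-true (∧-proj₂ {gAll x y z} e)) (≤-reflexive (trans (⟦⟧-∧ (Q x) _) (cong (⟦ Q x ⟧ *_) (⟦⟧-∧ (Q y) _))))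

-- The upper bound

record IsCore (Γ : Graph) (v : Variant) (l t' : ℕ) : Set where
  field
    unique : Unique (Graph.edges Γ)
    position : Fin (Graph.nv Γ) → Pos (2 + l) (4 + t')
    position-injective : ∀ {x y} → position x ≡ position y → x ≡ y
    edge⇒ : OnlyEdges Γ position e₁ (e₂ v)
    order : (2 + l) * (4 + t') ≤ Graph.nv Γ

embProp : ∀ {n m} {χ : Coloring n m} (F : Family χ) {Γ v l t'} → IsCore Γ v l t' → ¬ RainbowCopy χ (expansion Γ) → EmbProp F v l t' (Kh Γ)
embProp {χ = χ} F {Γ} {v} core none ψ ψ-inj heavy w₁ w₂ w₁≢w₂ ψ≢w₁ ψ≢w₂
  with χ (tri (ψ (zero , zero)) (ψ (zero , 1F)) w₁) Finₚ.≟ χ (tri (ψ (proj₁ (e₂ v))) (ψ (proj₂ (e₂ v))) w₂)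
... | yes e = e
... | no ne = ⊥-elim (none (Embed.embed F Γ unique position position-injective e₁ (e₂ v) edge⇒ ψ ψ-inj heavy w₁ w₂ w₁≢w₂ ψ≢w₁ ψ≢w₂ ne))
  where open IsCore core

module Upper (v : Variant) (l t' : ℕ) (Γ : Graph) (core : IsCore Γ v (suc l) t') where
  private
    ℓ ec : ℕ
    ℓ = (3 + l)
    ec = extraColours v ℓ
    K : ℕ
    K = Kh Γ
    K≥ : ℓ * (4 + t') + 4 ≤ K
    K≥ = ≤-trans (+-monoˡ-≤ 4 (IsCore.order core)) (m≤m+n _ (2 * length (Graph.edges Γ)))
    module Tu = Turán (suc l)
    Θ : ℕ → ℕ
    Θ k = e3 (Tu.bal k)

  module _ (consts : Constants (suc l) (4 + t') K) (Q₀ : ℕ) (Q₀≡ : Vec.sum (Constants.thresholds consts) ≡ Q₀) where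
    N₀ : ℕ
    N₀ = Q₀ * ℓ + 1

    module Finish {n m : ℕ} (χ : Coloring n m) (surj : Surjective3 χ) (none : ¬ RainbowCopy χ (expansion Γ))
      (N≤n : N₀ + N₀ * (N₀ * N₀) ≤ n) (Q : Fin n → Bool) (s d : ℕ) (cQ : count Q ≡ s) (n≡ : n ≡ s + d)
      (big : Θ s + (6 * ec + 6 + d) ≤ Represent.total χ surj Q)
      (min : ∀ o → Q o ≡ true → Θ s ≤ Θ (pred s) + 3 * Represent.linkSize χ surj Q o) where
      open Represent χ surj

      -- Each deletion raises the excess by one. If fewer than `N₀` vertices survived, more than
      -- `N₀³` would have been deleted, and so large an excess exceeds the number of ordered triples
      -- on the survivors.
      s≥N₀ : N₀ ≤ s
      s≥N₀ with N₀ ≤? s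
      ... | yes h = h
      ... | no ¬h = ⊥-elim (<⇒≱ (+-mono-<-≤ (≰⇒> ¬h) d≤) (≤-trans N≤n (≤-reflexive n≡)))
        where
        s≤N₀ : count Q ≤ N₀
        s≤N₀ = ≤-trans (≤-reflexive cQ) (<⇒≤ (≰⇒> ¬h))
        d≤ : d ≤ N₀ * (N₀ * N₀)
        d≤ = ≤-trans (≤-trans (m≤n+m d (6 * ec + 6)) (m≤n+m _ (Θ s))) (≤-trans big (≤-trans (total≤ Q) (*-mono-≤ s≤N₀ (*-mono-≤ s≤N₀ s≤N₀))))

      emb : EmbProp (family Q) v (suc l) t' K
      emb = embProp (family Q) core none

      members≤ : ∀ q → Q₀ ≤ q → q * ℓ ≤ count Q → count Q ≤ q * ℓ + ℓ →
        (∀ o → Q o ≡ true → (2 + l) * suc l * (q * q) ≤ linkSize Q o) → total Q ≤ e3 (Tu.bal (count Q)) + 6 * ec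
      members≤ q Q≤q = bounded (Compare.heavyGraph (family Q) v l t' K K≥ emb) v (Compare.sameColour (family Q) v l t' K K≥ emb) (s≤s z≤n) (s≤s z≤n) consts
            q (≤-trans (≤-reflexive Q₀≡) Q≤q)

      -- The quotient `q` is taken for `s - 1`: the degree condition compares `Θ s` with
      -- `Θ (s - 1)`, and their difference is three times the `e2` estimated by `e2-bal-≥`. The
      -- contradiction comes from the summand 6, the ordered triples of the one colour beyond the
      -- bound.
      contra : ∀ s' → s ≡ suc s' → ⊥
      contra s' refl = <⇒≱ (m≤m+n _ _) (≤-trans (≤-reflexive (lem (Θ s) (6 * ec) d)) (≤-trans big (subst (λ k → total Q ≤ e3 (Tu.bal k) + 6 * ec) cQ
          (members≤ q Q≤q s≥ s≤ link≥))))
        where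
        open Tu.Shape (Tu.shape s') renaming (n≡ to s'≡)
        lem : ∀ a b d → suc (a + b) + (5 + d) ≡ a + (b + 6 + d)
        lem = solve-∀
        s≥ : q * ℓ ≤ count Q
        s≥ = ≤-trans (m≤n+m (q * ℓ) r) (≤-trans (≤-reflexive (sym s'≡)) (≤-trans (n≤1+n s') (≤-reflexive (sym cQ))))
        s≤ : count Q ≤ q * ℓ + ℓ
        s≤ = ≤-trans (≤-reflexive (trans cQ (cong suc s'≡))) (≤-trans (+-monoˡ-≤ (q * ℓ) r<ℓ) (≤-reflexive (+-comm ℓ (q * ℓ))))
        Q≤q : Q₀ ≤ q
        Q≤q with Q₀ ≤? q
        ... | yes h = h
        ... | no ¬h = ⊥-elim (<⇒≱ (≤-trans (≤-reflexive (+-comm 1 (Q₀ * ℓ))) s≥N₀) (≤-trans (≤-reflexive (sym cQ)) (≤-trans s≤ (≤-trans (≤-reflexive (+-comm (q * ℓ) ℓ)) (*-monoˡ-≤ ℓ (≰⇒> ¬h))))))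
        link≥ : ∀ o → Q o ≡ true → (2 + l) * suc l * (q * q) ≤ linkSize Q o
        link≥ o e = ≤-trans (Tu.e2-bal-≥ s') (*-cancelˡ-≤ 3 (+-cancelˡ-≤ (Θ s') _ _ (≤-trans (≤-reflexive (sym (Tu.e3-bal-suc s'))) (min o e))))

      absurd : ⊥
      absurd = go s refl
        where
        go : ∀ k → s ≡ k → ⊥
        go zero e = <⇒≱ (≤-trans (≤-reflexive (+-comm 1 (Q₀ * ℓ))) s≥N₀) (≤-trans (≤-reflexive e) z≤n)
        go (suc s') e = contra s' e

    module Start {n : ℕ} (N≤n : N₀ + N₀ * (N₀ * N₀) ≤ n) (χ : Coloring n (t3 n ℓ + ec + 1)) (surj : Surjective3 χ)
      (none : ¬ RainbowCopy χ (expansion Γ)) where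
      open Represent χ surj

      start : Θ n + (6 * ec + 6) ≤ total (λ _ → true)
      start = ≤-trans (+-monoˡ-≤ (6 * ec + 6) (Tu.e3-bal≤ n)) (≤-trans (≤-reflexive (lem (t3 n ℓ) ec)) enough)
        where
        lem : ∀ a b → 6 * a + (6 * b + 6) ≡ 6 * (a + b + 1)
        lem = solve-∀

      Deleted : Set
      Deleted = Σ (Fin n → Bool) λ Q → Σ ℕ λ s' → Σ ℕ λ d →
        (Q ⊑ (λ _ → true)) × count Q ≡ s' × n ≡ s' + d × Θ s' + (6 * ec + 6 + d) ≤ total Q ×
        (∀ o → Q o ≡ true → Θ s' ≤ Θ (pred s') + 3 * linkSize Q o)

      finish : Deleted → ⊥
      finish (Q , s , d , _ , cQ , n≡ , big , min) = Finish.absurd χ surj none N≤n Q s d cQ n≡ big min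

      deleted : Deleted
      deleted = delete total (λ Q o → 3 * linkSize Q o) Θ total-∖ n (6 * ec + 6) (λ _ → true) (count-all n) start

    upper′ : ∀ n → N₀ + N₀ * (N₀ * N₀) ≤ n → ArProperty n (expansion Γ) (t3 n ℓ + ec + 1)
    upper′ n N≤n χ surj = decidable-stable (rainbow? χ (expansion Γ)) λ none → Start.finish N≤n χ surj none (Start.deleted N≤n χ surj none)

  upper″ : Constants (suc l) (4 + t') K → ∃ λ N → ∀ n → N ≤ n → ArProperty n (expansion Γ) (t3 n ℓ + ec + 1)
  upper″ c = N₀ c Q₀ refl + N₀ c Q₀ refl * (N₀ c Q₀ refl * N₀ c Q₀ refl) , upper′ c Q₀ refl
    where
    Q₀ : ℕ
    Q₀ = Vec.sum (Constants.thresholds c)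

  upper : ∃ λ N → ∀ n → N ≤ n → ArProperty n (expansion Γ) (t3 n ℓ + ec + 1)
  upper = upper″ (constants (suc l) (4 + t') K)

isCore : ∀ v l t' → IsCore (blowup v (2 + l) (4 + t')) v l t'
isCore v l t' = record
  { unique = edgesOf-unique v (2 + l) (4 + t')
  ; position = pos ; position-injective = pos-injective
  ; edge⇒ = λ i → blowAdj⇒ v (proj₁ (lookup (edgesOf v (2 + l) (4 + t')) i)) (proj₂ (lookup (edgesOf v (2 + l) (4 + t')) i))
      (edgesOf-adj v (2 + l) (4 + t') i)
  ; order = ≤-refl }

-- The lower bound

tri-size : ∀ {n} {x y z : Fin n} → x ≢ y → x ≢ z → y ≢ z → ∣ tri x y z ∣ ≡ 3
tri-size {n} {x} {y} {z} x≢y x≢z y≢z = trans (∣∣≡count (tri x y z)) (trans (count-∖-≡ p x (∈⇒lookup (∈-tri₁ x y z)))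
    (cong suc (trans (count-∖-≡ (p ∖ x) y (∖-true p (∈⇒lookup (∈-tri₂ x y z)) (x≢y ∘ sym)))
      (cong suc (trans (count-∖-≡ ((p ∖ x) ∖ y) z (∖-true (p ∖ x) (∖-true p (∈⇒lookup (∈-tri₃ x y z)) (x≢z ∘ sym)) (y≢z ∘ sym))) (cong suc (n≤0⇒n≡0 empty)))))))
  where
  p = Vec.lookup (tri x y z)
  out : ∀ {q : Fin n → Bool} {u a} → (q ∖ a) u ≡ true → u ≢ a
  out {q} {u} e refl = true≢false (==-refl u) (not-elim (∧-proj₂ {q u} e))
  empty : count (((p ∖ x) ∖ y) ∖ z) ≤ 0
  empty = sum-⟦⟧-≤ {f = ((p ∖ x) ∖ y) ∖ z} λ u e → ⊥-elim (case ∈-tri⁻ (lookup⇒∈ {τ = tri x y z} (∧-proj₁ {p u} (∧-proj₁ {(p ∖ x) u} (∧-proj₁ {((p ∖ x) ∖ y) u} e)))) of λ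
    { (inj₁ q) → out {p} (∧-proj₁ {(p ∖ x) u} (∧-proj₁ {((p ∖ x) ∖ y) u} e)) q
    ; (inj₂ (inj₁ q)) → out {p ∖ x} (∧-proj₁ {((p ∖ x) ∖ y) u} e) q
    ; (inj₂ (inj₂ q)) → out {(p ∖ x) ∖ y} e q })

sorted-unique : ∀ {n} {a b c a' b' c' : Fin n} → toℕ a < toℕ b → toℕ b < toℕ c → toℕ a' < toℕ b' → toℕ b' < toℕ c' →
  tri a b c ≡ tri a' b' c' → (a , b , c) ≡ (a' , b' , c')
sorted-unique {n} {a} {b} {c} {a'} {b'} {c'} ab bc ab' bc' e = cong₂ _,_ a≡ (cong₂ _,_ b≡ c≡)
  where
  lo : ∀ {a b c u : Fin n} → toℕ a < toℕ b → toℕ b < toℕ c → u ∈ₛ tri a b c → toℕ a ≤ toℕ u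
  lo ab bc h with ∈-tri⁻ h
  ... | inj₁ refl = ≤-refl
  ... | inj₂ (inj₁ refl) = <⇒≤ ab
  ... | inj₂ (inj₂ refl) = <⇒≤ (<-trans ab bc)
  hi : ∀ {a b c u : Fin n} → toℕ a < toℕ b → toℕ b < toℕ c → u ∈ₛ tri a b c → toℕ u ≤ toℕ c
  hi ab bc h with ∈-tri⁻ h
  ... | inj₁ refl = <⇒≤ (<-trans ab bc)
  ... | inj₂ (inj₁ refl) = <⇒≤ bc
  ... | inj₂ (inj₂ refl) = ≤-refl
  a≡ : a ≡ a'
  a≡ = Finₚ.toℕ-injective (≤-antisym (lo ab bc (subst (a' ∈ₛ_) (sym e) (∈-tri₁ a' b' c'))) (lo ab' bc' (subst (a ∈ₛ_) e (∈-tri₁ a b c))))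
  c≡ : c ≡ c'
  c≡ = Finₚ.toℕ-injective (≤-antisym (hi ab' bc' (subst (c ∈ₛ_) e (∈-tri₃ a b c))) (hi ab bc (subst (c' ∈ₛ_) (sym e) (∈-tri₃ a' b' c'))))
  b≡ : b ≡ b'
  b≡ with ∈-tri⁻ (subst (b ∈ₛ_) e (∈-tri₂ a b c))
  ... | inj₁ q = ⊥-elim (<-irrefl (cong toℕ (trans a≡ (sym q))) ab)
  ... | inj₂ (inj₁ q) = q
  ... | inj₂ (inj₂ q) = ⊥-elim (<-irrefl (cong toℕ (trans q (sym c≡))) bc)

triples-unique : ∀ n → Unique (triples n)
triples-unique n = subst Unique (sym (outer (allFin n))) (Uniqueₚ.cartesianProduct⁺ (Uniqueₚ.allFin⁺ n) (Uniqueₚ.cartesianProduct⁺ (Uniqueₚ.allFin⁺ n) (Uniqueₚ.allFin⁺ n)))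
  where
  inner : ∀ (a : Fin n) ys → concatMap (λ b → map (λ c → a , b , c) (allFin n)) ys ≡ map (a ,_) (cartesianProduct ys (allFin n))
  inner a [] = refl
  inner a (y ∷ ys) = trans (cong₂ _++_ (Listₚ.map-∘ (allFin n)) (inner a ys)) (sym (Listₚ.map-++ (a ,_) (map (y ,_) (allFin n)) _))
  outer : ∀ xs → concatMap (λ a → concatMap (λ b → map (λ c → a , b , c) (allFin n)) (allFin n)) xs ≡ cartesianProduct xs (cartesianProduct (allFin n) (allFin n))
  outer [] = refl
  outer (x ∷ xs) = cong₂ _++_ (inner x (allFin n)) (outer xs)

T⇒≡true : ∀ {b} → Data.Bool.T b → b ≡ true
T⇒≡true {true} _ = refl

-- The extremal colouring: transversal triples get distinct colours, the others the part in which they have two vertices.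
module Extremal (l n : ℕ) where
  open Turán (suc l) using (ℓ; cls)

  ok : Fin n × Fin n × Fin n → Bool
  ok (a , b , c) = (toℕ a <ᵇ toℕ b) ∧ (toℕ b <ᵇ toℕ c) ∧
    not ((toℕ a % ℓ) ≡ᵇ (toℕ b % ℓ)) ∧ not ((toℕ a % ℓ) ≡ᵇ (toℕ c % ℓ)) ∧
    not ((toℕ b % ℓ) ≡ᵇ (toℕ c % ℓ))

  L : List (Fin n × Fin n × Fin n)
  L = filterᵇ ok (triples n)

  M : ℕ
  M = t3 n ℓ

  at : Fin (length L) → Subset n
  at i = triple (lookup L i)

  ok-at : ∀ i → ok (lookup L i) ≡ true
  ok-at i = T⇒≡true (proj₂ (∈-filter⁻ (λ x → T? (ok x)) {xs = triples n} (∈-lookup i)))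

  ltᵇ : ∀ {x y} → (x <ᵇ y) ≡ true → x < y
  ltᵇ {x} {y} e = <ᵇ⇒< x y (subst Data.Bool.T (sym e) tt)

  cls≡⇒% : ∀ {x y : Fin n} → cls x ≡ cls y → toℕ x % ℓ ≡ toℕ y % ℓ
  cls≡⇒% {x} {y} e = trans (sym (Finₚ.toℕ-fromℕ< (m%n<n (toℕ x) ℓ))) (trans (cong toℕ e) (Finₚ.toℕ-fromℕ< (m%n<n (toℕ y) ℓ)))

  record Sorted (a b c : Fin n) : Set where
    field
      ab : toℕ a < toℕ b
      bc : toℕ b < toℕ c
      a≁b : cls a ≢ cls b
      a≁c : cls a ≢ cls c
      b≁c : cls b ≢ cls c

  ok⇒ : ∀ a b c → ok (a , b , c) ≡ true → Sorted a b c
  ok⇒ a b c e = record { ab = ltᵇ (∧-proj₁ {toℕ a <ᵇ toℕ b} e) ; bc = ltᵇ (∧-proj₁ {toℕ b <ᵇ toℕ c} h₁)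
      ; a≁b = λ h → apart {a} {b} h (∧-proj₁ {not ((toℕ a % ℓ) ≡ᵇ (toℕ b % ℓ))} h₂) ; a≁c = λ h → apart {a} {c} h (∧-proj₁ {not ((toℕ a % ℓ) ≡ᵇ (toℕ c % ℓ))} h₃)
      ; b≁c = λ h → apart {b} {c} h (∧-proj₂ {not ((toℕ a % ℓ) ≡ᵇ (toℕ c % ℓ))} h₃) }
    where
    h₁ = ∧-proj₂ {toℕ a <ᵇ toℕ b} e
    h₂ = ∧-proj₂ {toℕ b <ᵇ toℕ c} h₁
    h₃ = ∧-proj₂ {not ((toℕ a % ℓ) ≡ᵇ (toℕ b % ℓ))} h₂
    apart : ∀ {x y : Fin n} → cls x ≡ cls y → not ((toℕ x % ℓ) ≡ᵇ (toℕ y % ℓ)) ≡ true → ⊥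
    apart {x} {y} h e = true≢false (T⇒≡true (≡⇒≡ᵇ (toℕ x % ℓ) (toℕ y % ℓ) (cls≡⇒% {x} {y} h))) (not-elim e)

  va vb vc : Fin (length L) → Fin n
  va i = proj₁ (lookup L i)
  vb i = proj₁ (proj₂ (lookup L i))
  vc i = proj₂ (proj₂ (lookup L i))

  sorted-at : ∀ i → Sorted (va i) (vb i) (vc i)
  sorted-at i = ok⇒ (va i) (vb i) (vc i) (ok-at i)

  at-injective : ∀ {i i'} → at i ≡ at i' → i ≡ i'
  at-injective {i} {i'} e = unique-lookup (Uniqueₚ.filter⁺ (λ x → T? (ok x)) (triples-unique n))
    (sorted-unique (Sorted.ab (sorted-at i)) (Sorted.bc (sorted-at i)) (Sorted.ab (sorted-at i')) (Sorted.bc (sorted-at i')) e)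

  at-spread : ∀ i {x y} → x ∈ₛ at i → y ∈ₛ at i → x ≢ y → cls x ≢ cls y
  at-spread i x∈ y∈ x≢y e with ∈-tri⁻ x∈ | ∈-tri⁻ y∈ | sorted-at i
  ... | inj₁ refl | inj₁ refl | _ = x≢y refl
  ... | inj₁ refl | inj₂ (inj₁ refl) | s = Sorted.a≁b s e
  ... | inj₁ refl | inj₂ (inj₂ refl) | s = Sorted.a≁c s e
  ... | inj₂ (inj₁ refl) | inj₁ refl | s = Sorted.a≁b s (sym e)
  ... | inj₂ (inj₁ refl) | inj₂ (inj₁ refl) | _ = x≢y refl
  ... | inj₂ (inj₁ refl) | inj₂ (inj₂ refl) | s = Sorted.b≁c s e
  ... | inj₂ (inj₂ refl) | inj₁ refl | s = Sorted.a≁c s (sym e)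
  ... | inj₂ (inj₂ refl) | inj₂ (inj₁ refl) | s = Sorted.b≁c s (sym e)
  ... | inj₂ (inj₂ refl) | inj₂ (inj₂ refl) | _ = x≢y refl

  inClass : Subset n → Fin ℓ → Fin n → Bool
  inClass τ r x = Vec.lookup τ x ∧ (cls x == r)

  -- Colours below `M` are positions in the list of transversal triples, and `M + r` belongs to
  -- class `r`. The default 0 is never reached by a set of three vertices.
  χ₀ : Subset n → ℕ
  χ₀ τ with Finₚ.any? (λ i → at i ≟ₛ τ)
  ... | yes (i , _) = toℕ i
  ... | no _ with Finₚ.any? (λ r → 2 ≤? count (inClass τ r))
  ...   | yes (r , _) = M + toℕ r
  ...   | no _ = 0

  χ₀-at : ∀ i → χ₀ (at i) ≡ toℕ i
  χ₀-at i with Finₚ.any? (λ i' → at i' ≟ₛ at i)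
  ... | yes (i' , e) = cong toℕ (at-injective e)
  ... | no none = ⊥-elim (none (i , refl))

  -- A transversal set cannot contain both `x` and `y`, and a class other than theirs contains at
  -- most `z`, so the search can only return the class of `x`.
  χ₀-inner : ∀ {x y z} → x ≢ y → cls x ≡ cls y → χ₀ (tri x y z) ≡ M + toℕ (cls x)
  χ₀-inner {x} {y} {z} x≢y e with Finₚ.any? (λ i → at i ≟ₛ tri x y z)
  ... | yes (i , q) = ⊥-elim (at-spread i (subst (x ∈ₛ_) (sym q) (∈-tri₁ x y z)) (subst (y ∈ₛ_) (sym q) (∈-tri₂ x y z)) x≢y e)
  ... | no _ with Finₚ.any? (λ r → 2 ≤? count (inClass (tri x y z) r))
  ...   | no none = ⊥-elim (none (cls x , both))
    where
    p = inClass (tri x y z) (cls x)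
    px : p x ≡ true
    px = ∧-intro (∈⇒lookup (∈-tri₁ x y z)) (==-refl (cls x))
    py : p y ≡ true
    py = ∧-intro (∈⇒lookup (∈-tri₂ x y z)) (trans (cong (_== cls x) (sym e)) (==-refl (cls x)))
    both : 2 ≤ count p
    both = ≤-trans (s≤s (count-pos {p = p ∖ x} y (∖-true p py (x≢y ∘ sym)))) (≤-reflexive (sym (count-∖-≡ p x px)))
  ...   | yes (r , h) with r Finₚ.≟ cls x
  ...     | yes r≡ = cong (λ k → M + toℕ k) r≡
  ...     | no r≢ = ⊥-elim (<⇒≱ h (count≤1 λ a b pa pb → trans (only a pa) (sym (only b pb))))
    where
    only : ∀ a → inClass (tri x y z) r a ≡ true → a ≡ z
    only a pa with ∈-tri⁻ (lookup⇒∈ {τ = tri x y z} (∧-proj₁ {Vec.lookup (tri x y z) a} pa)) | ==⇒≡ {x = cls a} {r} (∧-proj₂ {Vec.lookup (tri x y z) a} pa)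
    ... | inj₁ refl | q = ⊥-elim (r≢ (sym q))
    ... | inj₂ (inj₁ refl) | q = ⊥-elim (r≢ (trans (sym q) (sym e)))
    ... | inj₂ (inj₂ q') | _ = q'

  -- Merging all colours from m′ on keeps the colouring free of rainbow copies.
  χ : ∀ m′ → Coloring n (suc m′)
  χ m′ τ = fromℕ< (s≤s (m⊓n≤n (χ₀ τ) m′))

  toℕ-χ : ∀ m′ τ → toℕ (χ m′ τ) ≡ χ₀ τ ⊓ m′
  toℕ-χ m′ τ = Finₚ.toℕ-fromℕ< (s≤s (m⊓n≤n (χ₀ τ) m′))

  -- The bound on `n` provides `r`, `r + ℓ` and `r + 2ℓ`, hence a triple inside each class `r`;
  -- truncation at `m′` leaves the colours up to `m′` unchanged.
  surjective : 3 * ℓ ≤ n → ∀ m′ → m′ < M + ℓ → Surjective3 (χ m′)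
  surjective 3ℓ≤n m′ m′< c = proj₁ hit , proj₁ (proj₂ hit) , Finₚ.toℕ-injective (trans (toℕ-χ m′ (proj₁ hit)) (trans (cong (_⊓ m′) (proj₂ (proj₂ hit))) (m≤n⇒m⊓n≡m (≤-pred (Finₚ.toℕ<n c)))))
    where
    vertex : ∀ k → k < 3 * ℓ → Fin n
    vertex k h = fromℕ< (<-≤-trans h 3ℓ≤n)
    fromClass : ∀ r → r < ℓ → ∃ λ τ → ∣ τ ∣ ≡ 3 × χ₀ τ ≡ M + r
    fromClass r r<ℓ = tri x y z , tri-size x≢y x≢z y≢z , trans (χ₀-inner {z = z} x≢y (Finₚ.toℕ-injective (trans cx (sym cy)))) (cong (M +_) cx)
      where
      bound : ∀ k → k ≤ 2 → r + k * ℓ < 3 * ℓ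
      bound k k≤2 = +-mono-<-≤ r<ℓ (*-monoˡ-≤ ℓ k≤2)
      x = vertex (r + 0 * ℓ) (bound 0 z≤n)
      y = vertex (r + 1 * ℓ) (bound 1 (s≤s z≤n))
      z = vertex (r + 2 * ℓ) (bound 2 ≤-refl)
      tox : ∀ k (k≤2 : k ≤ 2) → toℕ (vertex (r + k * ℓ) (bound k k≤2)) ≡ r + k * ℓ
      tox k k≤2 = Finₚ.toℕ-fromℕ< (<-≤-trans (bound k k≤2) 3ℓ≤n)
      cl : ∀ k (k≤2 : k ≤ 2) → toℕ (cls (vertex (r + k * ℓ) (bound k k≤2))) ≡ r
      cl k k≤2 = trans (Finₚ.toℕ-fromℕ< (m%n<n (toℕ (vertex (r + k * ℓ) (bound k k≤2))) ℓ)) (trans (cong (_% ℓ) (tox k k≤2)) (trans ([m+kn]%n≡m%n r k ℓ) (m<n⇒m%n≡m r<ℓ)))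
      cx : toℕ (cls x) ≡ r
      cx = cl 0 z≤n
      cy : toℕ (cls y) ≡ r
      cy = cl 1 (s≤s z≤n)
      differ : ∀ {k k'} (h : k ≤ 2) (h' : k' ≤ 2) → k ≢ k' → vertex (r + k * ℓ) (bound k h) ≢ vertex (r + k' * ℓ) (bound k' h')
      differ {k} {k'} h h' ne e = ne (*-cancelʳ-≡ k k' ℓ (+-cancelˡ-≡ r _ _ (trans (sym (tox k h)) (trans (cong toℕ e) (tox k' h')))))
      x≢y : x ≢ y
      x≢y = differ z≤n (s≤s z≤n) (λ ())
      x≢z : x ≢ z
      x≢z = differ z≤n ≤-refl (λ ())
      y≢z : y ≢ z
      y≢z = differ (s≤s z≤n) ≤-refl (λ ())
    hit : ∃ λ τ → ∣ τ ∣ ≡ 3 × χ₀ τ ≡ toℕ c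
    hit with toℕ c <? M
    ... | yes h = at i , size , trans (χ₀-at i) (Finₚ.toℕ-fromℕ< h)
      where
      i : Fin (length L)
      i = fromℕ< h
      size : ∣ at i ∣ ≡ 3
      size = tri-size {x = va i} {vb i} {vc i} (λ q → Sorted.a≁b (sorted-at i) (cong cls q)) (λ q → Sorted.a≁c (sorted-at i) (cong cls q)) (λ q → Sorted.b≁c (sorted-at i) (cong cls q))
    ... | no ¬h with slack (≮⇒≥ ¬h)
    ... | r , eq = case fromClass r (+-cancelˡ-< M r ℓ (≤-trans (s≤s (≤-trans (≤-reflexive (sym eq)) (≤-pred (Finₚ.toℕ<n c)))) m′<)) of λ { (τ , s3 , q) → τ , s3 , trans q (sym eq) }

-- Counterpart of `IsCore`: there the graph may have no edges but those of the core, here these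
-- edges have to be present.
record HasCore (Γ : Graph) (v : Variant) (l t' : ℕ) : Set where
  field
    place : Pos (2 + l) (4 + t') → Fin (Graph.nv Γ)
    place-injective : ∀ {p q} → place p ≡ place q → p ≡ q

  EdgeAt : Pos (2 + l) (4 + t') → Pos (2 + l) (4 + t') → Fin (length (Graph.edges Γ)) → Set
  EdgeAt p q i = lookup (Graph.edges Γ) i ≡ (place p , place q)

  field
    cross-edge : ∀ p q → proj₁ p ≢ proj₁ q → ∃ λ i → EdgeAt p q i ⊎ EdgeAt q p i
    edge₁ : ∃ λ i → EdgeAt (proj₁ e₁) (proj₂ e₁) i
    edge₂ : ∃ λ i → EdgeAt (proj₁ (e₂ v)) (proj₂ (e₂ v)) i

surjection : ∀ {k} (G : Fin k → Fin k) → (∀ p q → G p ≡ G q → p ≡ q) → ∀ c → ∃ λ p → c ≡ G p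
surjection {k} G inj c = go (Finₚ.pigeonhole (n<1+n k) F)
  where
  F : Fin (suc k) → Fin k
  F zero = c
  F (suc p) = G p
  go : (∃ λ i → ∃ λ i' → toℕ i < toℕ i' × F i ≡ F i') → ∃ λ p → c ≡ G p
  go (zero , suc p , _ , e) = p , e
  go (suc p , suc p' , s≤s lt , e) = ⊥-elim (<-irrefl (cong toℕ (inj p p' e)) lt)

-- The class map f must be constant on each part of K_ℓ[t], hence constant on both ends of each extra edge.
module NoRainbow (v : Variant) (l t' n : ℕ) (Γ : Graph) (core : HasCore Γ v (suc l) t') (ℓ<t : (3 + l) < (4 + t'))
  (M m′ : ℕ) (m′< : m′ < M + extraColours v (3 + l)) (cls : Fin n → Fin (3 + l)) (χ : Coloring n (suc m′))
  (χ-inner : ∀ {x y z} → x ≢ y → cls x ≡ cls y → toℕ (χ (tri x y z)) ≡ (M + toℕ (cls x)) ⊓ m′)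
  (φ : Fin (Graph.nv Γ + length (Graph.edges Γ)) → Fin n) (φ-inj : ∀ {x y} → φ x ≡ φ y → x ≡ y) where
  open HasCore core

  private
    ℓ t nv ne : ℕ
    ℓ = (3 + l)
    t = (4 + t')
    nv = Graph.nv Γ
    ne = length (Graph.edges Γ)

  colour : Fin ne → Fin (suc m′)
  colour i = χ (triple (φ (proj₁ (lookup (Graph.edges Γ) i) ↑ˡ ne) , φ (proj₂ (lookup (Graph.edges Γ) i) ↑ˡ ne) , φ (nv ↑ʳ i)))

  module _ (distinct : ∀ i k → i ≢ k → colour i ≢ colour k) where
    f : Pos ℓ t → Fin ℓ
    f p = cls (φ (place p ↑ˡ ne))

    Clash : Fin ℓ → Fin ℓ → Set
    Clash r r′ = (M + toℕ r) ⊓ m′ ≡ (M + toℕ r′) ⊓ m′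

    mono : ∀ {i p q} → p ≢ q → f p ≡ f q → EdgeAt p q i → toℕ (colour i) ≡ (M + toℕ (f p)) ⊓ m′
    mono {i} {p} {q} p≢q e eq = trans
      (cong (λ xy → toℕ (χ (tri (φ (proj₁ xy ↑ˡ ne)) (φ (proj₂ xy ↑ˡ ne)) (φ (nv ↑ʳ i))))) eq)
      (χ-inner {z = φ (nv ↑ʳ i)} (λ h → p≢q (place-injective (Finₚ.↑ˡ-injective ne _ _ (φ-inj h)))) e)

    -- Two cross edges from `x` inside one class would receive the same colour.
    star : ∀ x y y′ → proj₁ x ≢ proj₁ y → proj₁ x ≢ proj₁ y′ → y ≢ y′ → f x ≡ f y → f x ≡ f y′ → ⊥
    star x y y′ xy xy′ y≢ e e′ with cross-edge x y xy | cross-edge x y′ xy′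
    ... | i , h | i′ , h′ = distinct i i′ (λ { refl → y≢ (other h h′) }) (Finₚ.toℕ-injective (trans (col xy e h) (sym (col xy′ e′ h′))))
      where
      col : ∀ {y i} → proj₁ x ≢ proj₁ y → f x ≡ f y → EdgeAt x y i ⊎ EdgeAt y x i →
        toℕ (colour i) ≡ (M + toℕ (f x)) ⊓ m′
      col ne e (inj₁ h) = mono (ne ∘ cong proj₁) e h
      col ne e (inj₂ h) = trans (mono (ne ∘ cong proj₁ ∘ sym) (sym e) h) (cong (λ r → (M + toℕ r) ⊓ m′) (sym e))
      other : ∀ {i} → EdgeAt x y i ⊎ EdgeAt y x i →
        EdgeAt x y′ i ⊎ EdgeAt y′ x i → y ≡ y′
      other (inj₁ h) (inj₁ h′) = place-injective (cong proj₂ (trans (sym h) h′))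
      other (inj₁ h) (inj₂ h′) = ⊥-elim (xy′ (cong proj₁ (place-injective (cong proj₁ (trans (sym h) h′)))))
      other (inj₂ h) (inj₁ h′) = ⊥-elim (xy (cong proj₁ (sym (place-injective (cong proj₁ (trans (sym h) h′))))))
      other (inj₂ h) (inj₂ h′) = place-injective (cong proj₁ (trans (sym h) h′))

    -- This is where `t > ℓ` enters: some class is met twice by part `p`. By `star`, no vertex of
    -- another part can then lie in that class.
    repeat : ∀ p → ∃ λ r → ∃ λ r′ → r ≢ r′ × f (p , r) ≡ f (p , r′)
    repeat p = case Finₚ.pigeonhole ℓ<t (λ r → f (p , r)) of λ { (r , r′ , lt , e) → r , r′ , (λ q → <-irrefl (cong toℕ q) lt) , e }

    G : Fin ℓ → Fin ℓ
    G p = f (p , proj₁ (repeat p))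

    pair : ∀ x p → proj₁ x ≢ p → f x ≢ G p
    pair x p ne e = star x (p , proj₁ (repeat p)) (p , proj₁ (proj₂ (repeat p))) ne ne
      (λ q → proj₁ (proj₂ (proj₂ (repeat p))) (cong proj₂ q)) e (trans e (proj₂ (proj₂ (proj₂ (repeat p)))))

    G-inj : ∀ p q → G p ≡ G q → p ≡ q
    G-inj p q e with p Finₚ.≟ q
    ... | yes h = h
    ... | no ne = ⊥-elim (pair (p , proj₁ (repeat p)) q ne e)

    -- The classes `G p` are distinct, hence they are all ℓ classes. So the class of `x` is some
    -- `G p`, and `pair` rules out every `p` but the part of `x`.
    constant : ∀ x → f x ≡ G (proj₁ x)
    constant x with surjection G G-inj (f x)
    ... | p , e with proj₁ x Finₚ.≟ p
    ... | yes refl = e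
    ... | no ne = ⊥-elim (pair x p ne e)

    extraClash : ∀ p q p′ q′ → proj₁ p ≡ proj₁ q → proj₁ p′ ≡ proj₁ q′ → p ≢ q → p′ ≢ q′ → (p , q) ≢ (p′ , q′) →
      Clash (G (proj₁ p)) (G (proj₁ p′)) →
      (∃ λ i → EdgeAt p q i) → (∃ λ i → EdgeAt p′ q′ i) → ⊥
    extraClash p q p′ q′ pq pq′ p≢q p≢q′ ne clash (i , h) (i′ , h′) = distinct i i′
        (λ { refl → ne (cong₂ _,_ (place-injective (cong proj₁ (trans (sym h) h′))) (place-injective (cong proj₂ (trans (sym h) h′)))) })
        (Finₚ.toℕ-injective (trans (side p q pq p≢q h) (trans clash (sym (side p′ q′ pq′ p≢q′ h′)))))
      where
      side : ∀ p q {i} → proj₁ p ≡ proj₁ q → p ≢ q → EdgeAt p q i → toℕ (colour i) ≡ (M + toℕ (G (proj₁ p))) ⊓ m′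
      side p q pq p≢q h = trans (mono p≢q (trans (constant p) (trans (cong G pq) (sym (constant q)))) h) (cong (λ r → (M + toℕ r) ⊓ m′) (constant p))

    -- For `γ` the bound on `m′` gives `m′ ≤ M`, so truncation merges the colours of all classes.
    clash-γ : v ≡ γ → ∀ r r′ → Clash r r′
    clash-γ refl r r′ = trans (m≥n⇒m⊓n≡n (above r)) (sym (m≥n⇒m⊓n≡n (above r′)))
      where
      above : ∀ (r : Fin ℓ) → m′ ≤ M + toℕ r
      above r = ≤-trans (≤-pred (≤-trans m′< (≤-reflexive (+-comm M 1)))) (m≤m+n M (toℕ r))

    impossible : v ≢ plain → ⊥
    impossible v≢ = go v refl edge₂
      where
      go : ∀ u → v ≡ u → (∃ λ i → EdgeAt (proj₁ (e₂ u)) (proj₂ (e₂ u)) i) → ⊥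
      go plain e _ = v≢ e
      go α refl h = extraClash _ _ _ _ refl refl (λ ()) (λ ()) (λ ()) refl edge₁ h
      go β refl h = extraClash _ _ _ _ refl refl (λ ()) (λ ()) (λ ()) refl edge₁ h
      go γ refl h = extraClash _ _ _ _ refl refl (λ ()) (λ ()) (λ ()) (clash-γ refl _ _) edge₁ h

-- The blow-ups contain the edges of the core

blowAdj-intro : ∀ v {l t'} (x y : Fin ((2 + l) * (4 + t'))) → v ≢ plain → toℕ x < toℕ y →
  proj₁ (pos {l} {t'} x) ≢ proj₁ (pos {l} {t'} y) ⊎ (pos {l} {t'} x , pos {l} {t'} y) ≡ e₁ ⊎ (pos {l} {t'} x , pos {l} {t'} y) ≡ e₂ v →
  blowAdj v (2 + l) (4 + t') x y ≡ true
blowAdj-intro v {l} {t'} x y v≢ x<y h = ∧-intro (T⇒≡true (<⇒<ᵇ x<y)) (go h)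
  where
  shape : Pos (2 + l) (4 + t') → Pos (2 + l) (4 + t') → Bool
  shape (a , i) (b , k) = not (toℕ a ≡ᵇ toℕ b) ∨ extra v (toℕ a) (toℕ b) (toℕ i) (toℕ k)
  first : ∀ v → v ≢ plain → extra v 0 0 0 1 ≡ true
  first plain ne = ⊥-elim (ne refl)
  first α _ = refl
  first β _ = refl
  first γ _ = refl
  second : ∀ u → v ≡ u → shape (proj₁ (e₂ u)) (proj₂ (e₂ u)) ≡ true
  second plain e = ⊥-elim (v≢ e)
  second α refl = refl
  second β refl = refl
  second γ refl = refl
  go : _ → shape (pos x) (pos y) ≡ true
  go (inj₁ ne) = ∨-introˡ (not-intro (neq λ e → ne (Finₚ.toℕ-injective e)))
    where
    neq : ∀ {a b} → a ≢ b → (a ≡ᵇ b) ≡ false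
    neq {a} {b} ne with a ≡ᵇ b in e
    ... | false = refl
    ... | true = ⊥-elim (ne (eqᵇ e))
  go (inj₂ (inj₁ e)) = trans (cong (λ pq → shape (proj₁ pq) (proj₂ pq)) e) (first v v≢)
  go (inj₂ (inj₂ e)) = trans (cong (λ pq → shape (proj₁ pq) (proj₂ pq)) e) (second v refl)

edge-index : ∀ v ℓ t x y → blowAdj v ℓ t x y ≡ true → ∃ λ i → lookup (edgesOf v ℓ t) i ≡ (x , y)
edge-index v ℓ t x y e = index mem , sym (lookup-index mem)
  where
  mem : (x , y) ∈ edgesOf v ℓ t
  mem = ∈-filter⁺ (λ xy → T? (blowAdj v ℓ t (proj₁ xy) (proj₂ xy))) (subst ((x , y) ∈_) (sym (allPairs≡ (ℓ * t))) (∈-cartesianProduct⁺ (∈-allFin x) (∈-allFin y))) (subst Data.Bool.T (sym e) tt)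

hasCore : ∀ v l t' → v ≢ plain → HasCore (blowup v (2 + l) (4 + t')) v l t'
hasCore v l t' v≢ = record
  { place = place ; place-injective = λ {p} {q} e → trans (sym (pos-place p)) (trans (cong pos e) (pos-place q))
  ; cross-edge = cross
  ; edge₁ = edge-index v ℓ t _ _ (blowAdj-intro v {l} {t'} (place (proj₁ e₁)) (place (proj₂ e₁)) v≢ (order zero zero 1F (s≤s z≤n)) (inj₂ (inj₁ (cong₂ _,_ (pos-place (proj₁ e₁)) (pos-place (proj₂ e₁))))))
  ; edge₂ = edge-index v ℓ t _ _ (blowAdj-intro v {l} {t'} (place (proj₁ (e₂ v))) (place (proj₂ (e₂ v))) v≢ (order₂ v) (inj₂ (inj₂ (cong₂ _,_ (pos-place (proj₁ (e₂ v))) (pos-place (proj₂ (e₂ v))))))) }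
  where
  ℓ t : ℕ
  ℓ = (2 + l)
  t = (4 + t')
  place : Pos ℓ t → Fin (ℓ * t)
  place (p , r) = combine p r
  pos-place : ∀ p → pos {l} {t'} (place p) ≡ p
  pos-place (p , r) = Finₚ.remQuot-combine {ℓ} {t} p r
  order : ∀ (p : Fin ℓ) (r r′ : Fin t) → toℕ r < toℕ r′ → toℕ (place (p , r)) < toℕ (place (p , r′))
  order p r r′ h = subst₂ _<_ (sym (Finₚ.toℕ-combine p r)) (sym (Finₚ.toℕ-combine p r′)) (+-monoʳ-< (t * toℕ p) h)
  order₂ : ∀ u → toℕ (place (proj₁ (e₂ {l} {t'} u))) < toℕ (place (proj₂ (e₂ {l} {t'} u)))
  order₂ plain = order zero 1F 2F (s≤s (s≤s z≤n))
  order₂ α = order zero 1F 2F (s≤s (s≤s z≤n))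
  order₂ β = order zero 2F 3F (s≤s (s≤s (s≤s z≤n)))
  order₂ γ = order 1F zero 1F (s≤s z≤n)
  cross : ∀ p q → proj₁ p ≢ proj₁ q → ∃ λ i → lookup (edgesOf v ℓ t) i ≡ (place p , place q) ⊎ lookup (edgesOf v ℓ t) i ≡ (place q , place p)
  cross p q ne with <-cmp (toℕ (place p)) (toℕ (place q))
  ... | tri< h _ _ = case edge-index v ℓ t (place p) (place q) (blowAdj-intro v {l} {t'} (place p) (place q) v≢ h (inj₁ (λ e → ne (trans (cong proj₁ (sym (pos-place p))) (trans e (cong proj₁ (pos-place q))))))) of λ { (i , e) → i , inj₁ e }
  ... | tri≈ _ h _ = ⊥-elim (ne (cong proj₁ (trans (sym (pos-place p)) (trans (cong pos (Finₚ.toℕ-injective h)) (pos-place q)))))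
  ... | tri> _ _ h = case edge-index v ℓ t (place q) (place p) (blowAdj-intro v {l} {t'} (place q) (place p) v≢ h (inj₁ (λ e → ne (sym (trans (cong proj₁ (sym (pos-place q))) (trans e (cong proj₁ (pos-place p)))))))) of λ { (i , e) → i , inj₂ e }

extraColours≤ : ∀ v k → extraColours v (suc k) ≤ suc k
extraColours≤ plain k = ≤-refl
extraColours≤ α k = ≤-refl
extraColours≤ β k = ≤-refl
extraColours≤ γ k = s≤s z≤n

lower : ∀ v l t' Γ → HasCore Γ v (suc l) t' → v ≢ plain → (3 + l) < (4 + t') → ∀ n → 3 * (3 + l) ≤ n →
  ∀ m → 1 ≤ m → m < t3 n (3 + l) + extraColours v (3 + l) + 1 → ¬ ArProperty n (expansion Γ) m
lower v l t' Γ core v≢ ℓ<t n 3ℓ≤n (suc m′) _ m< ar = go (ar (χ m′) (surjective 3ℓ≤n m′ (≤-trans m′< (+-monoʳ-≤ (t3 n (3 + l)) (extraColours≤ v (2 + l))))))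
  where
  open Extremal l n
  m′< : m′ < t3 n (3 + l) + extraColours v (3 + l)
  m′< = ≤-pred (≤-trans m< (≤-reflexive (+-comm _ 1)))
  go : RainbowCopy (χ m′) (expansion Γ) → ⊥
  go (φ , φ-inj , distinct) = NoRainbow.impossible v l t' n Γ core ℓ<t (t3 n (3 + l)) m′ m′< (Turán.cls (suc l)) (χ m′)
    (λ {x} {y} {z} x≢y e → trans (toℕ-χ m′ (tri x y z)) (cong (_⊓ m′) (χ₀-inner {z = z} x≢y e))) φ φ-inj distinct v≢

isAr : ∀ v l t' → v ≢ plain → (3 + l) < (4 + t') → ∃ λ N → ∀ n → N ≤ n →
  IsAr n (expansion (blowup v (3 + l) (4 + t')))
    (t3 n (3 + l) + extraColours v (3 + l) + 1)
isAr v l t' v≢ ℓ<t = proj₁ up + 3 * (3 + l) , λ n N≤n →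
    m≤n+m 1 _ , proj₂ up n (≤-trans (m≤m+n (proj₁ up) _) N≤n) , lower v l t' _ (hasCore v (suc l) t' v≢) v≢ ℓ<t n (≤-trans (m≤n+m _ (proj₁ up)) N≤n)
  where
  up = Upper.upper v l t' (blowup v (3 + l) (4 + t')) (isCore v (suc l) t')

theorem1p4 : (t ℓ : ℕ) → 3 ≤ ℓ → ℓ < t →
    ∃ λ (N : ℕ) → ∀ (n : ℕ) → N ≤ n →
    IsAr n (expansion (blowup α ℓ t)) (t3 n ℓ + ℓ + 1) ×
    IsAr n (expansion (blowup β ℓ t)) (t3 n ℓ + ℓ + 1) ×
    IsAr n (expansion (blowup γ ℓ t)) (t3 n ℓ + 2)
theorem1p4 (suc (suc (suc (suc t')))) (suc (suc (suc l))) 3≤ℓ@(s≤s (s≤s (s≤s z≤n))) ℓ<t@(s≤s (s≤s (s≤s (s≤s _)))) =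
  proj₁ a + (proj₁ b + proj₁ c) , λ n N≤n →
    proj₂ a n (≤-trans (m≤m+n (proj₁ a) _) N≤n) ,
    proj₂ b n (≤-trans (≤-trans (m≤m+n (proj₁ b) (proj₁ c)) (m≤n+m _ (proj₁ a))) N≤n) ,
    subst (IsAr n (expansion (blowup γ (suc (suc (suc l))) (suc (suc (suc (suc t'))))))) (+-assoc (t3 n (suc (suc (suc l)))) 1 1)
      (proj₂ c n (≤-trans (≤-trans (m≤n+m (proj₁ c) (proj₁ b)) (m≤n+m _ (proj₁ a))) N≤n))
  where
  a = isAr α l t' (λ ()) ℓ<t
  b = isAr β l t' (λ ()) ℓ<t
  c = isAr γ l t' (λ ()) ℓ<t
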